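{- Let $n\ge 1$ and let $B_n$ be the bouquet of $n$ loops, represented as the simple graph with a central vertex $c$ and, for each $i=1,\dots,n$, two vertices $a_i,a_i'$ with edges $ca_i$, $a_ia_i'$, $a_i'c$. Let its automorphism group be $\Gamma=E_1\times S_n[C_2]$, the group of permutations of the $2n+1$ vertices fixing $c$ and mapping each pair $\{a_i,a_i'\}$ onto some pair $\{a_j,a_j'\}$ (order $2^nn!$). For a divisor $d$ of $2n$, the number $i_d$ of unlabeled imbeddings of $B_n$ that are $d$-fold symmetric, i.e. whose map-automorphism group is cyclic of order $d$ (the group $E_1\times C_d[E_{2n/d}]$), is \[ i_d=d\sum_{k:\ d\mid k,\ k\mid 2n} f(n,k)\,\mu(k/d),\] where $f(n,k)=A(n,k)+B(n,k)$ with \[A(n,k)=\begin{cases}\dfrac{(2n/k)!\,(k/2)^{n/k}}{2n\,(n/k)!}& k\mid n,\\ 0 & k\nmid n,\end{cases}\qquad B(n,k)=\begin{cases}\dfrac1{2n}\displaystyle\sum_{m=0}^{\lfloor (n-1)/k\rfloor}\frac{(2n/k)!\,(k/2)^m}{(2n/k-2m)!\,m!}& k\text{ even},\\ 0& k\text{ odd},\end{cases}\] and $\mu$ is the Möbius function.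
   Context: A rotation at a vertex $v$ is a cyclic permutation of its neighborhood $N(v)$ (a single cycle through all of $N(v)$); a map is $M=(B_n,\rho)$ with $\rho=\{\rho_v\}$ a rotation system (so only the rotation at $c$, a cyclic ordering of the $2n$ vertices $a_i,a_i'$, is a genuine choice). The group $\Gamma$ acts on maps by $\rho\mapsto\rho'$ with $\rho'_{\gamma(v)}=\gamma\rho_v\gamma^{ -1}$; the stabilizer of $M$ in $\Gamma$ is the map-automorphism group $\Gamma_M$, and the $\Gamma$-orbits of maps are the unlabeled imbeddings. -}

module Defs where

open import Data.Nat as ℕ using (ℕ; zero; suc; _∸_; _!; _≤_)
open import Data.Nat.Divisibility using (_∣_; _∣?_)
open import Data.Nat.Primality using (Prime; prime?)
open import Data.Nat.DivMod as DM using ()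
open import Data.Integer as ℤ using (ℤ; +_)
open import Data.Rational as ℚ using (ℚ; 0ℚ; 1ℚ)
open import Data.Fin using (Fin)
open import Data.Bool using (Bool; true; false; if_then_else_)
open import Data.List using (List; []; _∷_; map; upTo; filter; length; foldr)
open import Data.List.Relation.Unary.All using (All)
open import Data.List.Relation.Unary.Any using (Any)
open import Data.List.Relation.Unary.AllPairs using (AllPairs)
open import Data.Product using (Σ; ∃; _×_; _,_)
open import Data.Sum using (_⊎_)
open import Relation.Nullary using (¬_; Dec; yes; no; does)
open import Relation.Nullary.Decidable using (⌊_⌋)
open import Relation.Unary using (Decidable)
open import Relation.Binary.PropositionalEquality using (_≡_)
open import Function using (_∘_)

record Perm (X : Set) : Set where
  field
    to    : X → X
    from  : X → X
    to∘from : ∀ x → to (from x) ≡ x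
    from∘to : ∀ x → from (to x) ≡ x
open Perm public

iterate : {X : Set} → (X → X) → ℕ → X → X
iterate f zero    x = x
iterate f (suc k) x = f (iterate f k x)

-- The bouquet B_n as a simple graph: central vertex c, and for each
-- i : Fin n the two vertices a i, a' i, with edges c–a i, a i–a' i, a' i–c.

data Vertex (n : ℕ) : Set where
  c  : Vertex n
  a  : Fin n → Vertex n
  a' : Fin n → Vertex n

Nc : ℕ → Set
Nc n = Fin n × Bool

nb : ∀ {n} → Nc n → Vertex n
nb (i , false) = a i
nb (i , true)  = a' i

-- Maps.  The rotation at a_i (resp. a_i') is a cyclic permutation of the
-- 2-element set {c, a_i'} (resp. {c, a_i}), hence uniquely determined; so
-- a map M = (B_n , ρ) is determined by ρ_c, a cyclic permutation (single
-- cycle) of N(c).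

IsCyclicPerm : {X : Set} → Perm X → Set
IsCyclicPerm {X} σ = ∀ (x y : X) → ∃ λ k → iterate (to σ) k x ≡ y

record Map (n : ℕ) : Set where
  field
    ρc     : Perm (Nc n)
    cyclic : IsCyclicPerm ρc
open Map public

-- ρ_c extended to a function on all vertices (c is sent to itself;
-- only the values on N(c) matter below).
ρ̂ : ∀ {n} → Map n → Vertex n → Vertex n
ρ̂ M c      = c
ρ̂ M (a i)  = nb (to (ρc M) (i , false))
ρ̂ M (a' i) = nb (to (ρc M) (i , true))

record Γ (n : ℕ) : Set where
  field
    perm  : Perm (Vertex n)
    fix-c : to perm c ≡ c
    pairs : ∀ i → ∃ λ j →
              (to perm (a i) ≡ a j  × to perm (a' i) ≡ a' j)
            ⊎ (to perm (a i) ≡ a' j × to perm (a' i) ≡ a j)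
open Γ public

_≈Γ_ : ∀ {n} → Γ n → Γ n → Set
g ≈Γ h = ∀ v → to (perm g) v ≡ to (perm h) v

_^Γ_≈id : ∀ {n} → Γ n → ℕ → Set
g ^Γ k ≈id = ∀ v → iterate (to (perm g)) k v ≡ v

-- Action: γ sends M to M'  iff  ρ'_{γ(c)} = γ ρ_c γ⁻¹, i.e. (as γ c = c)
-- ρ'_c (γ v) = γ (ρ_c v) for every v ∈ N(c).
_·_↦_ : ∀ {n} → Γ n → Map n → Map n → Set
γ · M ↦ M' = ∀ (x : Nc _) → ρ̂ M' (to (perm γ) (nb x)) ≡ to (perm γ) (ρ̂ M (nb x))

InStab : ∀ {n} → Map n → Γ n → Set
InStab M γ = γ · M ↦ M

StabCyclicOfOrder : ∀ {n} → ℕ → Map n → Set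
StabCyclicOfOrder {n} d M =
  Σ (Γ n) λ g → InStab M g
    × (∀ h → InStab M h → ∃ λ k → ∀ v → to (perm h) v ≡ iterate (to (perm g)) k v)
    × (g ^Γ d ≈id)
    × (∀ k → 1 ≤ k → k ℕ.< d → ¬ (g ^Γ k ≈id))
    × (1 ≤ d)

SameOrbit : ∀ {n} → Map n → Map n → Set
SameOrbit {n} M M' = ∃ λ (γ : Γ n) → γ · M ↦ M'

-- k is the number of unlabeled imbeddings (Γ-orbits of maps) that are
-- d-fold symmetric: there is a list of exactly k such maps, pairwise in
-- different orbits, such that every d-fold symmetric map lies in the orbit
-- of one of them.
NumSymmetricImbeddings : (n d k : ℕ) → Set
NumSymmetricImbeddings n d k =
  ∃ λ (reps : List (Map n)) →
      length reps ≡ k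
    × All (StabCyclicOfOrder d) reps
    × AllPairs (λ M M' → ¬ SameOrbit M M') reps
    × (∀ M → StabCyclicOfOrder d M → Any (SameOrbit M) reps)

-- natural division, with the (never used) convention m / 0 = 0
_div_ : ℕ → ℕ → ℕ
m div zero    = 0
m div (suc d) = m DM./ suc d

⟦_⟧ : ℕ → ℚ
⟦ m ⟧ = + m ℚ./ 1

-- 1/m as rational, convention 1/0 = 0 (never used)
inv : ℕ → ℚ
inv zero    = 0ℚ
inv (suc m) = + 1 ℚ./ suc m

_^ℚ_ : ℚ → ℕ → ℚ
q ^ℚ zero  = 1ℚ
q ^ℚ suc k = q ℚ.* (q ^ℚ k)

sumℚ : List ℚ → ℚ
sumℚ = foldr ℚ._+_ 0ℚ

sumTo : ℕ → (ℕ → ℚ) → ℚ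
sumTo M g = sumℚ (map g (upTo (suc M)))

primeDivisors : ℕ → List ℕ
primeDivisors m = filter (λ p → prime? p Relation.Nullary.×-dec (p ∣? m)) (upTo (suc m))
  where import Relation.Nullary
squarePrimeDivisors : ℕ → List ℕ
squarePrimeDivisors m = filter (λ p → prime? p Relation.Nullary.×-dec ((p ℕ.* p) ∣? m)) (upTo (suc m))
  where import Relation.Nullary

minusOnePow : ℕ → ℤ
minusOnePow zero    = + 1
minusOnePow (suc r) = ℤ.- minusOnePow r

μ : ℕ → ℤ
μ m with squarePrimeDivisors m
... | []    = minusOnePow (length (primeDivisors m))
... | _ ∷ _ = + 0

μℚ : ℕ → ℚ
μℚ m = μ m ℚ./ 1

A : ℕ → ℕ → ℚ
A n k with k ∣? n
... | yes _ = ⟦ ((2 ℕ.* n) div k) ! ⟧ ℚ.* ((+ k ℚ./ 2) ^ℚ (n div k))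
                ℚ.* inv (2 ℕ.* n ℕ.* ((n div k) !))
... | no _  = 0ℚ

B : ℕ → ℕ → ℚ
B n k with 2 ∣? k
... | yes _ = inv (2 ℕ.* n) ℚ.*
              sumTo ((n ∸ 1) div k) (λ m →
                 ⟦ ((2 ℕ.* n) div k) ! ⟧ ℚ.* ((+ k ℚ./ 2) ^ℚ m)
                   ℚ.* inv ((((2 ℕ.* n) div k) ∸ 2 ℕ.* m) ! ℕ.* (m !)))
... | no _  = 0ℚ

f : ℕ → ℕ → ℚ
f n k = A n k ℚ.+ B n k

formula : ℕ → ℕ → ℚ
formula n d =
  ⟦ d ⟧ ℚ.* sumℚ (map (λ k → f n k ℚ.* μℚ (k div d))
                      (filter (λ k → (d ∣? k) Relation.Nullary.×-dec (k ∣? (2 ℕ.* n)))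
                              (map suc (upTo (2 ℕ.* n)))))
  where import Relation.Nullary

{-# OPTIONS --safe #-}
module Submission where

-- Reading the rotation at c from a base point turns a map into a
-- fixed-point-free involution of ℤ/2n (a chord diagram), the position of a i
-- being matched with that of a' i.  Γ-orbits of maps become rotation classes of
-- diagrams and Γ_M becomes the group of rotations preserving the diagram, so a
-- d-fold symmetric map is a diagram of period exactly p = 2n/d and its class
-- has p members.  A diagram invariant under translation by q = 2n/k is an
-- involution of the q residues in which each transposition has k possible
-- shifts and each fixed point needs an element of order two of ℤ/k; counting
-- these by the number of transpositions gives 2n f(n,k), and Möbius inversion
-- over the divisors of p isolates the diagrams of period exactly p.

open import Defs
open import Data.Nat using (ℕ; zero; suc; _+_; _*_; _∸_; _^_; _!; _≤_; _<_; _≤?_; _<?_; s≤s; z<s; s<s; s≤s⁻¹;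
  NonZero; >-nonZero; >-nonZero⁻¹; ≢-nonZero; ≢-nonZero⁻¹; _%_; _/_)
open import Data.Nat.Properties
open import Data.Nat.Divisibility
open import Data.Nat.DivMod using (_mod_; m≡m%n+[m/n]*n; m%n<n; m<n⇒m%n≡m; [m+kn]%n≡m%n; +-distrib-/-∣ʳ; m*n/n≡m; m<n⇒m/n≡0; m/n*n≡m)
open import Data.Nat.Induction using (<-rec)
open import Data.Nat.Tactic.RingSolver using (solve-∀)
open import Data.Bool using (Bool; true; false; not)
import Data.Bool.Properties as Bool
import Data.Product.Properties as Product
open import Data.Bool.Properties using (not-involutive)
open import Data.Fin using (Fin; zero; suc; toℕ; fromℕ<; punchIn; punchOut)
open import Data.Fin.Properties using (toℕ<n; toℕ-injective; toℕ-fromℕ<; injective⇒≤; punchIn-injective; punchInᵢ≢i; punchIn-punchOut; any?)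
import Data.Fin.Properties as Fin
open import Data.Vec.Functional using (insertAt)
open import Data.Vec.Functional.Properties using (insertAt-lookup; insertAt-punchIn)
open import Data.Product using (∃; _×_; _,_; proj₁; proj₂)
open import Data.Sum using (_⊎_; inj₁; inj₂)
open import Data.Unit using (⊤; tt)
open import Data.Sum.Function.Propositional using (_⊎-↔_)
open import Data.Product.Function.NonDependent.Propositional using (_×-↔_)
open import Function.Construct.Composition using (_↔-∘_)
open import Function.Construct.Symmetry using (↔-sym)
open import Function.Construct.Identity using (↔-id)
open import Function using (_∘_; id; _⇔_; mk⇔; Equivalence; _↔_; Inverse)
open import Relation.Binary using (Setoid; IsEquivalence)
import Relation.Binary.Reasoning.Setoid as SetoidReasoning
open import Relation.Nullary using (¬_; Dec; yes; no; contradiction; ¬?; _×-dec_)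
import Relation.Nullary.Decidable as Dec
open import Relation.Binary.PropositionalEquality
  using (_≡_; _≢_; refl; sym; trans; cong; cong₂; subst; subst₂; module ≡-Reasoning)
open import Algebra.Bundles using (module CommutativeRing)
open import Data.Rational.Solver using (module +-*-Solver)
import Data.Integer as ℤ
import Data.Integer.Properties as ℤ
open import Data.Integer using (-[1+_]; +[1+_])
import Data.Rational as ℚ
import Data.Rational.Properties as ℚ
open import Data.Rational using (ℚ; 0ℚ; 1ℚ)
open import Algebra.Properties.Ring ℚ.+-*-ring using () renaming (-‿involutive to neg-involutive)
import Data.Rational.Unnormalised as ℚᵘ
import Data.Rational.Unnormalised.Properties as ℚᵘ
open import Algebra.Properties.Semiring.Sum (CommutativeRing.semiring ℚ.+-*-commutativeRing)
  using (sum; ∑-comm; ∑-distrib-+; *-distribˡ-sum; *-distribʳ-sum; sum-cong-≗)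
open import Data.Nat.ListAction using (product)
open import Data.Nat.Primality using (Prime; prime?; euclidsLemma; prime⇒nonZero; ¬prime[1]; prime⇒irreducible)
open import Data.Nat.Primality.Factorisation using (factorise; module PrimeFactorisation)
open import Data.Nat.Coprimality using (Coprime; coprime-divisor)
open import Data.List using (List; []; _∷_; length; upTo; applyUpTo; filter; lookup; map; tabulate)
open import Data.List.Properties using (filter-none; map-upTo; length-tabulate)
open import Data.List.Membership.Propositional using (_∈_)
open import Data.List.Membership.Propositional.Properties using (∈-upTo⁺; ∈-filter⁺; ∈-filter⁻; ∈-lookup)
import Data.List.Relation.Unary.All as All
open import Data.List.Relation.Unary.All using (All; []; _∷_)
import Data.List.Relation.Unary.All.Properties as All
open import Data.List.Relation.Unary.Any using (Any; here; there)
import Data.List.Relation.Unary.Any as Any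
import Data.List.Relation.Unary.Any.Properties as Any
open import Data.List.Relation.Unary.AllPairs using (AllPairs; []; _∷_)
import Data.List.Relation.Unary.AllPairs.Properties as AllPairs
open import Data.List.Relation.Unary.Unique.Propositional using (Unique)
open import Data.List.Relation.Unary.Unique.Propositional.Properties using (upTo⁺; filter⁺)

-- Congruences

-- The two summands of f(n,k) come from the residues modulo q = 2n/k that the involution sends to
-- themselves. Such a residue needs a nonzero shift equal to its own negative, and ℤ/k has exactly
-- one, k/2, when k is even and none when k is odd. For odd k all residues are therefore paired, in
-- n/k pairs, which is A. For even k the number m of pairs varies: the limit (n-1)/k in B stops just
-- before m = n/k, the case without fixed residues, which occurs only for k dividing n and is again
-- supplied by A. Choosing m unordered pairs puts 2^m in the denominator and each pair has k shifts,
-- hence (k/2)^m. The factor d has another origin: if r classes have p members each, then r 2n = d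
-- (r p), so dividing the count of diagrams by p amounts to multiplying by d and dividing by 2n.
-- Labels depend on the base point and on unreduced exponents. Positions are therefore compared only
-- modulo 2n, and realised diagrams only up to rotation.

infix 4 _≋_[mod_]

-- Multiples of the modulus are added on both sides, which expresses congruence in ℕ without
-- subtraction and makes symmetry an exchange of the two witnesses.
record _≋_[mod_] (x y N : ℕ) : Set where
  no-eta-equality
  pattern
  constructor mod-eq
  field
    u v : ℕ
    eq  : x + u * N ≡ y + v * N

mod-reflexive : ∀ {N x y} → x ≡ y → x ≋ y [mod N ]
mod-reflexive refl = mod-eq 0 0 refl

mod-refl : ∀ {N x} → x ≋ x [mod N ]
mod-refl = mod-reflexive refl

mod-sym : ∀ {N x y} → x ≋ y [mod N ] → y ≋ x [mod N ]
mod-sym (mod-eq u v eq) = mod-eq v u (sym eq)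

mod-+ : ∀ {N x x′ y y′} → x ≋ y [mod N ] → x′ ≋ y′ [mod N ] → x + x′ ≋ y + y′ [mod N ]
mod-+ {N} {x} {x′} {y} {y′} (mod-eq u v eq) (mod-eq u′ v′ eq′) = mod-eq (u + u′) (v + v′) (begin
  x + x′ + (u + u′) * N         ≡⟨ regroup x x′ u u′ N ⟩
  (x + u * N) + (x′ + u′ * N)   ≡⟨ cong₂ _+_ eq eq′ ⟩
  (y + v * N) + (y′ + v′ * N)   ≡⟨ regroup y y′ v v′ N ⟨
  y + y′ + (v + v′) * N         ∎)
  where
  open ≡-Reasoning
  regroup : ∀ p q r s N → p + q + (r + s) * N ≡ (p + r * N) + (q + s * N)
  regroup = solve-∀

mod-cancelʳ : ∀ {N x y} w → x + w ≋ y + w [mod N ] → x ≋ y [mod N ]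
mod-cancelʳ {N} {x} {y} w (mod-eq u v eq) = mod-eq u v (+-cancelʳ-≡ w _ _ (begin
  x + u * N + w   ≡⟨ swap x (u * N) w ⟩
  x + w + u * N   ≡⟨ eq ⟩
  y + w + v * N   ≡⟨ swap y w (v * N) ⟩
  y + v * N + w   ∎))
  where
  open ≡-Reasoning
  swap : ∀ p q r → p + q + r ≡ p + r + q
  swap = solve-∀

mod-cancelˡ : ∀ {N x y} w → w + x ≋ w + y [mod N ] → x ≋ y [mod N ]
mod-cancelˡ {N} {x} {y} w e =
  mod-cancelʳ w (subst₂ (λ p q → p ≋ q [mod N ]) (+-comm w x) (+-comm w y) e)

-- The sum of the two congruences has y on both sides, where it cancels.
mod-trans : ∀ {N x y z} → x ≋ y [mod N ] → y ≋ z [mod N ] → x ≋ z [mod N ]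
mod-trans {N} {x} {y} {z} p q =
  mod-cancelʳ y (subst (λ w → x + y ≋ w [mod N ]) (+-comm y z) (mod-+ p q))

mod-setoid : ℕ → Setoid _ _
mod-setoid N = record
  { Carrier = ℕ
  ; _≈_ = λ x y → x ≋ y [mod N ]
  ; isEquivalence = record { refl = mod-refl ; sym = mod-sym ; trans = mod-trans } }

module ModReasoning (N : ℕ) = SetoidReasoning (mod-setoid N)

mod-+ʳ : ∀ {N x y} w → x ≋ y [mod N ] → x + w ≋ y + w [mod N ]
mod-+ʳ w e = mod-+ e mod-refl

mod-+ˡ : ∀ {N x y} w → x ≋ y [mod N ] → w + x ≋ w + y [mod N ]
mod-+ˡ w e = mod-+ mod-refl e

mod-multiple : ∀ {N} x s → x + s * N ≋ x [mod N ]
mod-multiple x s = mod-eq 0 s (+-identityʳ _)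

∣⇒mod-0 : ∀ {N x} → N ∣ x → x ≋ 0 [mod N ]
∣⇒mod-0 (divides s refl) = mod-multiple 0 s

mod-0⇒∣ : ∀ {N x} → x ≋ 0 [mod N ] → N ∣ x
mod-0⇒∣ {N} {x} (mod-eq u v eq) =
  ∣m+n∣m⇒∣n (divides v (trans (+-comm (u * N) x) eq)) (n∣m*n u)

mod-weaken : ∀ {q N x y} → q ∣ N → x ≋ y [mod N ] → x ≋ y [mod q ]
mod-weaken {q} {_} {x} {y} (divides k refl) (mod-eq u v eq) =
  mod-eq (u * k) (v * k) (trans (cong (x +_) (*-assoc u k q))
                                (trans eq (cong (y +_) (sym (*-assoc v k q)))))

mod-scale : ∀ {k x y} q → x ≋ y [mod k ] → q * x ≋ q * y [mod q * k ]
mod-scale {k} {x} {y} q (mod-eq u v eq) = mod-eq u v (begin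
  q * x + u * (q * k)   ≡⟨ factor q x u k ⟩
  q * (x + u * k)       ≡⟨ cong (q *_) eq ⟩
  q * (y + v * k)       ≡⟨ factor q y v k ⟨
  q * y + v * (q * k)   ∎)
  where
  open ≡-Reasoning
  factor : ∀ q x u k → q * x + u * (q * k) ≡ q * (x + u * k)
  factor = solve-∀

mod-unscale : ∀ {k x y} q .{{_ : NonZero q}} → q * x ≋ q * y [mod q * k ] → x ≋ y [mod k ]
mod-unscale {k} {x} {y} q (mod-eq u v eq) = mod-eq u v (*-cancelˡ-≡ _ _ q (begin
  q * (x + u * k)       ≡⟨ factor q x u k ⟨
  q * x + u * (q * k)   ≡⟨ eq ⟩
  q * y + v * (q * k)   ≡⟨ factor q y v k ⟩
  q * (y + v * k)       ∎))
  where
  open ≡-Reasoning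
  factor : ∀ q x u k → q * x + u * (q * k) ≡ q * (x + u * k)
  factor = solve-∀

module _ {N : ℕ} .{{_ : NonZero N}} where

  mod-% : ∀ x → x ≋ x % N [mod N ]
  mod-% x = mod-trans (mod-reflexive (m≡m%n+[m/n]*n x N)) (mod-multiple (x % N) (x / N))

  mod⇒% : ∀ {x y} → x ≋ y [mod N ] → x % N ≡ y % N
  mod⇒% {x} {y} (mod-eq u v eq) =
    trans (sym ([m+kn]%n≡m%n x u N)) (trans (cong (_% N) eq) ([m+kn]%n≡m%n y v N))

  %⇒mod : ∀ {x y} → x % N ≡ y % N → x ≋ y [mod N ]
  %⇒mod {x} {y} e = mod-trans (mod-% x) (mod-trans (mod-reflexive e) (mod-sym (mod-% y)))

  mod? : ∀ x y → Dec (x ≋ y [mod N ])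
  mod? x y = Dec.map′ %⇒mod mod⇒% (x % N ≟ y % N)

  mod-small : ∀ {x y} → x < N → y < N → x ≋ y [mod N ] → x ≡ y
  mod-small x<N y<N e = trans (sym (m<n⇒m%n≡m x<N)) (trans (mod⇒% e) (m<n⇒m%n≡m y<N))

  -- `N ∸ 1` represents -1, so this is a natural number representing -x.
  neg : ℕ → ℕ
  neg x = x * (N ∸ 1)

  +-neg : ∀ x → x + neg x ≋ 0 [mod N ]
  +-neg x = ∣⇒mod-0 (divides x (trans (sym (*-suc x (N ∸ 1))) (cong (x *_) (m+[n∸m]≡n (>-nonZero⁻¹ N)))))

  -- Reduction modulo N isolates the low digit; once it is cancelled, the common factor N can be
  -- divided out.
  mod-digits : ∀ {k s s′} {i i′ : Fin N} →
               toℕ i + N * s ≋ toℕ i′ + N * s′ [mod N * k ] → i ≡ i′ × s ≋ s′ [mod k ]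
  mod-digits {k} {s} {s′} {i} {i′} e = i≡i′ , s≡s′
    where
    residue : ∀ (i : Fin N) s → toℕ i + N * s ≋ toℕ i [mod N ]
    residue i s = mod-trans (mod-reflexive (cong (toℕ i +_) (*-comm N s))) (mod-multiple _ s)

    i≡i′ : i ≡ i′
    i≡i′ = toℕ-injective (mod-small (toℕ<n i) (toℕ<n i′)
      (mod-trans (mod-sym (residue i s)) (mod-trans (mod-weaken (m∣m*n k) e) (residue i′ s′))))

    s≡s′ : s ≋ s′ [mod k ]
    s≡s′ = mod-unscale N (mod-cancelˡ (toℕ i)
      (subst (λ j → toℕ i + N * s ≋ toℕ j + N * s′ [mod N * k ]) (sym i≡i′) e))

-- Finite enumerations

-- A cardinality modulo an equivalence. The same record serves for matchings up to equality and up
-- to rotation, so that both counts can be compared by one pigeonhole argument.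
record Enum {X : Set} (_≈_ : X → X → Set) (P : X → Set) (n : ℕ) : Set where
  field
    at       : Fin n → X
    holds    : ∀ i → P (at i)
    distinct : ∀ {i j} → at i ≈ at j → i ≡ j
    find     : ∀ x → P x → ∃ λ i → x ≈ at i

indicator : ∀ {P : Set} → Dec P → ℕ
indicator (yes _) = 1
indicator (no  _) = 0

count : ∀ {n} {P : Fin n → Set} → (∀ i → Dec (P i)) → ℕ
count {zero}  P? = 0
count {suc n} P? = indicator (P? zero) + count (P? ∘ suc)

module _ {X : Set} {_≈_ : X → X → Set} (≈-equiv : IsEquivalence _≈_) where
  open IsEquivalence ≈-equiv renaming (refl to ≈-refl; sym to ≈-sym; trans to ≈-trans)

  enum-≤ : ∀ {P Q : X → Set} {m n} → (∀ {x} → P x → Q x) → Enum _≈_ P m → Enum _≈_ Q n → m ≤ n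
  enum-≤ {m = m} P⊆Q E F = injective⇒≤ {f = λ i → proj₁ (place i)} inj
    where
    module E = Enum E
    module F = Enum F
    place : ∀ i → ∃ λ j → E.at i ≈ F.at j
    place i = F.find (E.at i) (P⊆Q (E.holds i))
    inj : ∀ {i j} → proj₁ (place i) ≡ proj₁ (place j) → i ≡ j
    inj {i} {j} e = E.distinct (≈-trans (proj₂ (place i))
      (≈-trans (subst (λ z → F.at (proj₁ (place i)) ≈ F.at z) e ≈-refl) (≈-sym (proj₂ (place j)))))

  enum-unique : ∀ {P Q : X → Set} {m n} → (∀ {x} → P x → Q x) → (∀ {x} → Q x → P x) →
                Enum _≈_ P m → Enum _≈_ Q n → m ≡ n
  enum-unique P⊆Q Q⊆P E F = ≤-antisym (enum-≤ P⊆Q E F) (enum-≤ Q⊆P F E)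

  enum-cong : ∀ {P Q : X → Set} {n} → (∀ {x} → P x → Q x) → (∀ {x} → Q x → P x) →
              Enum _≈_ P n → Enum _≈_ Q n
  enum-cong P⊆Q Q⊆P E = record
    { at = at ; holds = P⊆Q ∘ holds ; distinct = distinct ; find = λ x → find x ∘ Q⊆P }
    where open Enum E

  enum-filter : ∀ {n} (at : Fin n → X) → (∀ {i j} → at i ≈ at j → i ≡ j) →
                {Q : X → Set} → (∀ {x y} → x ≈ y → Q x → Q y) → (Q? : ∀ i → Dec (Q (at i))) →
                Enum _≈_ (λ x → Q x × ∃ λ i → x ≈ at i) (count Q?)
  enum-filter {zero} at inj resp Q? = record
    { at = λ () ; holds = λ () ; distinct = λ { {()} } ; find = λ { x (_ , () , _) } }
  enum-filter {suc n} at inj {Q} resp Q?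
    with Q? zero | enum-filter (at ∘ suc) (Fin.suc-injective ∘ inj) resp (Q? ∘ suc)
  ... | yes q₀ | E = record
    { at = at′ ; holds = holds′ ; distinct = λ {i} {j} → distinct′ i j ; find = find′ }
    where
    open Enum E renaming (at to at₀; holds to holds₀; distinct to distinct₀; find to find₀)
    k = count (Q? ∘ suc)
    at′ : Fin (suc k) → X
    at′ zero    = at zero
    at′ (suc i) = at₀ i
    holds′ : ∀ i → Q (at′ i) × ∃ λ j → at′ i ≈ at j
    holds′ zero    = q₀ , zero , ≈-refl
    holds′ (suc i) = let q , j , e = holds₀ i in q , suc j , e
    zero-new : ∀ {i} → ¬ (at zero ≈ at₀ i)
    zero-new {i} e = let _ , j , e′ = holds₀ i in Fin.0≢1+n (inj (≈-trans e e′))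
    distinct′ : ∀ i j → at′ i ≈ at′ j → i ≡ j
    distinct′ zero    zero    e = refl
    distinct′ zero    (suc j) e = contradiction e zero-new
    distinct′ (suc i) zero    e = contradiction (≈-sym e) zero-new
    distinct′ (suc i) (suc j) e = cong suc (distinct₀ e)
    find′ : ∀ x → (Q x × ∃ λ i → x ≈ at i) → ∃ λ i → x ≈ at′ i
    find′ x (q , zero  , e) = zero , e
    find′ x (q , suc i , e) = let j , e′ = find₀ x (q , i , e) in suc j , e′
  ... | no ¬q₀ | E = record
    { at = at₀ ; holds = λ i → let q , j , e = holds₀ i in q , suc j , e
    ; distinct = distinct₀ ; find = find′ }
    where
    open Enum E renaming (at to at₀; holds to holds₀; distinct to distinct₀; find to find₀)
    find′ : ∀ x → (Q x × ∃ λ i → x ≈ at i) → ∃ λ i → x ≈ at₀ i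
    find′ x (q , zero  , e) = contradiction (resp e q) ¬q₀
    find′ x (q , suc i , e) = find₀ x (q , i , e)

  -- An entry is kept only if it is equivalent to no representative already chosen for the later
  -- entries.
  representatives : (∀ x y → Dec (x ≈ y)) → ∀ {n} (at : Fin n → X) →
                    ∃ λ m → Enum _≈_ (λ x → ∃ λ i → x ≈ at i) m
  representatives _≈?_ {zero} at =
    0 , record { at = λ () ; holds = λ () ; distinct = λ { {()} } ; find = λ { x (() , _) } }
  representatives _≈?_ {suc n} at with representatives _≈?_ (at ∘ suc)
  ... | m , E with any? (λ i → at zero ≈? Enum.at E i)
  ...   | yes (i₀ , e₀) = m , record
    { at = at₀ ; holds = λ i → let j , e = holds₀ i in suc j , e
    ; distinct = distinct₀ ; find = find′ }
    where
    open Enum E renaming (at to at₀; holds to holds₀; distinct to distinct₀; find to find₀)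
    find′ : ∀ x → (∃ λ i → x ≈ at i) → ∃ λ i → x ≈ at₀ i
    find′ x (zero  , e) = i₀ , ≈-trans e e₀
    find′ x (suc i , e) = find₀ x (i , e)
  ...   | no new = suc m , record
    { at = at′ ; holds = holds′ ; distinct = λ {i} {j} → distinct′ i j ; find = find′ }
    where
    open Enum E renaming (at to at₀; holds to holds₀; distinct to distinct₀; find to find₀)
    at′ : Fin (suc m) → X
    at′ zero    = at zero
    at′ (suc i) = at₀ i
    holds′ : ∀ i → ∃ λ j → at′ i ≈ at j
    holds′ zero    = zero , ≈-refl
    holds′ (suc i) = let j , e = holds₀ i in suc j , e
    distinct′ : ∀ i j → at′ i ≈ at′ j → i ≡ j
    distinct′ zero    zero    e = refl
    distinct′ zero    (suc j) e = contradiction (j , e) new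
    distinct′ (suc i) zero    e = contradiction (i , ≈-sym e) new
    distinct′ (suc i) (suc j) e = cong suc (distinct₀ e)
    find′ : ∀ x → (∃ λ i → x ≈ at i) → ∃ λ i → x ≈ at′ i
    find′ x (zero  , e) = zero , e
    find′ x (suc i , e) = let j , e′ = find₀ x (i , e) in suc j , e′

least-positive : {P : ℕ → Set} → (∀ n → Dec (P n)) → ∀ n → 0 < n → P n →
                 ∃ λ p → 0 < p × P p × (∀ m → 0 < m → m < p → ¬ P m)
least-positive {P} P? = <-rec _ step
  where
  step : ∀ n → (∀ {m} → m < n → 0 < m → P m → ∃ λ p → 0 < p × P p × (∀ m → 0 < m → m < p → ¬ P m)) →
         0 < n → P n → ∃ λ p → 0 < p × P p × (∀ m → 0 < m → m < p → ¬ P m)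
  step n rec 0<n pn with anyUpTo? (λ m → 0 <? m ×-dec P? m) n
  ... | yes (m , m<n , 0<m , pm) = rec m<n 0<m pm
  ... | no  none = n , 0<n , pn , λ m 0<m m<n pm → none (m , m<n , 0<m , pm)

-- Involutions π of Fin q whose fixed points and transpositions carry colours
-- in ℤ/k: they encode the fixed-point-free involutions of ℤ/qk that commute
-- with the translation by q, j + q s being sent to π j + q (s + colour j).
record Coloured (k q : ℕ) : Set where
  field
    π            : Fin q → Fin q
    colour       : Fin q → ℕ
    π-involutive : ∀ j → π (π j) ≡ j
    colour-π     : ∀ j → colour (π j) + colour j ≋ 0 [mod k ]
    no-fixed     : ∀ j → π j ≡ j → ¬ colour j ≋ 0 [mod k ]

_≈ᶜ_ : ∀ {k q} → Coloured k q → Coloured k q → Set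
_≈ᶜ_ {k} x y = ∀ j → Coloured.π x j ≡ Coloured.π y j
                    × Coloured.colour x j ≋ Coloured.colour y j [mod k ]

-- The colours available to a fixed point: the elements of order two of ℤ/k.
record Halves (k e : ℕ) : Set where
  field
    half          : Fin e → ℕ
    half-double   : ∀ i → half i + half i ≋ 0 [mod k ]
    half-nonzero  : ∀ i → ¬ half i ≋ 0 [mod k ]
    half-distinct : ∀ {i j} → half i ≋ half j [mod k ] → i ≡ j
    half-find     : ∀ x → x + x ≋ 0 [mod k ] → ¬ x ≋ 0 [mod k ] → ∃ λ i → x ≋ half i [mod k ]

-- The recursion follows the point zero: it is fixed and has one of `e` colours, or it is exchanged
-- with one of the other points in one of `k` colours.
number : (e k q : ℕ) → ℕ
number e k 0 = 1
number e k 1 = e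
number e k (suc (suc q)) = e * number e k (suc q) + suc q * (k * number e k q)

punchIn-view : ∀ {q} (j z : Fin (suc q)) → z ≡ j ⊎ (∃ λ y → z ≡ punchIn j y)
punchIn-view j z with j Fin.≟ z
... | yes j≡z = inj₁ (sym j≡z)
... | no  j≢z = inj₂ (punchOut j≢z , sym (punchIn-punchOut j≢z))

emptyᶜ : ∀ {k} → Coloured k 0
emptyᶜ = record { π = λ () ; colour = λ () ; π-involutive = λ () ; colour-π = λ () ; no-fixed = λ () }

addFixed : ∀ {k q} s → s + s ≋ 0 [mod k ] → ¬ s ≋ 0 [mod k ] → Coloured k q → Coloured k (suc q)
addFixed {k} {q} s s+s s≢0 x = record
  { π = π′ ; colour = colour′ ; π-involutive = π-involutive′ ; colour-π = colour-π′ ; no-fixed = no-fixed′ }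
  where
  open Coloured x
  π′ : Fin (suc q) → Fin (suc q)
  π′ zero    = zero
  π′ (suc j) = suc (π j)
  colour′ : Fin (suc q) → ℕ
  colour′ zero    = s
  colour′ (suc j) = colour j
  π-involutive′ : ∀ j → π′ (π′ j) ≡ j
  π-involutive′ zero    = refl
  π-involutive′ (suc j) = cong suc (π-involutive j)
  colour-π′ : ∀ j → colour′ (π′ j) + colour′ j ≋ 0 [mod k ]
  colour-π′ zero    = s+s
  colour-π′ (suc j) = colour-π j
  no-fixed′ : ∀ j → π′ j ≡ j → ¬ colour′ j ≋ 0 [mod k ]
  no-fixed′ zero    _ = s≢0
  no-fixed′ (suc j) e = no-fixed j (Fin.suc-injective e)

split-fixed : ∀ {k q} (x : Coloured k (suc q)) → Coloured.π x zero ≡ zero →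
              ∃ λ s → ∃ λ s+s → ∃ λ s≢0 → ∃ λ y → x ≈ᶜ addFixed s s+s s≢0 y
split-fixed {k} {q} x π0 =
  colour zero , subst (λ j → colour j + colour zero ≋ 0 [mod k ]) π0 (colour-π zero) , no-fixed zero π0 ,
  record { π = proj₁ ∘ π↓ ; colour = colour ∘ suc ; π-involutive = π-involutive↓
         ; colour-π = λ j → subst (λ z → colour z + colour (suc j) ≋ 0 [mod k ]) (proj₂ (π↓ j)) (colour-π (suc j))
         ; no-fixed = λ j e → no-fixed (suc j) (trans (proj₂ (π↓ j)) (cong suc e)) } ,
  λ { zero → π0 , mod-refl ; (suc j) → proj₂ (π↓ j) , mod-refl }
  where
  open Coloured x
  π↓ : ∀ j → ∃ λ j′ → π (suc j) ≡ suc j′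
  π↓ j with π (suc j) in e
  ... | suc j′ = j′ , refl
  ... | zero = contradiction (trans (sym π0) (trans (sym (cong π e)) (π-involutive (suc j)))) Fin.0≢1+n
  π-involutive↓ : ∀ j → proj₁ (π↓ (proj₁ (π↓ j))) ≡ j
  π-involutive↓ j = Fin.suc-injective (trans (sym (proj₂ (π↓ (proj₁ (π↓ j)))))
    (trans (cong π (sym (proj₂ (π↓ j)))) (π-involutive (suc j))))

module _ {k q : ℕ} .{{_ : NonZero k}} where

  -- The colours of two exchanged points sum to zero, so the colour s at zero forces the one at
  -- `suc j`; this is why a transposition has k choices and not k².
  addPair : Fin (suc q) → ℕ → Coloured k q → Coloured k (suc (suc q))
  addPair j s x = record
    { π = π′ ; colour = colour′ ; π-involutive = π-involutive′ ; colour-π = colour-π′ ; no-fixed = no-fixed′ }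
    where
    open Coloured x
    π′ : Fin (suc (suc q)) → Fin (suc (suc q))
    π′ zero    = suc j
    π′ (suc z) = insertAt (suc ∘ punchIn j ∘ π) j zero z
    colour′ : Fin (suc (suc q)) → ℕ
    colour′ zero    = s
    colour′ (suc z) = insertAt colour j (neg {k} s) z
    π-j : π′ (suc j) ≡ zero
    π-j = insertAt-lookup (suc ∘ punchIn j ∘ π) j zero
    π-rest : ∀ y → π′ (suc (punchIn j y)) ≡ suc (punchIn j (π y))
    π-rest = insertAt-punchIn (suc ∘ punchIn j ∘ π) j zero
    colour-j : colour′ (suc j) ≡ neg {k} s
    colour-j = insertAt-lookup colour j (neg {k} s)
    colour-rest : ∀ y → colour′ (suc (punchIn j y)) ≡ colour y
    colour-rest = insertAt-punchIn colour j (neg {k} s)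
    π-involutive′ : ∀ z → π′ (π′ z) ≡ z
    π-involutive′ zero = π-j
    π-involutive′ (suc z) with punchIn-view j z
    ... | inj₁ refl = cong π′ π-j
    ... | inj₂ (y , refl) = trans (cong π′ (π-rest y))
      (trans (π-rest (π y)) (cong (suc ∘ punchIn j) (π-involutive y)))
    colour-π′ : ∀ z → colour′ (π′ z) + colour′ z ≋ 0 [mod k ]
    colour-π′ zero = mod-trans (mod-reflexive (trans (cong (_+ s) colour-j) (+-comm (neg {k} s) s))) (+-neg s)
    colour-π′ (suc z) with punchIn-view j z
    ... | inj₁ refl = mod-trans (mod-reflexive (cong₂ _+_ (cong colour′ π-j) colour-j)) (+-neg s)
    ... | inj₂ (y , refl) = mod-trans
      (mod-reflexive (cong₂ _+_ (trans (cong colour′ (π-rest y)) (colour-rest (π y))) (colour-rest y))) (colour-π y)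
    no-fixed′ : ∀ z → π′ z ≡ z → ¬ colour′ z ≋ 0 [mod k ]
    no-fixed′ (suc z) e with punchIn-view j z
    ... | inj₁ refl = contradiction (trans (sym π-j) e) Fin.0≢1+n
    ... | inj₂ (y , refl) = λ s≋0 → no-fixed y
      (punchIn-injective j _ _ (Fin.suc-injective (trans (sym (π-rest y)) e)))
      (mod-trans (mod-reflexive (sym (colour-rest y))) s≋0)

  -- The colour at zero is an arbitrary natural number, whereas the enumeration uses representatives
  -- below k; hence the freedom to replace it by any congruent s.
  split-pair : (x : Coloured k (suc (suc q))) (j : Fin (suc q)) → Coloured.π x zero ≡ suc j →
               ∃ λ y → ∀ s → Coloured.colour x zero ≋ s [mod k ] → x ≈ᶜ addPair j s y
  split-pair x j π0 = y , λ { s e zero → π0 , e ; s e (suc z) → at-suc s e z (punchIn-view j z) }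
    where
    open Coloured x
    πj : π (suc j) ≡ zero
    πj = trans (cong π (sym π0)) (π-involutive zero)
    π↓ : ∀ y → ∃ λ y′ → π (suc (punchIn j y)) ≡ suc (punchIn j y′)
    π↓ y with π (suc (punchIn j y)) in e
    ... | zero = contradiction (sym (Fin.suc-injective (trans (sym π0) (trans (cong π (sym e)) (π-involutive _)))))
                               (punchInᵢ≢i j y)
    ... | suc w with punchIn-view j w
    ...   | inj₁ refl = contradiction (trans (sym πj) (trans (cong π (sym e)) (π-involutive _))) Fin.0≢1+n
    ...   | inj₂ (y′ , refl) = y′ , refl
    y : Coloured k q
    y = record
      { π = proj₁ ∘ π↓
      ; colour = λ y → colour (suc (punchIn j y))
      ; π-involutive = λ y → punchIn-injective j _ _ (Fin.suc-injective
          (trans (sym (proj₂ (π↓ (proj₁ (π↓ y))))) (trans (cong π (sym (proj₂ (π↓ y)))) (π-involutive _))))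
      ; colour-π = λ y → mod-trans (mod-reflexive (cong (λ z → colour z + _) (sym (proj₂ (π↓ y))))) (colour-π _)
      ; no-fixed = λ y e → no-fixed _ (trans (proj₂ (π↓ y)) (cong (suc ∘ punchIn j) e)) }
    at-suc : ∀ s → colour zero ≋ s [mod k ] → ∀ z → z ≡ j ⊎ (∃ λ y → z ≡ punchIn j y) →
             π (suc z) ≡ Coloured.π (addPair j s y) (suc z) ×
             colour (suc z) ≋ Coloured.colour (addPair j s y) (suc z) [mod k ]
    at-suc s e z (inj₁ refl) = trans πj (sym (insertAt-lookup _ j zero)) ,
      mod-cancelʳ s (begin
        colour (suc j) + s                                 ≈⟨ mod-+ˡ _ e ⟨
        colour (suc j) + colour zero                       ≈⟨ mod-reflexive (cong (λ z → colour z + colour zero) (sym π0)) ⟩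
        colour (π zero) + colour zero                      ≈⟨ colour-π zero ⟩
        0                                                  ≈⟨ +-neg s ⟨
        s + neg {k} s                                      ≈⟨ mod-reflexive (+-comm s _) ⟩
        neg {k} s + s                                      ≈⟨ mod-reflexive (cong (_+ s) (sym (insertAt-lookup _ j (neg {k} s)))) ⟩
        Coloured.colour (addPair j s y) (suc j) + s        ∎)
      where open ModReasoning k
    at-suc s e z (inj₂ (w , refl)) =
      trans (proj₂ (π↓ w)) (sym (insertAt-punchIn _ j zero w)) ,
      mod-reflexive (sym (insertAt-punchIn _ j (neg {k} s) w))

  addPair-injective : ∀ {j j′ s s′ x x′} → addPair j s x ≈ᶜ addPair j′ s′ x′ →
                      j ≡ j′ × s ≋ s′ [mod k ] × x ≈ᶜ x′
  addPair-injective {j} {j′} {s} {s′} {x} {x′} e with Fin.suc-injective (proj₁ (e zero))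
  ... | refl = refl , proj₂ (e zero) , λ y →
    punchIn-injective j _ _ (Fin.suc-injective
      (trans (sym (insertAt-punchIn _ j zero y)) (trans (proj₁ (e (suc (punchIn j y)))) (insertAt-punchIn _ j zero y)))) ,
    mod-trans (mod-reflexive (sym (insertAt-punchIn _ j (neg {k} s) y)))
      (mod-trans (proj₂ (e (suc (punchIn j y)))) (mod-reflexive (insertAt-punchIn _ j (neg {k} s′) y)))

  addPair-cong : ∀ {j s x x′} → x ≈ᶜ x′ → addPair j s x ≈ᶜ addPair j s x′
  addPair-cong {j} {s} e zero = refl , mod-refl
  addPair-cong {j} {s} e (suc z) with punchIn-view j z
  ... | inj₁ refl = trans (insertAt-lookup _ j zero) (sym (insertAt-lookup _ j zero)) ,
    mod-reflexive (trans (insertAt-lookup _ j (neg {k} s)) (sym (insertAt-lookup _ j (neg {k} s))))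
  ... | inj₂ (y , refl) =
    trans (insertAt-punchIn _ j zero y)
      (trans (cong (suc ∘ punchIn j) (proj₁ (e y))) (sym (insertAt-punchIn _ j zero y))) ,
    mod-trans (mod-reflexive (insertAt-punchIn _ j (neg {k} s) y))
      (mod-trans (proj₂ (e y)) (mod-reflexive (sym (insertAt-punchIn _ j (neg {k} s) y))))

≈ᶜ-trans : ∀ {k q} {x y z : Coloured k q} → x ≈ᶜ y → y ≈ᶜ z → x ≈ᶜ z
≈ᶜ-trans e e′ j = trans (proj₁ (e j)) (proj₁ (e′ j)) , mod-trans (proj₂ (e j)) (proj₂ (e′ j))

enum-reindex : ∀ {X I : Set} {_≈_ : X → X → Set} {P : X → Set} {n} → I ↔ Fin n →
               (at : I → X) → (∀ i → P (at i)) → (∀ i j → at i ≈ at j → i ≡ j) →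
               (∀ x → P x → ∃ λ i → x ≈ at i) → Enum _≈_ P n
enum-reindex {_≈_ = _≈_} I↔n at holds distinct find = record
  { at = at ∘ index⁻¹
  ; holds = holds ∘ index⁻¹
  ; distinct = λ {i} {j} e → trans (sym (strictlyInverseˡ i)) (trans (cong index (distinct _ _ e)) (strictlyInverseˡ j))
  ; find = λ x p → let i , e = find x p in
      index i , subst (λ i → x ≈ at i) (sym (strictlyInverseʳ i)) e }
  where open Inverse I↔n using (strictlyInverseˡ; strictlyInverseʳ) renaming (to to index; from to index⁻¹)

module _ {k e : ℕ} .{{_ : NonZero k}} (H : Halves k e) where
  open Halves H

  -- A type shaped like the recursion of `number`: its size is then immediate and decoding proceeds
  -- by structural recursion.
  Code : ℕ → Set
  Code 0 = ⊤
  Code 1 = Fin e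
  Code (suc (suc q)) = (Fin e × Code (suc q)) ⊎ (Fin (suc q) × Fin k × Code q)

  Code↔Fin : ∀ q → Code q ↔ Fin (number e k q)
  Code↔Fin 0 = ↔-sym Fin.1↔⊤
  Code↔Fin 1 = ↔-id _
  Code↔Fin (suc (suc q)) = ↔-sym Fin.+↔⊎ ↔-∘
    ((↔-sym Fin.*↔× ↔-∘ (↔-id _ ×-↔ Code↔Fin (suc q))) ⊎-↔
     (↔-sym Fin.*↔× ↔-∘ (↔-id _ ×-↔ (↔-sym Fin.*↔× ↔-∘ (↔-id _ ×-↔ Code↔Fin q)))))

  fixedᶜ : ∀ {q} → Fin e → Coloured k q → Coloured k (suc q)
  fixedᶜ i = addFixed (half i) (half-double i) (half-nonzero i)

  decode : ∀ q → Code q → Coloured k q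
  decode 0 _ = emptyᶜ
  decode 1 i = fixedᶜ i emptyᶜ
  decode (suc (suc q)) (inj₁ (i , y)) = fixedᶜ i (decode (suc q) y)
  decode (suc (suc q)) (inj₂ (j , s , y)) = addPair j (toℕ s) (decode q y)

  decode-distinct : ∀ q y z → decode q y ≈ᶜ decode q z → y ≡ z
  decode-distinct 0 _ _ _ = refl
  decode-distinct 1 _ _ e = half-distinct (proj₂ (e zero))
  decode-distinct (suc (suc q)) (inj₁ (i , y)) (inj₁ (i′ , y′)) e =
    cong inj₁ (cong₂ _,_ (half-distinct (proj₂ (e zero)))
      (decode-distinct (suc q) y y′ (λ j → Fin.suc-injective (proj₁ (e (suc j))) , proj₂ (e (suc j)))))
  decode-distinct (suc (suc q)) (inj₁ _) (inj₂ _) e = contradiction (proj₁ (e zero)) Fin.0≢1+n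
  decode-distinct (suc (suc q)) (inj₂ _) (inj₁ _) e = contradiction (sym (proj₁ (e zero))) Fin.0≢1+n
  decode-distinct (suc (suc q)) (inj₂ (j , s , y)) (inj₂ (j′ , s′ , y′)) e with addPair-injective e
  ... | refl , s≋s′ , y≈y′ =
    cong inj₂ (cong₂ (λ s y → j , s , y) (toℕ-injective (mod-small (toℕ<n s) (toℕ<n s′) s≋s′))
                                        (decode-distinct q y y′ y≈y′))

  find-fixed : ∀ q → (∀ (y : Coloured k q) → ∃ λ z → y ≈ᶜ decode q z) →
               ∀ (x : Coloured k (suc q)) → Coloured.π x zero ≡ zero →
               ∃ λ i → ∃ λ z → x ≈ᶜ fixedᶜ i (decode q z)
  find-fixed q find x π0 with split-fixed x π0
  ... | s , s+s , s≢0 , y , x≈ with half-find s s+s s≢0 | find y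
  ...   | i , s≋i | z , y≈z = i , z , λ where
    zero    → proj₁ (x≈ zero) , mod-trans (proj₂ (x≈ zero)) s≋i
    (suc j) → trans (proj₁ (x≈ (suc j))) (cong suc (proj₁ (y≈z j))) ,
              mod-trans (proj₂ (x≈ (suc j))) (proj₂ (y≈z j))

  find-pair : ∀ q → (∀ (y : Coloured k q) → ∃ λ z → y ≈ᶜ decode q z) →
              ∀ (x : Coloured k (suc (suc q))) j → Coloured.π x zero ≡ suc j →
              ∃ λ s → ∃ λ z → x ≈ᶜ addPair j (toℕ {k} s) (decode q z)
  find-pair q find x j π0 with split-pair x j π0
  ... | y , x≈ with find y
  ...   | z , y≈z = s , z ,
    ≈ᶜ-trans {x = x} {addPair j (toℕ s) y} {addPair j (toℕ s) (decode q z)}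
      (x≈ (toℕ s) (mod-trans (mod-% s₀) (mod-reflexive (sym (toℕ-fromℕ< (m%n<n s₀ k))))))
      (addPair-cong {j = j} y≈z)
    where
    s₀ = Coloured.colour x zero
    s = fromℕ< (m%n<n s₀ k)

  find-either : ∀ q → (∀ (y : Coloured k (suc q)) → ∃ λ z → y ≈ᶜ decode (suc q) z) →
                (∀ (y : Coloured k q) → ∃ λ z → y ≈ᶜ decode q z) →
                ∀ (x : Coloured k (suc (suc q))) → ∃ λ z → x ≈ᶜ decode (suc (suc q)) z
  find-either q find₁ find₀ x with Coloured.π x zero in π0
  ... | zero  = let i , z , e = find-fixed (suc q) find₁ x π0 in inj₁ (i , z) , e
  ... | suc j = let s , z , e = find-pair q find₀ x j π0 in inj₂ (j , s , z) , e

  decode-find : ∀ q x → ∃ λ z → x ≈ᶜ decode q z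
  decode-find 0 x = tt , λ ()
  decode-find 1 x with Coloured.π x zero in π0
  ... | zero = let i , _ , e = find-fixed 0 (λ _ → tt , λ ()) x π0 in i , e
  decode-find (suc (suc q)) = find-either q (decode-find (suc q)) (decode-find q)

  coloured-enum : ∀ q → Enum _≈ᶜ_ (λ (_ : Coloured k q) → ⊤) (number e k q)
  coloured-enum q = enum-reindex (Code↔Fin q) (decode q) (λ _ → tt) (decode-distinct q) (λ x _ → decode-find q x)

-- Fixed-point-free involutions of ℤ/N, given by functions on representatives.
record Matching (N : ℕ) : Set where
  field
    partner      : ℕ → ℕ
    partner-resp : ∀ {t u} → t ≋ u [mod N ] → partner t ≋ partner u [mod N ]
    involutive   : ∀ t → partner (partner t) ≋ t [mod N ]
    unfixed      : ∀ t → ¬ partner t ≋ t [mod N ]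
open Matching

_≈ᵐ_ : ∀ {N} → Matching N → Matching N → Set
_≈ᵐ_ {N} x y = ∀ t → partner x t ≋ partner y t [mod N ]

-- The intertwining form makes shifts compose by addition. For `x = y` it describes a rotational
-- symmetry, and for `j = 0` it is equality of matchings.
Shift : ∀ {N} → Matching N → Matching N → ℕ → Set
Shift {N} x y j = ∀ t → partner y (t + j) ≋ partner x t + j [mod N ]

_∼ᵐ_ : ∀ {N} → Matching N → Matching N → Set
x ∼ᵐ y = ∃ λ j → Shift x y j

≈ᵐ-isEquivalence : ∀ {N} → IsEquivalence (_≈ᵐ_ {N})
≈ᵐ-isEquivalence = record
  { refl = λ t → mod-refl ; sym = λ e t → mod-sym (e t) ; trans = λ e e′ t → mod-trans (e t) (e′ t) }

-- Composition and cancellation of rotations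

module _ {N : ℕ} where

  shift-0 : ∀ {x y : Matching N} → x ≈ᵐ y → Shift x y 0
  shift-0 {x} {y} e t = mod-trans (mod-reflexive (cong (partner y) (+-identityʳ t)))
    (mod-trans (mod-sym (e t)) (mod-reflexive (sym (+-identityʳ (partner x t)))))

  shift-≈ : ∀ {x y : Matching N} → Shift x y 0 → x ≈ᵐ y
  shift-≈ {x} {y} e t = mod-sym (mod-trans (mod-reflexive (sym (cong (partner y) (+-identityʳ t))))
    (mod-trans (e t) (mod-reflexive (+-identityʳ (partner x t)))))

  shift-+ : ∀ {x y z : Matching N} {i j} → Shift x y i → Shift y z j → Shift x z (i + j)
  shift-+ {x} {y} {z} {i} {j} e e′ t = begin
    partner z (t + (i + j))   ≈⟨ mod-reflexive (cong (partner z) (sym (+-assoc t i j))) ⟩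
    partner z (t + i + j)     ≈⟨ e′ (t + i) ⟩
    partner y (t + i) + j     ≈⟨ mod-+ʳ j (e t) ⟩
    partner x t + i + j       ≈⟨ mod-reflexive (+-assoc (partner x t) i j) ⟩
    partner x t + (i + j)     ∎
    where open ModReasoning N

  shift-resp : ∀ {x y : Matching N} {i j} → i ≋ j [mod N ] → Shift x y i → Shift x y j
  shift-resp {x} {y} i≋j e t = mod-trans (partner-resp y (mod-+ˡ t (mod-sym i≋j)))
    (mod-trans (e t) (mod-+ˡ (partner x t) i≋j))

  -- Both hypotheses are evaluated at u = t - i. The lemma replaces subtraction of shifts and so
  -- yields inverses, remainders and conjugates.
  shift-cancel : ∀ {x y z : Matching N} {i j} → .{{_ : NonZero N}} →
                 Shift x y i → Shift x z (i + j) → Shift y z j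
  shift-cancel {x} {y} {z} {i} {j} e e′ t = begin
    partner z (t + j)             ≈⟨ partner-resp z (mod-+ʳ j t≋) ⟩
    partner z (u + i + j)         ≈⟨ mod-reflexive (cong (partner z) (+-assoc u i j)) ⟩
    partner z (u + (i + j))       ≈⟨ e′ u ⟩
    partner x u + (i + j)         ≈⟨ mod-reflexive (sym (+-assoc (partner x u) i j)) ⟩
    partner x u + i + j           ≈⟨ mod-+ʳ j (e u) ⟨
    partner y (u + i) + j         ≈⟨ mod-+ʳ j (partner-resp y t≋) ⟨
    partner y t + j               ∎
    where
    open ModReasoning N
    u = t + neg {N} i
    t≋ : t ≋ u + i [mod N ]
    t≋ = begin
      t                       ≈⟨ mod-reflexive (sym (+-identityʳ t)) ⟩
      t + 0                   ≈⟨ mod-+ˡ t (+-neg i) ⟨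
      t + (i + neg {N} i)     ≈⟨ mod-reflexive (trans (cong (t +_) (+-comm i _)) (sym (+-assoc t _ i))) ⟩
      t + neg {N} i + i       ∎

  module _ .{{_ : NonZero N}} where

    ∼ᵐ-sym : ∀ {x y : Matching N} → x ∼ᵐ y → y ∼ᵐ x
    ∼ᵐ-sym {x} {y} (i , e) = neg {N} i , shift-cancel {x} {y} {x} {i} e
      (shift-resp {x} {x} (mod-sym (+-neg i)) (shift-0 {x} {x} (λ t → mod-refl)))

    ∼ᵐ-isEquivalence : IsEquivalence (_∼ᵐ_ {N})
    ∼ᵐ-isEquivalence = record
      { refl = λ {x} → 0 , shift-0 {x} {x} (λ t → mod-refl)
      ; sym = λ {x} {y} → ∼ᵐ-sym {x} {y}
      ; trans = λ { {x} {y} {z} (i , e) (j , e′) → i + j , shift-+ {x} {y} {z} e e′ } }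

    shift? : ∀ (x y : Matching N) j → Dec (Shift x y j)
    shift? x y j = Dec.map′ extend (λ e {t} _ → e t)
      (allUpTo? (λ t → mod? (partner y (t + j)) (partner x t + j)) N)
      where
      extend : (∀ {t} → t < N → partner y (t + j) ≋ partner x t + j [mod N ]) → Shift x y j
      extend e t = mod-trans (partner-resp y (mod-+ʳ j (mod-% t)))
        (mod-trans (e (m%n<n t N)) (mod-+ʳ j (partner-resp x (mod-sym (mod-% t)))))

    _∼ᵐ?_ : ∀ (x y : Matching N) → Dec (x ∼ᵐ y)
    x ∼ᵐ? y = Dec.map′ (λ (j , _ , e) → j , e)
      (λ (j , e) → j % N , m%n<n j N , shift-resp {x} {y} (mod-% j) e)
      (anyUpTo? (shift? x y) N)

    rotate : ℕ → Matching N → Matching N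
    rotate i x = record
      { partner = λ t → partner x (t + neg {N} i) + i
      ; partner-resp = λ e → mod-+ʳ i (partner-resp x (mod-+ʳ _ e))
      ; involutive = λ t → begin
          partner x (partner x (t + neg {N} i) + i + neg {N} i) + i   ≈⟨ mod-+ʳ i (partner-resp x (back _)) ⟩
          partner x (partner x (t + neg {N} i)) + i                   ≈⟨ mod-+ʳ i (involutive x _) ⟩
          t + neg {N} i + i                                           ≈⟨ forth t ⟩
          t                                                           ∎
      ; unfixed = λ t e → unfixed x (t + neg {N} i) (mod-cancelʳ i (mod-trans e (mod-sym (forth t)))) }
      where
      open ModReasoning N
      back : ∀ t → t + i + neg {N} i ≋ t [mod N ]
      back t = mod-trans (mod-reflexive (+-assoc t i _))
        (mod-trans (mod-+ˡ t (+-neg i)) (mod-reflexive (+-identityʳ t)))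
      forth : ∀ t → t + neg {N} i + i ≋ t [mod N ]
      forth t = mod-trans (mod-reflexive (trans (+-assoc t _ i) (trans (cong (t +_) (+-comm _ i)) (sym (+-assoc t i _))))) (back t)

    rotate-shift : ∀ i (x : Matching N) → Shift x (rotate i x) i
    rotate-shift i x t = mod-+ʳ i (partner-resp x (mod-trans (mod-reflexive (+-assoc t i _))
      (mod-trans (mod-+ˡ t (+-neg i)) (mod-reflexive (+-identityʳ t)))))

-- Symmetries of a matching form a subgroup of ℤ containing N, hence pℤ.
Period : ∀ {N} → Matching N → ℕ → Set
Period x p = ∀ j → Shift x x j ⇔ p ∣ j

module _ {N : ℕ} .{{_ : NonZero N}} where

  shift-multiple : ∀ {x : Matching N} {i j} → Shift x x i → i ∣ j → Shift x x j
  shift-multiple {x} {i} e (divides s refl) = multiple s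
    where
    multiple : ∀ s → Shift x x (s * i)
    multiple zero    = shift-0 {x = x} {x} (λ t → mod-refl)
    multiple (suc s) = shift-+ {x = x} {x} {x} e (multiple s)

  shift-% : ∀ {x : Matching N} {i} j .{{_ : NonZero i}} → Shift x x i → Shift x x j → Shift x x (j % i)
  shift-% {x} {i} j e e′ = shift-cancel {x = x} {x} {x} {j / i * i} (shift-multiple {x} e (n∣m*n (j / i)))
    (subst (Shift x x) (trans (m≡m%n+[m/n]*n j i) (+-comm (j % i) _)) e′)

  shift-N : ∀ (x : Matching N) → Shift x x N
  shift-N x = shift-resp {x = x} {x} (mod-sym (∣⇒mod-0 ∣-refl)) (shift-0 {x = x} {x} (λ t → mod-refl))

  least-shift-period : ∀ {x : Matching N} {p} .{{_ : NonZero p}} → Shift x x p →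
                       (∀ i → 0 < i → i < p → ¬ Shift x x i) → Period x p
  least-shift-period {x} {p} e least j = mk⇔ (only (j % p) refl) (shift-multiple {x} e)
    where
    only : ∀ r → j % p ≡ r → Shift x x j → p ∣ j
    only zero    eq e′ = m%n≡0⇒n∣m j p eq
    -- A nonzero remainder of j modulo p would be a positive symmetry smaller than p.
    only (suc r) eq e′ = contradiction (subst (Shift x x) eq (shift-% {x} j e e′))
                                       (least (suc r) z<s (subst (_< p) eq (m%n<n j p)))

  period : ∀ (x : Matching N) → ∃ λ p → 0 < p × Period x p
  period x =
    let p , 0<p , e , least = least-positive (shift? x x) N (>-nonZero⁻¹ N) (shift-N x)
    in p , 0<p , least-shift-period {x} {{>-nonZero 0<p}} e least

  period-∣ : ∀ {x : Matching N} {p} → Period x p → p ∣ N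
  period-∣ {x} P = Equivalence.to (P N) (shift-N x)

  -- Rotations commute, so conjugation by the rotation from x to y leaves every symmetry unchanged.
  period-resp : ∀ {x y : Matching N} {p} → x ∼ᵐ y → Period x p → Period y p
  period-resp {x} {y} {p} (i , e) P j = mk⇔
    (λ e′ → Equivalence.to (P j) (conj x y (i , e) e′)) (λ p∣j → conj y x (∼ᵐ-sym {x = x} {y} (i , e)) (Equivalence.from (P j) p∣j))
    where
    conj : ∀ (x y : Matching N) {j} → x ∼ᵐ y → Shift y y j → Shift x x j
    conj x y {j} x∼y e′ =
      let i′ , e″ = ∼ᵐ-sym {x = x} {y} x∼y
      in shift-cancel {x = y} {x} {x} {i′} e″
           (subst (Shift y x) (+-comm j i′) (shift-+ {x = y} {y} {x} e′ e″))

  period-unique : ∀ {x : Matching N} {p p′} → Period x p → Period x p′ → p ≡ p′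
  period-unique P P′ = ∣-antisym
    (Equivalence.to (P _) (Equivalence.from (P′ _) ∣-refl))
    (Equivalence.to (P′ _) (Equivalence.from (P _) ∣-refl))

  period? : ∀ (x : Matching N) p → Dec (Period x p)
  period? x p =
    let p₀ , _ , P₀ = period x
    in Dec.map′ (λ e → subst (Period x) e P₀) (period-unique {x} P₀) (p₀ ≟ p)

  -- An orbit of matchings of period p consists of the p matchings
  -- rotate i x with i < p.
  orbit-enum : ∀ {p r} → 0 < p → Enum (_∼ᵐ_ {N}) (λ x → Period x p) r →
               Enum (_≈ᵐ_ {N}) (λ x → Period x p) (r * p)
  orbit-enum {p} {r} 0<p R = enum-reindex {P = λ x → Period x p} (↔-sym Fin.*↔×)
    (λ (i , j) → rotate (toℕ j) (at i))
    (λ (i , j) → period-resp {at i} {rotate (toℕ j) (at i)} (toℕ j , rotate-shift (toℕ j) (at i)) (holds i))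
    (λ (i , j) (i′ , j′) → distinct′ i j i′ j′)
    find′
    where
    open Enum R
    instance _ = >-nonZero 0<p
    open IsEquivalence (∼ᵐ-isEquivalence {N}) using () renaming (trans to ∼-trans; sym to ∼-sym)

    -- If two rotations of x agree, their difference i - j is a symmetry of x and hence a multiple
    -- of p.
    to-mod : ∀ {x : Matching N} i j → Period x p → rotate i x ≈ᵐ rotate j x → i ≋ j [mod p ]
    to-mod {x} i j P e = mod-cancelʳ (neg {N} j) (mod-trans (∣⇒mod-0 (Equivalence.to (P _) sh))
      (mod-sym (mod-weaken (period-∣ {x} P) (+-neg j))))
      where
      sh : Shift x x (i + neg {N} j)
      sh = shift-+ {x = x} {rotate i x} {x} (rotate-shift i x)
        (shift-cancel {x = x} {rotate i x} {x} {j}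
          (shift-+′ {rotate j x} {rotate i x} (rotate-shift j x) (λ t → mod-sym (e t)))
          (shift-resp {x = x} {x} (mod-sym (+-neg j)) (shift-0 {x = x} {x} (λ t → mod-refl))))
        where
        shift-+′ : ∀ {y z : Matching N} {j} → Shift x y j → y ≈ᵐ z → Shift x z j
        shift-+′ {y} {z} s e t = mod-trans (mod-sym (e (t + _))) (s t)

    distinct′ : ∀ i j i′ j′ → rotate (toℕ {p} j) (at i) ≈ᵐ rotate (toℕ {p} j′) (at i′) → (i , j) ≡ (i′ , j′)
    distinct′ i j i′ j′ e = same-orbit j j′
      (distinct {i} {i′}
        (∼-trans {at i} {rotate (toℕ j) (at i)} {at i′} (toℕ j , rotate-shift (toℕ j) (at i))
          (∼-trans {rotate (toℕ j) (at i)} {rotate (toℕ j′) (at i′)} {at i′}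
            (0 , shift-0 {x = rotate (toℕ j) (at i)} {rotate (toℕ j′) (at i′)} e)
            (∼-sym {at i′} {rotate (toℕ j′) (at i′)} (toℕ j′ , rotate-shift (toℕ j′) (at i′)))))) e
      where
      same-orbit : ∀ {i i′} j j′ → i ≡ i′ → rotate (toℕ {p} j) (at i) ≈ᵐ rotate (toℕ {p} j′) (at i′) → (i , j) ≡ (i′ , j′)
      same-orbit {i} j j′ refl e = cong (i ,_) (toℕ-injective (mod-small (toℕ<n j) (toℕ<n j′)
        (to-mod {at i} (toℕ j) (toℕ j′) (holds i) e)))

    -- Multiples of p are symmetries of `at i`, so m may be replaced by its remainder modulo p.
    in-orbit : ∀ i y m → Shift (at i) y m → ∃ λ (j : Fin p) → y ≈ᵐ rotate (toℕ j) (at i)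
    in-orbit i y m e = j , shift-≈ {x = y} {rotate (toℕ j) (at i)}
      (shift-cancel {x = at i} {y} {rotate (toℕ j) (at i)} {toℕ j} e′
        (subst (Shift (at i) (rotate (toℕ j) (at i))) (sym (+-identityʳ (toℕ j))) (rotate-shift (toℕ j) (at i))))
      where
      j = fromℕ< (m%n<n m p)
      e′ : Shift (at i) y (toℕ j)
      e′ = shift-cancel {x = at i} {at i} {y} {m / p * p}
        (Equivalence.from (holds i _) (n∣m*n (m / p)))
        (subst (Shift (at i) y) (trans (m≡m%n+[m/n]*n m p)
          (trans (+-comm (m % p) _) (cong (m / p * p +_) (sym (toℕ-fromℕ< (m%n<n m p)))))) e)

    find′ : ∀ y → Period y p → ∃ λ ((i , j) : Fin r × Fin p) → y ≈ᵐ rotate (toℕ j) (at i)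
    find′ y P =
      let i , y∼ = find y P
          m , e = ∼-sym {y} {at i} y∼
          j , e′ = in-orbit i y m e
      in (i , j) , e′

enum-map : ∀ {X Y : Set} {_≈_ : X → X → Set} {_≈′_ : Y → Y → Set} {P : X → Set} {Q : Y → Set} {n} →
           (φ : X → Y) → (∀ {x y} → x ≈ y → φ x ≈′ φ y) → (∀ {x y} → φ x ≈′ φ y → x ≈ y) →
           (∀ x → P x → Q (φ x)) → (∀ y → Q y → ∃ λ x → P x × y ≈′ φ x) →
           (∀ {x y z} → x ≈′ y → y ≈′ z → x ≈′ z) → Enum _≈_ P n → Enum _≈′_ Q n
enum-map φ φ-cong φ-inj P⇒Q onto ≈′-trans E = record
  { at = φ ∘ at
  ; holds = λ i → P⇒Q (at i) (holds i)
  ; distinct = distinct ∘ φ-inj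
  ; find = λ y Qy →
      let x , Px , y≈ = onto y Qy
          i , x≈ = find x Px
      in i , ≈′-trans y≈ (φ-cong x≈) }
  where open Enum E

-- Matchings invariant under translation by q as coloured involutions

module _ {N q k : ℕ} .{{_ : NonZero q}} (qk≡N : q * k ≡ N) where

  digits : ∀ {s s′} {i i′ : Fin q} → toℕ i + q * s ≋ toℕ i′ + q * s′ [mod N ] → i ≡ i′ × s ≋ s′ [mod k ]
  digits {s} {s′} {i} {i′} e =
    mod-digits (subst (λ N → toℕ i + q * s ≋ toℕ i′ + q * s′ [mod N ]) (sym qk≡N) e)

  from-digits : ∀ {s s′} {i i′ : Fin q} → i ≡ i′ → s ≋ s′ [mod k ] → toℕ i + q * s ≋ toℕ i′ + q * s′ [mod N ]
  from-digits {s} {s′} {i} refl e =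
    subst (λ N → toℕ i + q * s ≋ toℕ i + q * s′ [mod N ]) qk≡N (mod-+ˡ (toℕ i) (mod-scale q e))

  digits-of : ∀ t → t ≡ toℕ (t mod q) + q * (t / q)
  digits-of t = trans (m≡m%n+[m/n]*n t q)
    (cong₂ _+_ (sym (toℕ-fromℕ< (m%n<n t q))) (*-comm (t / q) q))

  module _ (x : Coloured k q) where
    open Coloured x

    encoded : ℕ → ℕ
    encoded t = toℕ (π (t mod q)) + q * (colour (t mod q) + t / q)

    -- The definition uses quotient and remainder of t, but any expansion congruent to t serves: its
    -- low digit is determined, and its high digit matters only modulo k.
    encoded-digits : ∀ t {i s} → t ≋ toℕ i + q * s [mod N ] →
                     encoded t ≋ toℕ (π i) + q * (colour i + s) [mod N ]
    encoded-digits t {i} {s} e =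
      let i≡ , s≋ = digits {t / q} {s} {t mod q} {i} (mod-trans (mod-reflexive (sym (digits-of t))) e)
      in from-digits (cong π i≡) (mod-+ (mod-reflexive (cong colour i≡)) s≋)

    encode : Matching N
    encode = record
      { partner = encoded
      ; partner-resp = λ {t} {u} e → mod-trans
          (encoded-digits t {u mod q} {u / q} (mod-trans e (mod-reflexive (digits-of u)))) mod-refl
      ; involutive = involutive′
      ; unfixed = λ t e → let π≡ , s≋ = digits (mod-trans e (mod-reflexive (digits-of t)))
                          in no-fixed (t mod q) π≡ (mod-cancelʳ (t / q) s≋) }
      where
      involutive′ : ∀ t → encoded (encoded t) ≋ t [mod N ]
      involutive′ t = begin
        encoded (encoded t)
          ≈⟨ encoded-digits (encoded t) mod-refl ⟩
        toℕ (π (π j)) + q * (colour (π j) + (colour j + t / q))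
          ≈⟨ from-digits (π-involutive j) (mod-trans (mod-reflexive (sym (+-assoc (colour (π j)) _ _))) (mod-+ʳ (t / q) (colour-π j))) ⟩
        toℕ j + q * (t / q)
          ≈⟨ mod-reflexive (sym (digits-of t)) ⟩
        t ∎
        where
        open ModReasoning N
        j = t mod q

    encode-shift : Shift encode encode q
    encode-shift t = begin
      encoded (t + q)                                  ≈⟨ encoded-digits (t + q) (mod-reflexive t+q) ⟩
      toℕ (π j) + q * (colour j + suc (t / q))         ≈⟨ mod-reflexive (carry (toℕ (π j)) q (colour j) (t / q)) ⟩
      toℕ (π j) + q * (colour j + t / q) + q           ∎
      where
      open ModReasoning N
      j = t mod q
      carry : ∀ i q s v → i + q * (s + suc v) ≡ i + q * (s + v) + q
      carry = solve-∀
      carry₀ : ∀ i q v → i + q * v + q ≡ i + q * suc v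
      carry₀ = solve-∀
      t+q : t + q ≡ toℕ j + q * suc (t / q)
      t+q = trans (cong (_+ q) (digits-of t)) (carry₀ (toℕ j) q (t / q))

    encoded-toℕ : ∀ j → encoded (toℕ j) ≋ toℕ (π j) + q * colour j [mod N ]
    encoded-toℕ j = mod-trans
      (encoded-digits (toℕ j) {j} {0} (mod-reflexive (sym (trans (cong (toℕ j +_) (*-zeroʳ q)) (+-identityʳ _)))))
      (mod-reflexive (cong (λ s → toℕ (π j) + q * s) (+-identityʳ (colour j))))

  encode-cong : ∀ {x y} → x ≈ᶜ y → encode x ≈ᵐ encode y
  encode-cong {x} {y} e t = from-digits (proj₁ (e (t mod q))) (mod-+ʳ (t / q) (proj₂ (e (t mod q))))

  encode-injective : ∀ {x y} → encode x ≈ᵐ encode y → x ≈ᶜ y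
  encode-injective {x} {y} e j = digits
    (mod-trans (mod-sym (encoded-toℕ x j)) (mod-trans (e (toℕ j)) (encoded-toℕ y j)))

  -- Invariance reduces x to its values at 0, ..., q-1. The low digit of such a value is the
  -- involution on residues, and the high digit is the colour.
  encode-onto : ∀ (x : Matching N) → Shift x x q → ∃ λ y → x ≈ᵐ encode y
  encode-onto x e = y , λ t → begin
    h t                                                    ≈⟨ mod-reflexive (cong h (digits-of t)) ⟩
    h (toℕ (t mod q) + q * (t / q))                        ≈⟨ h-digits (t mod q) (t / q) ⟩
    toℕ (π (t mod q)) + q * (s (t mod q) + t / q)          ∎
    where
    open ModReasoning N
    h = partner x
    π : Fin q → Fin q
    π j = h (toℕ j) mod q
    s : Fin q → ℕ
    s j = h (toℕ j) / q
    h-toℕ : ∀ j → h (toℕ j) ≡ toℕ (π j) + q * s j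
    h-toℕ j = digits-of (h (toℕ j))
    h-shift : ∀ t v → h (t + q * v) ≋ h t + q * v [mod N ]
    h-shift t zero = mod-reflexive (trans (cong h (trans (cong (t +_) (*-zeroʳ q)) (+-identityʳ t)))
                                          (sym (trans (cong (h t +_) (*-zeroʳ q)) (+-identityʳ (h t)))))
    h-shift t (suc v) = begin
      h (t + q * suc v)     ≈⟨ mod-reflexive (cong h (step t q v)) ⟩
      h (t + q * v + q)     ≈⟨ e (t + q * v) ⟩
      h (t + q * v) + q     ≈⟨ mod-+ʳ q (h-shift t v) ⟩
      h t + q * v + q       ≈⟨ mod-reflexive (sym (step (h t) q v)) ⟩
      h t + q * suc v       ∎
      where
      step : ∀ t q v → t + q * suc v ≡ t + q * v + q
      step = solve-∀
    h-digits : ∀ j v → h (toℕ j + q * v) ≋ toℕ (π j) + q * (s j + v) [mod N ]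
    h-digits j v = mod-trans (h-shift (toℕ j) v) (mod-reflexive
      (trans (cong (_+ q * v) (h-toℕ j)) (collect (toℕ (π j)) q (s j) v)))
      where
      collect : ∀ i q s v → i + q * s + q * v ≡ i + q * (s + v)
      collect = solve-∀
    -- Applying h twice and reading off digits gives at once that `π` is involutive and that the
    -- colours of partners cancel.
    hh : ∀ j → toℕ (π (π j)) + q * (s (π j) + s j) ≋ toℕ j + q * 0 [mod N ]
    hh j = begin
      toℕ (π (π j)) + q * (s (π j) + s j)   ≈⟨ h-digits (π j) (s j) ⟨
      h (toℕ (π j) + q * s j)               ≈⟨ mod-reflexive (cong h (sym (h-toℕ j))) ⟩
      h (h (toℕ j))                         ≈⟨ involutive x (toℕ j) ⟩
      toℕ j                                 ≈⟨ mod-reflexive (sym (trans (cong (toℕ j +_) (*-zeroʳ q)) (+-identityʳ _))) ⟩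
      toℕ j + q * 0                         ∎
    y : Coloured k q
    y = record
      { π = π
      ; colour = s
      ; π-involutive = λ j → proj₁ (digits (hh j))
      ; colour-π = λ j → proj₂ (digits {i = π (π j)} {j} (hh j))
      ; no-fixed = λ j πj≡j sj≋0 → unfixed x (toℕ j) (mod-trans (mod-reflexive (h-toℕ j))
          (mod-trans (from-digits πj≡j sj≋0)
            (mod-reflexive (trans (cong (toℕ j +_) (*-zeroʳ q)) (+-identityʳ _))))) }

  invariant-enum : ∀ {e} .{{_ : NonZero k}} → Halves k e →
                   Enum (_≈ᵐ_ {N}) (λ x → Shift x x q) (number e k q)
  invariant-enum H = enum-map encode (λ {x} {y} → encode-cong {x} {y}) (λ {x} {y} → encode-injective {x} {y})
    (λ x _ → encode-shift x) (λ x e → let y , x≈ = encode-onto x e in y , tt , x≈)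
    (λ e e′ t → mod-trans (e t) (e′ t)) (coloured-enum H q)

-- Elements of order two in ℤ/k

odd-halves : ∀ κ → Halves (1 + 2 * κ) 0
odd-halves κ = record
  { half = λ () ; half-double = λ () ; half-nonzero = λ () ; half-distinct = λ { {()} }
  ; half-find = λ x 2x≋0 x≢0 → contradiction (∣⇒mod-0 (no-half x (mod-0⇒∣ 2x≋0))) x≢0 }
  where
  -- Modulo 1 + 2κ the number κ + 1 is an inverse of 2, so multiplying 2x by it recovers x.
  no-half : ∀ x → 1 + 2 * κ ∣ x + x → 1 + 2 * κ ∣ x
  no-half x d = ∣m+n∣m⇒∣n
    (subst (1 + 2 * κ ∣_) (split κ x) (∣m⇒∣m*n (suc κ) d))
    (m∣m*n x)
    where
    split : ∀ κ x → (x + x) * suc κ ≡ (1 + 2 * κ) * x + x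
    split = solve-∀

-- If 2κ divides 2x then κ divides x, and modulo 2κ only the parity of x/κ remains: even gives zero,
-- odd gives κ.
even-halves : ∀ κ .{{_ : NonZero κ}} → Halves (2 * κ) 1
even-halves κ = record
  { half = λ _ → κ
  ; half-double = λ _ → mod-trans (mod-reflexive (cong (κ +_) (sym (+-identityʳ κ)))) (∣⇒mod-0 ∣-refl)
  ; half-nonzero = λ _ κ≋0 → >⇒∤ (m<m+n κ (subst (0 <_) (sym (+-identityʳ κ)) (>-nonZero⁻¹ κ))) (mod-0⇒∣ κ≋0)
  ; half-distinct = λ { {zero} {zero} _ → refl }
  ; half-find = λ x 2x≋0 x≢0 → zero , half-find′ x (mod-0⇒∣ 2x≋0) x≢0 }
  where
  half-find′ : ∀ x → 2 * κ ∣ x + x → ¬ x ≋ 0 [mod 2 * κ ] → x ≋ κ [mod 2 * κ ]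
  half-find′ x d x≢0 = subst (_≋ κ [mod 2 * κ ]) (sym x≡) (odd-multiple s (λ e → x≢0 (mod-trans (mod-reflexive x≡) e)))
    where
    κ∣x : κ ∣ x
    κ∣x = *-cancelˡ-∣ 2 (subst (2 * κ ∣_) (cong (x +_) (sym (+-identityʳ x))) d)
    s = quotient κ∣x
    x≡ = m∣n⇒n≡quotient*m κ∣x
    odd-multiple : ∀ s → ¬ s * κ ≋ 0 [mod 2 * κ ] → s * κ ≋ κ [mod 2 * κ ]
    odd-multiple 0 0≢0 = contradiction mod-refl 0≢0
    odd-multiple 1 _ = mod-reflexive (+-identityʳ κ)
    odd-multiple (suc (suc s)) ≢0 = mod-trans (mod-sym (drop s))
      (odd-multiple s (λ e → ≢0 (mod-trans (mod-sym (drop s)) e)))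
      where
      drop : ∀ s → s * κ ≋ suc (suc s) * κ [mod 2 * κ ]
      drop s = mod-eq 1 0 (solved κ s)
        where
        solved : ∀ κ s → s * κ + 1 * (2 * κ) ≡ suc (suc s) * κ + 0 * (2 * κ)
        solved = solve-∀

-- From maps to matchings

mate : ∀ {n} → Nc n → Nc n
mate (i , β) = i , not β

mate-mate : ∀ {n} (y : Nc n) → mate (mate y) ≡ y
mate-mate (i , β) = cong (i ,_) (not-involutive β)

mate-≢ : ∀ {n} (y : Nc n) → mate y ≢ y
mate-≢ (i , false) ()
mate-≢ (i , true)  ()

nb-injective : ∀ {n} {y z : Nc n} → nb y ≡ nb z → y ≡ z
nb-injective {y = i , false} {_ , false} refl = refl
nb-injective {y = i , true}  {_ , true}  refl = refl

ρ̂-nb : ∀ {n} (M : Map n) y → ρ̂ M (nb y) ≡ nb (to (ρc M) y)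
ρ̂-nb M (i , false) = refl
ρ̂-nb M (i , true)  = refl

Nc↔Fin : ∀ n → Nc n ↔ Fin (n * 2)
Nc↔Fin n = ↔-sym Fin.*↔× ↔-∘ (↔-id _ ×-↔ ↔-sym Fin.2↔Bool)

nc-enum : ∀ n → Enum _≡_ (λ (_ : Nc n) → ⊤) (n * 2)
nc-enum n = enum-reindex (Nc↔Fin n) id (λ _ → tt) (λ _ _ e → e) (λ y _ → y , refl)

≡-isEquivalence : ∀ {X : Set} → IsEquivalence (_≡_ {A = X})
≡-isEquivalence = record { refl = refl ; sym = sym ; trans = trans }

module _ {X : Set} (g : X → X) where

  iterate-+ : ∀ s t x → iterate g (s + t) x ≡ iterate g s (iterate g t x)
  iterate-+ zero    t x = refl
  iterate-+ (suc s) t x = cong g (iterate-+ s t x)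

  iterate-fixed : ∀ {x} → g x ≡ x → ∀ s → iterate g s x ≡ x
  iterate-fixed e zero    = refl
  iterate-fixed e (suc s) = trans (cong g (iterate-fixed e s)) e

  iterate-suc : ∀ s x → iterate g s (g x) ≡ g (iterate g s x)
  iterate-suc s x = trans (sym (iterate-+ s 1 x)) (cong (λ t → iterate g t x) (+-comm s 1))

  iterate-* : ∀ m {h : X → X} → (∀ x → h x ≡ iterate g m x) → ∀ s x → iterate h s x ≡ iterate g (s * m) x
  iterate-* m e zero    x = refl
  iterate-* m e (suc s) x = trans (e _) (trans (cong (iterate g m) (iterate-* m e s x)) (sym (iterate-+ m (s * m) x)))

  iterate-multiple : ∀ {d} → (∀ x → iterate g d x ≡ x) → ∀ s x → iterate g (s * d) x ≡ x
  iterate-multiple {d} e zero    x = refl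
  iterate-multiple {d} e (suc s) x = trans (iterate-+ d (s * d) x) (trans (e _) (iterate-multiple e s x))

to-injective : ∀ {X : Set} (σ : Perm X) {x y} → to σ x ≡ to σ y → x ≡ y
to-injective σ {x} {y} e = trans (sym (from∘to σ x)) (trans (cong (from σ) e) (from∘to σ y))

iterate-injective : ∀ {X : Set} (σ : Perm X) s {x y} → iterate (to σ) s x ≡ iterate (to σ) s y → x ≡ y
iterate-injective σ zero    e = e
iterate-injective σ (suc s) e = iterate-injective σ s (to-injective σ e)

-- Preserving the pairs means commuting with `mate`; this form spares the later proofs the case
-- distinction hidden in `pairs`.
Γ-nb : ∀ {n} (γ : Γ n) y → ∃ λ z → to (perm γ) (nb y) ≡ nb z × to (perm γ) (nb (mate y)) ≡ nb (mate z)
Γ-nb γ (i , β) with pairs γ i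
Γ-nb γ (i , false) | j , inj₁ (e , e′) = (j , false) , e , e′
Γ-nb γ (i , false) | j , inj₂ (e , e′) = (j , true)  , e , e′
Γ-nb γ (i , true)  | j , inj₁ (e , e′) = (j , true)  , e′ , e
Γ-nb γ (i , true)  | j , inj₂ (e , e′) = (j , false) , e′ , e

vertex-cases : ∀ {n} (Q : Vertex n → Set) → Q c → (∀ y → Q (nb y)) → ∀ v → Q v
vertex-cases Q Qc Qnb c      = Qc
vertex-cases Q Qc Qnb (a i)  = Qnb (i , false)
vertex-cases Q Qc Qnb (a' i) = Qnb (i , true)

lift : ∀ {n} → (Nc n → Nc n) → Vertex n → Vertex n
lift g c      = c
lift g (a i)  = nb (g (i , false))
lift g (a' i) = nb (g (i , true))

lift-nb : ∀ {n} (g : Nc n → Nc n) y → lift g (nb y) ≡ nb (g y)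
lift-nb g (i , false) = refl
lift-nb g (i , true)  = refl

lift-inverse : ∀ {n} (g h : Nc n → Nc n) → (∀ y → g (h y) ≡ y) → ∀ v → lift g (lift h v) ≡ v
lift-inverse g h e = vertex-cases _ refl
  (λ y → trans (cong (lift g) (lift-nb h y)) (trans (lift-nb g (h y)) (cong nb (e y))))

liftΓ : ∀ {n} (g h : Nc n → Nc n) → (∀ y → g (h y) ≡ y) → (∀ y → h (g y) ≡ y) →
        (∀ y → g (mate y) ≡ mate (g y)) → Γ n
liftΓ {n} g h gh hg g-mate = record
  { perm  = record { to = lift g ; from = lift h ; to∘from = lift-inverse g h gh ; from∘to = lift-inverse h g hg }
  ; fix-c = refl
  ; pairs = λ i → pair i (g (i , false)) refl }
  where
  pair : ∀ i y → g (i , false) ≡ y → ∃ λ j → (lift g (a i) ≡ a j × lift g (a' i) ≡ a' j) ⊎ (lift g (a i) ≡ a' j × lift g (a' i) ≡ a j)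
  pair i (j , false) e = j , inj₁ (cong nb e , cong nb (trans (g-mate (i , false)) (cong mate e)))
  pair i (j , true)  e = j , inj₂ (cong nb e , cong nb (trans (g-mate (i , false)) (cong mate e)))

-- Reading the rotation of M at c from a base point x₀ labels the neighbours
-- of c by ℤ/2n; the matching of M is the involution a i ↔ a' i in these labels.
module Position {n : ℕ} .{{_ : NonZero n}} (x₀ : Nc n) (M : Map n) where

  instance
    2n≢0 : NonZero (2 * n)
    2n≢0 = m*n≢0 2 n

  place : ℕ → Nc n
  place t = iterate (to (ρc M)) t x₀

  label : Nc n → ℕ
  label y = proj₁ (cyclic M x₀ y)

  place-label : ∀ y → place (label y) ≡ y
  place-label y = proj₂ (cyclic M x₀ y)

  place-+ : ∀ s t → place t ≡ x₀ → place (s + t) ≡ place s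
  place-+ s t e = trans (iterate-+ _ s t x₀) (cong (iterate (to (ρc M)) s) e)

  place-∸ : ∀ s r → place s ≡ place (s + r) → place r ≡ x₀
  place-∸ s r e = sym (iterate-injective (ρc M) s (trans e (iterate-+ _ s r x₀)))

  -- Cyclicity leads from the successor of `x₀` back to `x₀`, so a positive return time exists. Its
  -- least value is identified with 2n by counting.
  return : ∃ λ p → 0 < p × place p ≡ x₀ × (∀ m → 0 < m → m < p → place m ≢ x₀)
  return = least-positive (λ m → Product.≡-dec Fin._≟_ Bool._≟_ (place m) x₀) (suc k) z<s
    (trans (sym (iterate-suc _ k x₀)) (proj₂ (cyclic M (to (ρc M) x₀) x₀)))
    where k = proj₁ (cyclic M (to (ρc M) x₀) x₀)

  module Return (p : ℕ) (0<p : 0 < p) (return-p : place p ≡ x₀)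
                (least : ∀ m → 0 < m → m < p → place m ≢ x₀) where

    instance
      p≢0 : NonZero p
      p≢0 = >-nonZero 0<p

    place-multiple : ∀ s t → place (t + s * p) ≡ place t
    place-multiple s t = place-+ t (s * p) (iterate-return s)
      where
      iterate-return : ∀ s → place (s * p) ≡ x₀
      iterate-return zero    = refl
      iterate-return (suc s) = trans (cong place (+-comm p (s * p)))
        (trans (place-+ (s * p) p return-p) (iterate-return s))

    place-mod : ∀ {s t} → s ≋ t [mod p ] → place s ≡ place t
    place-mod {s} {t} (mod-eq u v e) =
      trans (sym (place-multiple u s)) (trans (cong place e) (place-multiple v t))

    place-inj-≤ : ∀ {s t} → s ≤ t → t < p → place s ≡ place t → s ≡ t
    place-inj-≤ {s} {t} s≤t t<p e with t ∸ s | m+[n∸m]≡n s≤t | m∸n≤m t s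
    ... | zero  | s+r≡t | _   = trans (sym (+-identityʳ s)) s+r≡t
    ... | suc r | s+r≡t | r≤t = contradiction (place-∸ s (suc r) (trans e (cong place (sym s+r≡t))))
                                              (least (suc r) z<s (≤-<-trans r≤t t<p))

    place-inj : ∀ {s t} → s < p → t < p → place s ≡ place t → s ≡ t
    place-inj {s} {t} s<p t<p e with ≤-total s t
    ... | inj₁ s≤t = place-inj-≤ s≤t t<p e
    ... | inj₂ t≤s = sym (place-inj-≤ t≤s s<p (sym e))

    place-enum : Enum _≡_ (λ (_ : Nc n) → ⊤) p
    place-enum = record
      { at = place ∘ toℕ
      ; holds = λ _ → tt
      ; distinct = λ {i} {j} e → toℕ-injective (place-inj (toℕ<n i) (toℕ<n j) e)
      ; find = λ y _ → fromℕ< (m%n<n (label y) p) ,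
          trans (sym (place-label y)) (trans (place-mod (mod-% (label y)))
            (cong place (sym (toℕ-fromℕ< (m%n<n (label y) p))))) }

    -- The places before the first return list every neighbour of c exactly once.
    p≡2n : p ≡ 2 * n
    p≡2n = trans (enum-unique ≡-isEquivalence id id place-enum (nc-enum n)) (*-comm n 2)

    mod-place : ∀ {s t} → place s ≡ place t → s ≋ t [mod p ]
    mod-place {s} {t} e = %⇒mod (place-inj (m%n<n s p) (m%n<n t p)
      (trans (place-mod (mod-sym (mod-% s))) (trans e (place-mod (mod-% t)))))

  place-cong : ∀ {s t} → s ≋ t [mod 2 * n ] → place s ≡ place t
  place-cong {s} {t} e =
    let p , 0<p , return-p , least = return
        open Return p 0<p return-p least
    in place-mod (subst (s ≋ t [mod_]) (sym p≡2n) e)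

  place-injective : ∀ {s t} → place s ≡ place t → s ≋ t [mod 2 * n ]
  place-injective {s} {t} e =
    let p , 0<p , return-p , least = return
        open Return p 0<p return-p least
    in subst (s ≋ t [mod_]) p≡2n (mod-place e)

  label-place : ∀ t → label (place t) ≋ t [mod 2 * n ]
  label-place t = place-injective (place-label (place t))

  place-partner : ∀ t → place (label (mate (place t))) ≡ mate (place t)
  place-partner t = place-label (mate (place t))

  matching : Matching (2 * n)
  matching = record
    { partner = λ t → label (mate (place t))
    ; partner-resp = λ e → mod-reflexive (cong (label ∘ mate) (place-cong e))
    ; involutive = λ t → place-injective (trans (place-partner (label (mate (place t))))
        (trans (cong mate (place-partner t)) (mate-mate (place t))))
    ; unfixed = λ t e → mate-≢ (place t) (trans (sym (place-partner t)) (place-cong e)) }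

module _ {n : ℕ} .{{_ : NonZero n}} (x₀ : Nc n) where
  open Position x₀ using (place; label; matching; place-label; place-cong; place-injective; label-place; place-partner)

  private instance
    2n≢0 : NonZero (2 * n)
    2n≢0 = m*n≢0 2 n

  Translates : Γ n → Map n → Map n → ℕ → Set
  Translates γ M M′ j = ∀ t → to (perm γ) (nb (place M t)) ≡ nb (place M′ (t + j))

  -- Since γ intertwines the two rotations at c, the image of `x₀` determines it; the offset j found
  -- there persists along the cycle by induction on t.
  act⇒translates : ∀ γ {M M′} → γ · M ↦ M′ → ∃ (Translates γ M M′)
  act⇒translates γ {M} {M′} act = j , translates
    where
    z = Γ-nb γ x₀
    j = label M′ (proj₁ z)
    translates : Translates γ M M′ j
    translates zero    = trans (proj₁ (proj₂ z)) (cong nb (sym (place-label M′ (proj₁ z))))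
    translates (suc t) = begin
      to (perm γ) (nb (place M (suc t)))          ≡⟨ cong (to (perm γ)) (sym (ρ̂-nb M (place M t))) ⟩
      to (perm γ) (ρ̂ M (nb (place M t)))          ≡⟨ act (place M t) ⟨
      ρ̂ M′ (to (perm γ) (nb (place M t)))         ≡⟨ cong (ρ̂ M′) (translates t) ⟩
      ρ̂ M′ (nb (place M′ (t + j)))                ≡⟨ ρ̂-nb M′ (place M′ (t + j)) ⟩
      nb (place M′ (suc t + j))                   ∎
      where open ≡-Reasoning

  -- Because γ commutes with `mate`, translating positions by j carries one chord diagram to the
  -- other.
  translates⇒shift : ∀ γ {M M′ j} → Translates γ M M′ j → Shift (matching M) (matching M′) j
  translates⇒shift γ {M} {M′} {j} translates t = place-injective M′ (nb-injective (begin
    nb (place M′ (partner (matching M′) (t + j)))         ≡⟨ cong nb (place-partner M′ (t + j)) ⟩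
    nb (mate (place M′ (t + j)))                          ≡⟨ cong (nb ∘ mate) (nb-injective (trans (sym (translates t)) (proj₁ (proj₂ z)))) ⟩
    nb (mate (proj₁ z))                                   ≡⟨ proj₂ (proj₂ z) ⟨
    to (perm γ) (nb (mate (place M t)))                   ≡⟨ cong (to (perm γ) ∘ nb) (place-partner M t) ⟨
    to (perm γ) (nb (place M (partner (matching M) t)))   ≡⟨ translates (partner (matching M) t) ⟩
    nb (place M′ (partner (matching M) t + j))            ∎))
    where
    open ≡-Reasoning
    z = Γ-nb γ (place M t)

  -- Read a position in `M`, add j and place the result in `M′`. Such a map respects the rotations
  -- by construction; the hypothesis on the diagrams is what makes it respect the pairs and so
  -- belong to Γ.
  shift⇒act : ∀ {M M′ j} → Shift (matching M) (matching M′) j → ∃ λ γ → γ · M ↦ M′ × Translates γ M M′ j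
  shift⇒act {M} {M′} {j} shift = γ , act , λ t → trans (lift-nb g (place M t)) (cong nb (g-place t))
    where
    g h : Nc n → Nc n
    g y = place M′ (label M y + j)
    h y = place M (label M′ y + neg {2 * n} j)
    g-place : ∀ t → g (place M t) ≡ place M′ (t + j)
    g-place t = place-cong M′ (mod-+ʳ j (label-place M t))
    h-place : ∀ t → h (place M′ t) ≡ place M (t + neg {2 * n} j)
    h-place t = place-cong M (mod-+ʳ _ (label-place M′ t))
    return : ∀ t → t + j + neg {2 * n} j ≋ t [mod 2 * n ]
    return t = mod-trans (mod-reflexive (+-assoc t j _)) (mod-trans (mod-+ˡ t (+-neg j)) (mod-reflexive (+-identityʳ t)))
    gh : ∀ y → g (h y) ≡ y
    gh y = trans (g-place (label M′ y + neg {2 * n} j)) (trans (place-cong M′ (mod-trans (mod-reflexive (swap (label M′ y) j (neg {2 * n} j)))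
      (return (label M′ y)))) (place-label M′ y))
      where
      swap : ∀ x y z → x + z + y ≡ x + y + z
      swap = solve-∀
    hg : ∀ y → h (g y) ≡ y
    hg y = trans (h-place (label M y + j)) (trans (place-cong M (return (label M y))) (place-label M y))
    along-place : ∀ (Q : Nc n → Set) → (∀ t → Q (place M t)) → ∀ y → Q y
    along-place Q q y = subst Q (place-label M y) (q (label M y))
    g-mate : ∀ y → g (mate y) ≡ mate (g y)
    g-mate = along-place (λ y → g (mate y) ≡ mate (g y)) λ t → begin
      g (mate (place M t))                        ≡⟨ cong g (place-partner M t) ⟨
      g (place M (partner (matching M) t))        ≡⟨ g-place (partner (matching M) t) ⟩
      place M′ (partner (matching M) t + j)       ≡⟨ place-cong M′ (shift t) ⟨
      place M′ (partner (matching M′) (t + j))    ≡⟨ place-partner M′ (t + j) ⟩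
      mate (place M′ (t + j))                     ≡⟨ cong mate (g-place t) ⟨
      mate (g (place M t))                        ∎
      where open ≡-Reasoning
    γ : Γ n
    γ = liftΓ g h gh hg g-mate
    act : γ · M ↦ M′
    act = along-place (λ y → ρ̂ M′ (lift g (nb y)) ≡ lift g (ρ̂ M (nb y))) λ t → begin
      ρ̂ M′ (lift g (nb (place M t)))        ≡⟨ cong (ρ̂ M′) (trans (lift-nb g _) (cong nb (g-place t))) ⟩
      ρ̂ M′ (nb (place M′ (t + j)))          ≡⟨ ρ̂-nb M′ _ ⟩
      nb (place M′ (suc t + j))             ≡⟨ cong nb (g-place (suc t)) ⟨
      nb (g (place M (suc t)))              ≡⟨ lift-nb g _ ⟨
      lift g (nb (place M (suc t)))         ≡⟨ cong (lift g) (ρ̂-nb M _) ⟨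
      lift g (ρ̂ M (nb (place M t)))         ∎
      where open ≡-Reasoning

  sameOrbit⇒∼ : ∀ {M M′} → SameOrbit M M′ → matching M ∼ᵐ matching M′
  sameOrbit⇒∼ {M} {M′} (γ , act) =
    let j , translates = act⇒translates γ {M} {M′} act in j , translates⇒shift γ {M} {M′} translates

  ∼⇒sameOrbit : ∀ {M M′} → matching M ∼ᵐ matching M′ → SameOrbit M M′
  ∼⇒sameOrbit {M} {M′} (j , shift) = let γ , act , _ = shift⇒act {M} {M′} shift in γ , act

  module _ {M : Map n} where

    translates-iterate : ∀ {γ j} → Translates γ M M j → ∀ s t →
                         iterate (to (perm γ)) s (nb (place M t)) ≡ nb (place M (t + s * j))
    translates-iterate {γ} {j} translates zero    t = cong (nb ∘ place M) (sym (+-identityʳ t))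
    translates-iterate {γ} {j} translates (suc s) t =
      trans (cong (to (perm γ)) (translates-iterate {γ} translates s t))
        (trans (translates (t + s * j)) (cong (nb ∘ place M) (regroup t s j)))
      where
      regroup : ∀ t s j → t + s * j + j ≡ t + suc s * j
      regroup = solve-∀

    on-vertices : ∀ (Q : Vertex n → Set) → Q c → (∀ t → Q (nb (place M t))) → ∀ v → Q v
    on-vertices Q Qc Qnb = vertex-cases Q Qc (λ y → subst (Q ∘ nb) (place-label M y) (Qnb (label M y)))

    -- The generator is the element of Γ that translates positions by p. Every other stabilising
    -- element translates by a multiple of p, and positions are counted modulo d p.
    period⇒stab : ∀ {d p} → d * p ≡ 2 * n → Period (matching M) p → StabCyclicOfOrder d M
    period⇒stab {d} {p} dp≡2n P =
      let g , inStab , translates = shift⇒act {M} {M} (Equivalence.from (P p) ∣-refl)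
      in g , inStab , generates g translates , power-d g translates , minimal g translates ,
         n≢0⇒n>0 (λ d≡0 → ≢-nonZero⁻¹ (2 * n) (trans (sym dp≡2n) (cong (_* p) d≡0)))
      where
      generates : ∀ g → Translates g M M p → ∀ h → InStab M h →
                  ∃ λ k → ∀ v → to (perm h) v ≡ iterate (to (perm g)) k v
      generates g translates h stab =
        let j , h-translates = act⇒translates h {M} {M} stab
            p∣j = Equivalence.to (P j) (translates⇒shift h {M} {M} h-translates)
            k = quotient p∣j
        in k , on-vertices (λ v → to (perm h) v ≡ iterate (to (perm g)) k v)
          (trans (fix-c h) (sym (iterate-fixed _ (fix-c g) k)))
          (λ t → trans (h-translates t)
            (trans (cong (λ j → nb (place M (t + j))) (m∣n⇒n≡quotient*m p∣j))
                   (sym (translates-iterate {g} translates k t))))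
      power-d : ∀ g → Translates g M M p → g ^Γ d ≈id
      power-d g translates = on-vertices (λ v → iterate (to (perm g)) d v ≡ v) (iterate-fixed _ (fix-c g) d)
        (λ t → trans (translates-iterate {g} translates d t) (cong nb (place-cong M
          (mod-trans (mod-+ˡ t (∣⇒mod-0 (∣-reflexive (sym dp≡2n)))) (mod-reflexive (+-identityʳ t))))))
      minimal : ∀ g → Translates g M M p → ∀ k → 1 ≤ k → k < d → ¬ (g ^Γ k ≈id)
      -- If the k-th power fixes the base point, then d p divides k p, so d divides k, which is
      -- impossible for 0 < k < d.
      minimal g translates k 1≤k k<d e = >⇒∤ {{>-nonZero 1≤k}} k<d
        (*-cancelʳ-∣ p {{p≢0}} (subst (_∣ k * p) (sym dp≡2n) (mod-0⇒∣ (place-injective M (nb-injective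
          (trans (sym (translates-iterate {g} translates k 0)) (e (nb x₀))))))))
        where
        p≢0 : NonZero p
        p≢0 = ≢-nonZero (λ p≡0 → ≢-nonZero⁻¹ (2 * n)
          (trans (sym dp≡2n) (trans (cong (d *_) p≡0) (*-zeroʳ d))))

  -- The second generator is a power of the first, so its d-th power is trivial, and minimality of
  -- d′ applies.
  order-≤ : ∀ {M : Map n} {d d′} → StabCyclicOfOrder d M → StabCyclicOfOrder d′ M → d′ ≤ d
  order-≤ {M} {d} {d′} (g , _ , gen , g^d , _ , 1≤d) (g′ , stab′ , _ , _ , minimal′ , _) with d′ ≤? d
  ... | yes d′≤d = d′≤d
  ... | no  d′≰d = contradiction g′^d (minimal′ d 1≤d (≰⇒> d′≰d))
    where
    m = proj₁ (gen g′ stab′)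
    g′^d : g′ ^Γ d ≈id
    g′^d v = trans (iterate-* _ m (proj₂ (gen g′ stab′)) d v)
      (trans (cong (λ s → iterate (to (perm g)) s v) (*-comm d m)) (iterate-multiple _ g^d m v))

  -- The matching has some period p₀, which makes the stabiliser cyclic of order 2n/p₀. Uniqueness
  -- of the order gives d = 2n/p₀, whence p₀ = p.
  stab⇒period : ∀ {M d p} → d * p ≡ 2 * n → StabCyclicOfOrder d M → Period (matching M) p
  stab⇒period {M} {d} {p} dp≡2n stab =
    let p₀ , 0<p₀ , P₀ = period (matching M)
        p₀∣2n = period-∣ {x = matching M} P₀
        d₀ = quotient p₀∣2n
        d₀p₀≡2n = sym (m∣n⇒n≡quotient*m p₀∣2n)
        stab₀ = period⇒stab {M} {d₀} {p₀} d₀p₀≡2n P₀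
        d≡d₀ = ≤-antisym (order-≤ {M} stab₀ stab) (order-≤ {M} stab stab₀)
        d≢0 = ≢-nonZero (λ d≡0 → ≢-nonZero⁻¹ (2 * n) (trans (sym dp≡2n) (cong (_* p) d≡0)))
    in subst (Period (matching M)) (*-cancelˡ-≡ p₀ p d {{d≢0}}
         (trans (cong (_* p₀) d≡d₀) (trans d₀p₀≡2n (sym dp≡2n)))) P₀

-- From matchings to maps

-- A naming of the points by pairs a, a' in which partners become mates. The number of pairs is left
-- open and is computed from q afterwards.
record Pairing (q : ℕ) (π : Fin q → Fin q) : Set where
  field
    pairCount     : ℕ
    point         : Nc pairCount → Fin q
    point-inj     : ∀ {y z} → point y ≡ point z → y ≡ z
    point-find    : ∀ i → ∃ λ y → i ≡ point y
    point-mate    : ∀ y → point (mate y) ≡ π (point y)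

-- The transposition through zero is removed as in the enumeration of coloured involutions, and its
-- two points become the pair with index zero.
add-pair : ∀ {q} (x : Coloured 1 (suc (suc q))) {j} → Coloured.π x zero ≡ suc j →
           (∀ y → Pairing q (Coloured.π y)) → Pairing (suc (suc q)) (Coloured.π x)
add-pair {q} x {j} π0 rec = record
  { pairCount = suc pairCount
  ; point = point′
  ; point-inj = λ {y} {z} → point-inj′ y z
  ; point-find = point-find′
  ; point-mate = point-mate′ }
  where
  y = proj₁ (split-pair x j π0)
  x≈ = proj₂ (split-pair x j π0) _ mod-refl
  open Coloured x using (π; π-involutive)
  open Pairing (rec y)
  point′ : Nc (suc pairCount) → Fin (suc (suc q))
  point′ (zero  , false) = zero
  point′ (zero  , true)  = suc j
  point′ (suc i , β)     = suc (punchIn j (point (i , β)))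
  lift-inj : ∀ {y z : Nc pairCount} → y ≡ z → (suc (proj₁ y) , proj₂ y) ≡ (suc (proj₁ z) , proj₂ z)
  lift-inj refl = refl
  point-inj′ : ∀ y z → point′ y ≡ point′ z → y ≡ z
  point-inj′ (zero  , false) (zero  , false) e = refl
  point-inj′ (zero  , true)  (zero  , true)  e = refl
  point-inj′ (zero  , true)  (suc i , β)     e = contradiction (sym (Fin.suc-injective e)) (punchInᵢ≢i j _)
  point-inj′ (suc i , β)     (zero  , true)  e = contradiction (Fin.suc-injective e) (punchInᵢ≢i j _)
  point-inj′ (suc i , β)     (suc i′ , β′)   e =
    lift-inj (point-inj (punchIn-injective j _ _ (Fin.suc-injective e)))
  point-find′ : ∀ i → ∃ λ y → i ≡ point′ y
  point-find′ zero = (zero , false) , refl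
  point-find′ (suc z) with punchIn-view j z
  ... | inj₁ refl = (zero , true) , refl
  ... | inj₂ (w , refl) = let (i , β) , e = point-find w in (suc i , β) , cong (suc ∘ punchIn j) e
  point-mate′ : ∀ y → point′ (mate y) ≡ π (point′ y)
  point-mate′ (zero  , false) = sym π0
  point-mate′ (zero  , true)  = sym (trans (cong π (sym π0)) (π-involutive zero))
  point-mate′ (suc i , β)     = sym (trans (proj₁ (x≈ (suc (punchIn j (point (i , β))))))
    (trans (insertAt-punchIn _ j zero (point (i , β))) (cong (suc ∘ punchIn j) (sym (point-mate (i , β))))))

-- Modulo 1 every colour is zero, so for `k = 1` the field `no-fixed` excludes all fixed points.
unfixed-zero : ∀ {q} (x : Coloured 1 (suc q)) → Coloured.π x zero ≢ zero
unfixed-zero x π0 = Coloured.no-fixed x zero π0 (∣⇒mod-0 (1∣ _))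

pairing-step : ∀ {q} (x : Coloured 1 (suc (suc q))) → (∀ y → Pairing q (Coloured.π y)) →
               ∀ j → Coloured.π x zero ≡ j → Pairing (suc (suc q)) (Coloured.π x)
pairing-step x rec zero    π0 = contradiction π0 (unfixed-zero x)
pairing-step x rec (suc j) π0 = add-pair x π0 rec

pairing : ∀ q (x : Coloured 1 q) → Pairing q (Coloured.π x)
pairing 0 x = record
  { pairCount = 0 ; point = λ { (() , _) } ; point-inj = λ { {() , _} }
  ; point-find = λ () ; point-mate = λ { (() , _) } }
pairing 1 x with Coloured.π x zero in π0
... | zero = contradiction π0 (unfixed-zero x)
pairing (suc (suc q)) x = pairing-step x (pairing q) (Coloured.π x zero) refl

pairing-size : ∀ {q π} (P : Pairing q π) → q ≡ Pairing.pairCount P * 2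
pairing-size {q} P = enum-unique ≡-isEquivalence {P = λ _ → ⊤} {λ _ → ⊤} id id
  (record { at = id ; holds = λ _ → tt ; distinct = id ; find = λ i _ → i , refl })
  (enum-map point (cong point) point-inj (λ _ _ → tt) (λ i _ → let y , e = point-find i in y , tt , e)
    trans (nc-enum pairCount))
  where open Pairing P

module _ {n : ℕ} .{{_ : NonZero n}} (x₀ : Nc n) where

  private instance
    2n≢0 : NonZero (2 * n)
    2n≢0 = m*n≢0 2 n

  -- Given names for the residues modulo 2n under which partners are mates, the rotation at c is the
  -- successor on residues carried over to the names.
  module Realise (x : Matching (2 * n)) (point : Nc n → Fin (2 * n))
                 (point-inj : ∀ {y z} → point y ≡ point z → y ≡ z)
                 (point-find : ∀ i → ∃ λ y → i ≡ point y)
                 (point-mate : ∀ y → toℕ (point (mate y)) ≋ partner x (toℕ (point y)) [mod 2 * n ]) where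

    N = 2 * n

    index : Nc n → ℕ
    index y = toℕ (point y)

    at : ℕ → Nc n
    at t = proj₁ (point-find (t mod N))

    index-at : ∀ t → index (at t) ≋ t [mod N ]
    index-at t = mod-trans (mod-reflexive (trans (cong toℕ (sym (proj₂ (point-find (t mod N)))))
      (toℕ-fromℕ< (m%n<n t N)))) (mod-sym (mod-% t))

    index-injective : ∀ {y z} → index y ≋ index z [mod N ] → y ≡ z
    index-injective {y} {z} e = point-inj (toℕ-injective (mod-small (toℕ<n (point y)) (toℕ<n (point z)) e))

    at-cong : ∀ {s t} → s ≋ t [mod N ] → at s ≡ at t
    at-cong {s} {t} e = index-injective (mod-trans (index-at s) (mod-trans e (mod-sym (index-at t))))

    at-index : ∀ y → at (index y) ≡ y
    at-index y = index-injective (index-at (index y))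

    next prev : Nc n → Nc n
    next y = at (suc (index y))
    prev y = at (index y + neg {N} 1)

    next-at : ∀ t → next (at t) ≡ at (suc t)
    next-at t = at-cong (mod-+ˡ 1 (index-at t))

    next-prev : ∀ y → next (prev y) ≡ y
    next-prev y = trans (next-at (index y + neg {N} 1)) (trans (at-cong (begin
      suc (index y + neg {N} 1)   ≈⟨ mod-reflexive (sym (+-suc (index y) _)) ⟩
      index y + (1 + neg {N} 1)   ≈⟨ mod-+ˡ (index y) (+-neg 1) ⟩
      index y + 0                 ≈⟨ mod-reflexive (+-identityʳ (index y)) ⟩
      index y                     ∎)) (at-index y))
      where open ModReasoning N

    prev-next : ∀ y → prev (next y) ≡ y
    prev-next y = trans (at-cong (begin
      index (at (suc (index y))) + neg {N} 1   ≈⟨ mod-+ʳ _ (index-at (suc (index y))) ⟩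
      suc (index y) + neg {N} 1                ≈⟨ mod-reflexive (sym (+-suc (index y) _)) ⟩
      index y + (1 + neg {N} 1)                ≈⟨ mod-+ˡ (index y) (+-neg 1) ⟩
      index y + 0                              ≈⟨ mod-reflexive (+-identityʳ (index y)) ⟩
      index y                                  ∎)) (at-index y)
      where open ModReasoning N

    next-iterate : ∀ s t → iterate next s (at t) ≡ at (s + t)
    next-iterate zero    t = refl
    next-iterate (suc s) t = trans (cong next (next-iterate s t)) (next-at (s + t))

    next-cyclic : ∀ y z → ∃ λ s → iterate next s y ≡ z
    next-cyclic y z = s , (begin
      iterate next s y                  ≡⟨ cong (iterate next s) (at-index y) ⟨
      iterate next s (at (index y))     ≡⟨ next-iterate s (index y) ⟩
      at (s + index y)                  ≡⟨ at-cong s+y ⟩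
      at (index z)                      ≡⟨ at-index z ⟩
      z                                 ∎)
      where
      open ≡-Reasoning
      s = index z + neg {N} (index y)
      s+y : s + index y ≋ index z [mod N ]
      s+y = mod-trans (mod-reflexive (trans (+-assoc (index z) _ _) (cong (index z +_) (+-comm _ (index y)))))
        (mod-trans (mod-+ˡ (index z) (+-neg (index y))) (mod-reflexive (+-identityʳ (index z))))

    realisation : Map n
    realisation = record
      { ρc = record { to = next ; from = prev ; to∘from = next-prev ; from∘to = prev-next }
      ; cyclic = next-cyclic }

    open Position x₀ realisation using (place; matching; place-partner)

    place-at : ∀ t → place t ≡ at (t + index x₀)
    place-at t = trans (cong (iterate next t) (sym (at-index x₀))) (next-iterate t (index x₀))

    -- The realised map is read from `x₀`, which need not carry the residue zero; its index is the
    -- rotation by which the matching read off differs from x.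
    matching-shift : Shift matching x (index x₀)
    matching-shift t = begin
      partner x (t + index x₀)                        ≈⟨ partner-resp x (index-at (t + index x₀)) ⟨
      partner x (index (at (t + index x₀)))           ≈⟨ point-mate (at (t + index x₀)) ⟨
      index (mate (at (t + index x₀)))                ≈⟨ mod-reflexive (cong (index ∘ mate) (place-at t)) ⟨
      index (mate (place t))                          ≈⟨ mod-reflexive (cong index (place-partner t)) ⟨
      index (place (partner matching t))              ≈⟨ mod-reflexive (cong index (place-at (partner matching t))) ⟩
      index (at (partner matching t + index x₀))      ≈⟨ index-at (partner matching t + index x₀) ⟩
      partner matching t + index x₀                   ∎
      where open ModReasoning N

  realise : ∀ (x : Matching (2 * n)) → ∃ λ M → Position.matching x₀ M ∼ᵐ x
  realise x = from-pairing pairCount point point-inj point-find point-mate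
    (*-cancelʳ-≡ _ n 2 (trans (sym (pairing-size P)) (*-comm 2 n)))
    where
    onto : ∃ λ (y : Coloured 1 (2 * n)) → x ≈ᵐ encode (*-identityʳ (2 * n)) y
    onto = encode-onto (*-identityʳ (2 * n)) x (shift-N x)
    y = proj₁ onto
    P = pairing (2 * n) y
    open Pairing P
    partner-π : ∀ j → toℕ (Coloured.π y j) ≋ partner x (toℕ j) [mod 2 * n ]
    partner-π j = mod-sym (mod-trans (proj₂ onto (toℕ j)) (mod-trans (encoded-toℕ (*-identityʳ (2 * n)) y j)
      (mod-trans (mod-reflexive (cong (toℕ (Coloured.π y j) +_) (*-comm (2 * n) (Coloured.colour y j)))) (mod-multiple _ (Coloured.colour y j)))))
    from-pairing : ∀ m (point : Nc m → Fin (2 * n)) → (∀ {y z} → point y ≡ point z → y ≡ z) →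
                   (∀ i → ∃ λ y → i ≡ point y) → (∀ z → point (mate z) ≡ Coloured.π y (point z)) →
                   m ≡ n → ∃ λ M → Position.matching x₀ M ∼ᵐ x
    from-pairing m point inj find e refl = realisation , index x₀ , matching-shift
      where open Realise x point inj find (λ z → mod-trans (mod-reflexive (cong toℕ (e z))) (partner-π (point z)))

-- Rational sums and the Möbius function

fromℚᵘ-+ : ∀ p q → ℚ.fromℚᵘ (p ℚᵘ.+ q) ≡ ℚ.fromℚᵘ p ℚ.+ ℚ.fromℚᵘ q
fromℚᵘ-+ p q = ℚ.toℚᵘ-injective (ℚᵘ.≃-trans (ℚ.toℚᵘ-fromℚᵘ (p ℚᵘ.+ q)) (ℚᵘ.≃-sym
  (ℚᵘ.≃-trans (ℚ.toℚᵘ-homo-+ (ℚ.fromℚᵘ p) (ℚ.fromℚᵘ q)) (ℚᵘ.+-cong (ℚ.toℚᵘ-fromℚᵘ p) (ℚ.toℚᵘ-fromℚᵘ q)))))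

fromℚᵘ-* : ∀ p q → ℚ.fromℚᵘ (p ℚᵘ.* q) ≡ ℚ.fromℚᵘ p ℚ.* ℚ.fromℚᵘ q
fromℚᵘ-* p q = ℚ.toℚᵘ-injective (ℚᵘ.≃-trans (ℚ.toℚᵘ-fromℚᵘ (p ℚᵘ.* q)) (ℚᵘ.≃-sym
  (ℚᵘ.≃-trans (ℚ.toℚᵘ-homo-* (ℚ.fromℚᵘ p) (ℚ.fromℚᵘ q)) (ℚᵘ.*-cong (ℚ.toℚᵘ-fromℚᵘ p) (ℚ.toℚᵘ-fromℚᵘ q)))))

⟦⟧-+ : ∀ m n → ⟦ m + n ⟧ ≡ ⟦ m ⟧ ℚ.+ ⟦ n ⟧
⟦⟧-+ m n = trans (cong (ℚ._/ 1) (cong₂ ℤ._+_ (sym (ℤ.*-identityʳ (ℤ.+ m))) (sym (ℤ.*-identityʳ (ℤ.+ n)))))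
                 (fromℚᵘ-+ (ℚᵘ.mkℚᵘ (ℤ.+ m) 0) (ℚᵘ.mkℚᵘ (ℤ.+ n) 0))

⟦⟧-* : ∀ m n → ⟦ m * n ⟧ ≡ ⟦ m ⟧ ℚ.* ⟦ n ⟧
⟦⟧-* m n = trans (cong (ℚ._/ 1) (ℤ.pos-* m n)) (fromℚᵘ-* (ℚᵘ.mkℚᵘ (ℤ.+ m) 0) (ℚᵘ.mkℚᵘ (ℤ.+ n) 0))

inv-⟦⟧ : ∀ m .{{_ : NonZero m}} → inv m ℚ.* ⟦ m ⟧ ≡ 1ℚ
inv-⟦⟧ (suc m) = trans (sym (fromℚᵘ-* (ℚᵘ.mkℚᵘ (ℤ.+ 1) m) (ℚᵘ.mkℚᵘ (ℤ.+ suc m) 0)))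
  (ℚ.fromℚᵘ-cong {ℚᵘ.mkℚᵘ (ℤ.+ 1) m ℚᵘ.* ℚᵘ.mkℚᵘ (ℤ.+ suc m) 0} {ℚᵘ.1ℚᵘ}
    (ℚᵘ.*≡* (cong ℤ.+_ (shape m))))
  where
  shape : ∀ m → (1 * suc m) * 1 ≡ 1 * (suc m * 1)
  shape = solve-∀

neg-/1 : ∀ z → (ℤ.- z) ℚ./ 1 ≡ ℚ.- (z ℚ./ 1)
neg-/1 (ℤ.+ zero)  = refl
neg-/1 +[1+ n ]  = refl
neg-/1 -[1+ n ]  = sym (neg-involutive ⟦ suc n ⟧)

∑< : ℕ → (ℕ → ℚ) → ℚ
∑< n g = sum {n} (g ∘ toℕ)

∑<-cong : ∀ n {g h : ℕ → ℚ} → (∀ j → j < n → g j ≡ h j) → ∑< n g ≡ ∑< n h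
∑<-cong n {g} {h} e = sum-cong-≗ {n} {g ∘ toℕ} {h ∘ toℕ} (λ i → e (toℕ i) (toℕ<n i))

∑<-zero : ∀ n {g : ℕ → ℚ} → (∀ j → g j ≡ 0ℚ) → ∑< n g ≡ 0ℚ
∑<-zero zero    e = refl
∑<-zero (suc n) e = trans (cong₂ ℚ._+_ (e 0) (∑<-zero n (e ∘ suc))) (ℚ.+-identityˡ 0ℚ)

∑<-append : ∀ m n g → ∑< (m + n) g ≡ ∑< m g ℚ.+ ∑< n (λ j → g (m + j))
∑<-append zero    n g = sym (ℚ.+-identityˡ (∑< n g))
∑<-append (suc m) n g = trans (cong (g 0 ℚ.+_) (∑<-append m n (g ∘ suc))) (sym (ℚ.+-assoc (g 0) _ _))

∑<-extend : ∀ m n g → (∀ j → g (m + j) ≡ 0ℚ) → ∑< (m + n) g ≡ ∑< m g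
∑<-extend m n g e = trans (∑<-append m n g) (trans (cong (∑< m g ℚ.+_) (∑<-zero n e)) (ℚ.+-identityʳ (∑< m g)))

∑<-last : ∀ n g → ∑< (suc n) g ≡ ∑< n g ℚ.+ g n
∑<-last n g = trans (cong (λ m → ∑< m g) (+-comm 1 n)) (trans (∑<-append n 1 g)
  (cong (∑< n g ℚ.+_) (trans (ℚ.+-identityʳ (g (n + 0))) (cong g (+-identityʳ n)))))

∑<-+ : ∀ n g h → ∑< n (λ j → g j ℚ.+ h j) ≡ ∑< n g ℚ.+ ∑< n h
∑<-+ n g h = ∑-distrib-+ (g ∘ toℕ {n}) (h ∘ toℕ)

∑<-*ˡ : ∀ n x g → x ℚ.* ∑< n g ≡ ∑< n (λ j → x ℚ.* g j)
∑<-*ˡ n x g = *-distribˡ-sum x (g ∘ toℕ {n})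

-- With conditions written as factors 0 or 1, filtered sums run over a full range and can be split,
-- interchanged and compared termwise.
𝟙 : ∀ {P : Set} → Dec P → ℚ
𝟙 (yes _) = 1ℚ
𝟙 (no  _) = 0ℚ

𝟙-yes : ∀ {P : Set} (d : Dec P) → P → 𝟙 d ≡ 1ℚ
𝟙-yes (yes _) p = refl
𝟙-yes (no ¬p) p = contradiction p ¬p

𝟙-no : ∀ {P : Set} (d : Dec P) → ¬ P → 𝟙 d ≡ 0ℚ
𝟙-no (yes p) ¬p = contradiction p ¬p
𝟙-no (no _)  ¬p = refl

𝟙-cong : ∀ {P Q : Set} (d : Dec P) (e : Dec Q) → (P → Q) → (Q → P) → 𝟙 d ≡ 𝟙 e
𝟙-cong (yes p) e P⇒Q Q⇒P = sym (𝟙-yes e (P⇒Q p))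
𝟙-cong (no ¬p) e P⇒Q Q⇒P = sym (𝟙-no e (¬p ∘ Q⇒P))

𝟙-split : ∀ {P : Set} (d : Dec P) x → x ≡ 𝟙 d ℚ.* x ℚ.+ 𝟙 (¬? d) ℚ.* x
𝟙-split (yes _) x = sym (trans (cong₂ ℚ._+_ (ℚ.*-identityˡ x) (ℚ.*-zeroˡ x)) (ℚ.+-identityʳ x))
𝟙-split (no _)  x = sym (trans (cong₂ ℚ._+_ (ℚ.*-zeroˡ x) (ℚ.*-identityˡ x)) (ℚ.+-identityˡ x))

𝟙-0 : ∀ {P : Set} (d : Dec P) → ¬ P → ∀ x → 𝟙 d ℚ.* x ≡ 0ℚ
𝟙-0 d ¬p x = trans (cong (ℚ._* x) (𝟙-no d ¬p)) (ℚ.*-zeroˡ x)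

𝟙-1 : ∀ {P : Set} (d : Dec P) → P → ∀ x → 𝟙 d ℚ.* x ≡ x
𝟙-1 d p x = trans (cong (ℚ._* x) (𝟙-yes d p)) (ℚ.*-identityˡ x)

⟦count⟧ : ∀ {n} {P : Fin n → Set} (P? : ∀ i → Dec (P i)) → ⟦ count P? ⟧ ≡ sum (λ i → 𝟙 (P? i))
⟦count⟧ {zero}  P? = refl
⟦count⟧ {suc n} P? = trans (⟦⟧-+ (indicator (P? zero)) (count (P? ∘ suc)))
  (cong₂ ℚ._+_ (⟦indicator⟧ (P? zero)) (⟦count⟧ (P? ∘ suc)))
  where
  ⟦indicator⟧ : ∀ {P : Set} (d : Dec P) → ⟦ indicator d ⟧ ≡ 𝟙 d
  ⟦indicator⟧ (yes _) = refl
  ⟦indicator⟧ (no  _) = refl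

sum-filter : ∀ {P : ℕ → Set} (P? : ∀ k → Dec (P k)) (F : ℕ → ℚ) n (h : ℕ → ℕ) →
             sumℚ (map F (filter P? (applyUpTo h n))) ≡ ∑< n (λ j → 𝟙 (P? (h j)) ℚ.* F (h j))
sum-filter P? F zero    h = refl
sum-filter P? F (suc n) h with P? (h 0)
... | yes _ = cong₂ ℚ._+_ (sym (ℚ.*-identityˡ (F (h 0)))) (sum-filter P? F n (h ∘ suc))
... | no  _ = trans (sum-filter P? F n (h ∘ suc))
  (sym (trans (cong (ℚ._+ rest) (ℚ.*-zeroˡ (F (h 0)))) (ℚ.+-identityˡ rest)))
  where rest = ∑< n (λ j → 𝟙 (P? (h (suc j))) ℚ.* F (h (suc j)))

-- Index j stands for the number j + 1, so the only multiple of d in each block of d indices is the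
-- last entry.
∑<-multiples : ∀ d .{{_ : NonZero d}} M (g : ℕ → ℚ) →
               ∑< (M * d) (λ j → 𝟙 (d ∣? suc j) ℚ.* g (suc j)) ≡ ∑< M (λ i → g (suc i * d))
∑<-multiples d zero    g = refl
∑<-multiples d@(suc d-1) (suc M) g = begin
  ∑< (d + M * d) h                                            ≡⟨ ∑<-append d (M * d) h ⟩
  ∑< d h ℚ.+ ∑< (M * d) (λ j → h (d + j))                     ≡⟨ cong₂ ℚ._+_ block rest ⟩
  g (1 * d) ℚ.+ ∑< M (λ i → g (suc (suc i) * d))              ∎
  where
  open ≡-Reasoning
  h : ℕ → ℚ
  h j = 𝟙 (d ∣? suc j) ℚ.* g (suc j)
  block : ∑< d h ≡ g (1 * d)
  block = begin
    ∑< d h                     ≡⟨ ∑<-last d-1 h ⟩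
    ∑< d-1 h ℚ.+ h d-1         ≡⟨ cong₂ ℚ._+_ (∑<-cong d-1 {h} {λ _ → 0ℚ} (λ j j<d-1 → 𝟙-0 (d ∣? suc j) (>⇒∤ (s<s j<d-1)) _))
                                              (𝟙-1 (d ∣? d) ∣-refl (g d)) ⟩
    ∑< d-1 (λ _ → 0ℚ) ℚ.+ g d  ≡⟨ cong (ℚ._+ g d) (∑<-zero d-1 (λ _ → refl)) ⟩
    0ℚ ℚ.+ g d                 ≡⟨ ℚ.+-identityˡ (g d) ⟩
    g d                        ≡⟨ cong g (sym (*-identityˡ d)) ⟩
    g (1 * d)                  ∎
  rest : ∑< (M * d) (λ j → h (d + j)) ≡ ∑< M (λ i → g (suc (suc i) * d))
  rest = trans (∑<-cong (M * d) (λ j _ → cong₂ ℚ._*_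
      (𝟙-cong (d ∣? suc (d + j)) (d ∣? suc j)
        (λ d∣ → ∣m+n∣m⇒∣n (subst (d ∣_) (sym (+-suc d j)) d∣) ∣-refl)
        (λ d∣ → subst (d ∣_) (+-suc d j) (∣m∣n⇒∣m+n ∣-refl d∣)))
      (cong g (sym (+-suc d j)))))
    (∑<-multiples d M (λ k → g (d + k)))

-- Values of the Möbius function

enum-list : ∀ {X : Set} {P : X → Set} {xs} → Unique xs → (∀ {x} → x ∈ xs → P x) → (∀ {x} → P x → x ∈ xs) →
            Enum _≡_ P (length xs)
enum-list {xs = xs} u P⇐ P⇒ = record
  { at = lookup xs
  ; holds = λ i → P⇐ (∈-lookup i)
  ; distinct = λ {i} {j} → lookup-inj u i j
  ; find = λ x p → Any.index (P⇒ p) , Any.lookup-index (P⇒ p) }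
  where
  lookup-inj : ∀ {xs} → Unique xs → ∀ i j → lookup xs i ≡ lookup xs j → i ≡ j
  lookup-inj (_ ∷ _) zero    zero    e = refl
  lookup-inj (x≢ ∷ _) zero    (suc j) e = contradiction e (All.lookup x≢ (∈-lookup j))
  lookup-inj (x≢ ∷ _) (suc i) zero    e = contradiction (sym e) (All.lookup x≢ (∈-lookup i))
  lookup-inj (_ ∷ u) (suc i) (suc j) e = cong suc (lookup-inj u i j e)

SquareFree : ℕ → Set
SquareFree m = ∀ q → Prime q → ¬ q * q ∣ m

squareFree⇒[] : ∀ m → SquareFree m → squarePrimeDivisors m ≡ []
squareFree⇒[] m sf = filter-none (λ p → prime? p ×-dec (p * p ∣? m)) (All.universal (λ q (pr , d) → sf q pr d) (upTo (suc m)))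

[]⇒squareFree : ∀ m .{{_ : NonZero m}} → squarePrimeDivisors m ≡ [] → SquareFree m
[]⇒squareFree m e q pr q²∣m = not-in-[] (subst (q ∈_) e
  (∈-filter⁺ (λ p → prime? p ×-dec (p * p ∣? m)) (∈-upTo⁺ (s≤s (≤-trans (m≤m*n q q {{prime⇒nonZero pr}}) (∣⇒≤ q²∣m)))) (pr , q²∣m)))
  where
  not-in-[] : ¬ q ∈ []
  not-in-[] ()

μ-squareFree : ∀ m → squarePrimeDivisors m ≡ [] → μ m ≡ minusOnePow (length (primeDivisors m))
μ-squareFree m e with squarePrimeDivisors m | e
... | [] | refl = refl

μ-square : ∀ m → squarePrimeDivisors m ≢ [] → μ m ≡ ℤ.+ 0
μ-square m ne with squarePrimeDivisors m
... | []    = contradiction refl ne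
... | _ ∷ _ = refl

∈-primeDivisors⁻ : ∀ m {q} → q ∈ primeDivisors m → Prime q × q ∣ m
∈-primeDivisors⁻ m q∈ = proj₂ (∈-filter⁻ (λ p → prime? p ×-dec (p ∣? m)) {xs = upTo (suc m)} q∈)

∈-primeDivisors⁺ : ∀ m .{{_ : NonZero m}} {q} → Prime q → q ∣ m → q ∈ primeDivisors m
∈-primeDivisors⁺ m pr q∣m = ∈-filter⁺ (λ p → prime? p ×-dec (p ∣? m)) (∈-upTo⁺ (s≤s (∣⇒≤ q∣m))) (pr , q∣m)

primeDivisors-unique : ∀ m → Unique (primeDivisors m)
primeDivisors-unique m = filter⁺ (λ p → prime? p ×-dec (p ∣? m)) (upTo⁺ (suc m))

prime∣prime : ∀ {p q} → Prime p → Prime q → q ∣ p → q ≡ p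
prime∣prime pp pq q∣p with prime⇒irreducible pp q∣p
... | inj₁ refl = contradiction pq ¬prime[1]
... | inj₂ q≡p  = q≡p

module _ {p j : ℕ} (pp : Prime p) .{{_ : NonZero j}} where

  private instance
    p≢0 : NonZero p
    p≢0 = prime⇒nonZero pp
    jp≢0 : NonZero (j * p)
    jp≢0 = m*n≢0 j p

  -- The lists may differ in order, so their lengths are compared as two enumerations of the same
  -- set, the primes dividing j p.
  primeDivisors-* : ¬ p ∣ j → length (primeDivisors (j * p)) ≡ suc (length (primeDivisors j))
  primeDivisors-* p∤j = enum-unique ≡-isEquivalence {P = λ q → Prime q × q ∣ j * p} id id
    (enum-list (primeDivisors-unique (j * p)) (∈-primeDivisors⁻ (j * p)) (λ (pr , q∣jp) → ∈-primeDivisors⁺ (j * p) pr q∣jp))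
    (enum-list {xs = p ∷ primeDivisors j}
      (All.tabulate (λ {q} q∈ p≡q → p∤j (subst (_∣ j) (sym p≡q) (proj₂ (∈-primeDivisors⁻ j q∈)))) ∷ primeDivisors-unique j)
      (λ { (here refl) → pp , n∣m*n j
         ; (there q∈) → let pr , q∣j = ∈-primeDivisors⁻ j q∈ in pr , ∣m⇒∣m*n p q∣j })
      (λ (pr , q∣jp) → place pr (euclidsLemma j p pr q∣jp)))
    where
    place : ∀ {q} → Prime q → q ∣ j ⊎ q ∣ p → q ∈ p ∷ primeDivisors j
    place pr (inj₁ q∣j) = there (∈-primeDivisors⁺ j pr q∣j)
    place pr (inj₂ q∣p) = here (prime∣prime pp pr q∣p)

  prime-coprime : ∀ {q} → Prime q → q ≢ p → Coprime (q * q) p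
  prime-coprime pq q≢p {i} (i∣qq , i∣p) with prime⇒irreducible pp i∣p
  ... | inj₁ i≡1 = i≡1
  ... | inj₂ refl with euclidsLemma _ _ pp i∣qq
  ...   | inj₁ p∣q = contradiction (sym (prime∣prime pq pp p∣q)) q≢p
  ...   | inj₂ p∣q = contradiction (sym (prime∣prime pq pp p∣q)) q≢p

  squareFree-* : ¬ p ∣ j → SquareFree j → SquareFree (j * p)
  squareFree-* p∤j sf q pq qq∣jp with q ≟ p
  ... | yes refl = p∤j (*-cancelʳ-∣ p qq∣jp)
  ... | no  q≢p  = sf q pq (coprime-divisor (prime-coprime pq q≢p) (subst (q * q ∣_) (*-comm j p) qq∣jp))

  μ-* : ¬ p ∣ j → μ (j * p) ≡ ℤ.- μ j
  μ-* p∤j = by-cases (squarePrimeDivisors j) refl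
    where
    by-cases : ∀ xs → squarePrimeDivisors j ≡ xs → μ (j * p) ≡ ℤ.- μ j
    by-cases [] e = trans
      (μ-squareFree (j * p) (squareFree⇒[] (j * p) (squareFree-* p∤j ([]⇒squareFree j e))))
      (trans (cong minusOnePow (primeDivisors-* p∤j)) (cong ℤ.-_ (sym (μ-squareFree j e))))
    by-cases (q ∷ _) e = trans
      (μ-square (j * p) (λ e′ → not-free (λ q pq qq∣j → []⇒squareFree (j * p) e′ q pq (∣m⇒∣m*n p qq∣j))))
      (sym (cong ℤ.-_ (μ-square j (λ e′ → not-free ([]⇒squareFree j e′)))))
      where
      not-free : ¬ SquareFree j
      not-free sf with () ← trans (sym e) (squareFree⇒[] j sf)

  μ-∣ : p ∣ j → μ (j * p) ≡ ℤ.+ 0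
  μ-∣ p∣j = μ-square (j * p) (λ e → []⇒squareFree (j * p) e p pp (*-monoˡ-∣ p p∣j))

  -- Both cases, p dividing j or not, in a single equation that can be substituted under a sum.
  μℚ-* : μℚ (j * p) ≡ ℚ.- (𝟙 (¬? (p ∣? j)) ℚ.* μℚ j)
  μℚ-* = by-cases (p ∣? j)
    where
    by-cases : (d : Dec (p ∣ j)) → μℚ (j * p) ≡ ℚ.- (𝟙 (¬? d) ℚ.* μℚ j)
    by-cases (yes p∣j) = trans (cong (ℚ._/ 1) (μ-∣ p∣j)) (cong ℚ.-_ (sym (ℚ.*-zeroˡ (μℚ j))))
    by-cases (no  p∤j) = trans (cong (ℚ._/ 1) (μ-* p∤j)) (trans (neg-/1 (μ j)) (cong ℚ.-_ (sym (ℚ.*-identityˡ (μℚ j)))))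

prime-divisor : ∀ m .{{_ : NonZero m}} → m ≢ 1 → ∃ λ p → Prime p × p ∣ m
prime-divisor m m≢1 = from-factors (factors (factorise m)) (isFactorisation (factorise m)) (factorsPrime (factorise m))
  where
  open PrimeFactorisation
  from-factors : ∀ ps → m ≡ product ps → All Prime ps → ∃ λ p → Prime p × p ∣ m
  from-factors []       e _        = contradiction e m≢1
  from-factors (p ∷ ps) e (pp ∷ _) = p , pp , subst (p ∣_) (sym e) (m∣m*n (product ps))

∑μ : ℕ → ℚ
∑μ m = ∑< m (λ j → 𝟙 (suc j ∣? m) ℚ.* μℚ (suc j))

-- The divisors of m prime to p and the p-multiples of those cancel; for k
-- prime to p, k ∣ M p means k ∣ M.
∑μ-prime : ∀ M p .{{_ : NonZero M}} → Prime p → ∑μ (M * p) ≡ 0ℚ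
∑μ-prime M p pp = begin
  ∑μ m                                                   ≡⟨ ∑<-cong m (λ j _ → 𝟙-split (p ∣? suc j) (term j)) ⟩
  ∑< m (λ j → mult j ℚ.+ 𝟙 (¬? (p ∣? suc j)) ℚ.* term j)  ≡⟨ ∑<-+ m mult (λ j → 𝟙 (¬? (p ∣? suc j)) ℚ.* term j) ⟩
  ∑< m mult ℚ.+ ∑< m (λ j → 𝟙 (¬? (p ∣? suc j)) ℚ.* term j) ≡⟨ cong₂ ℚ._+_ multiples others ⟩
  ∑< M (λ i → ℚ.- rest i) ℚ.+ ∑< M rest                   ≡⟨ ∑<-+ M (λ i → ℚ.- rest i) rest ⟨
  ∑< M (λ i → ℚ.- rest i ℚ.+ rest i)                      ≡⟨ ∑<-zero M (λ i → ℚ.+-inverseˡ (rest i)) ⟩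
  0ℚ                                                      ∎
  where
  open ≡-Reasoning
  instance
    p≢0 : NonZero p
    p≢0 = prime⇒nonZero pp
  m = M * p
  term mult rest : ℕ → ℚ
  term j = 𝟙 (suc j ∣? m) ℚ.* μℚ (suc j)
  mult j = 𝟙 (p ∣? suc j) ℚ.* term j
  rest j = 𝟙 (¬? (p ∣? suc j)) ℚ.* (𝟙 (suc j ∣? M) ℚ.* μℚ (suc j))
  swap : ∀ x y z → x ℚ.* (ℚ.- (y ℚ.* z)) ≡ ℚ.- (y ℚ.* (x ℚ.* z))
  swap x y z = trans (sym (ℚ.neg-distribʳ-* x (y ℚ.* z))) (cong ℚ.-_
    (trans (sym (ℚ.*-assoc x y z)) (trans (cong (ℚ._* z) (ℚ.*-comm x y)) (ℚ.*-assoc y x z))))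
  multiples : ∑< m mult ≡ ∑< M (λ i → ℚ.- rest i)
  multiples = trans (∑<-multiples p M (λ k → 𝟙 (k ∣? m) ℚ.* μℚ k)) (∑<-cong M (λ i _ → trans
    (cong₂ ℚ._*_ (𝟙-cong (suc i * p ∣? m) (suc i ∣? M) (*-cancelʳ-∣ p) (*-monoˡ-∣ p)) (μℚ-* {p} {suc i} pp))
    (swap (𝟙 (suc i ∣? M)) (𝟙 (¬? (p ∣? suc i))) (μℚ (suc i)))))
  prime-to-p : ∀ {k} → ¬ p ∣ k → k ∣ m → k ∣ M
  prime-to-p {k} p∤k k∣m = coprime-divisor coprime (subst (k ∣_) (*-comm M p) k∣m)
    where
    coprime : Coprime k p
    coprime (i∣k , i∣p) with prime⇒irreducible pp i∣p
    ... | inj₁ i≡1  = i≡1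
    ... | inj₂ refl = contradiction i∣k p∤k
  same : ∀ j (d : Dec (p ∣ suc j)) → 𝟙 (¬? d) ℚ.* term j ≡ 𝟙 (¬? d) ℚ.* (𝟙 (suc j ∣? M) ℚ.* μℚ (suc j))
  same j (yes _)   = trans (ℚ.*-zeroˡ (term j)) (sym (ℚ.*-zeroˡ (𝟙 (suc j ∣? M) ℚ.* μℚ (suc j))))
  same j (no  p∤k) = cong (λ x → 1ℚ ℚ.* (x ℚ.* μℚ (suc j)))
    (𝟙-cong (suc j ∣? m) (suc j ∣? M) (prime-to-p p∤k) (∣m⇒∣m*n p))
  -- Numbers above M do not divide M, so the range of length M p can be cut down to M.
  beyond : ∀ j → rest (M + j) ≡ 0ℚ
  beyond j = trans
    (cong (𝟙 (¬? (p ∣? suc (M + j))) ℚ.*_) (𝟙-0 (suc (M + j) ∣? M) (>⇒∤ (s≤s (m≤m+n M j))) _))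
    (ℚ.*-zeroʳ (𝟙 (¬? (p ∣? suc (M + j)))))
  others : ∑< m (λ j → 𝟙 (¬? (p ∣? suc j)) ℚ.* term j) ≡ ∑< M rest
  others = trans (∑<-cong m (λ j _ → same j (p ∣? suc j)))
    (trans (cong (λ l → ∑< l rest) (sym (m+[n∸m]≡n (m≤m*n M p)))) (∑<-extend M (m ∸ M) rest beyond))

∑μ≡𝟙 : ∀ m .{{_ : NonZero m}} → ∑μ m ≡ 𝟙 (m ≟ 1)
∑μ≡𝟙 m = by-cases (m ≟ 1)
  where
  by-cases : (d : Dec (m ≡ 1)) → ∑μ m ≡ 𝟙 d
  by-cases (yes refl) = refl
  by-cases (no m≢1)   =
    let p , pp , p∣m = prime-divisor m m≢1
    in subst (λ m → ∑μ m ≡ 0ℚ) (sym (m∣n⇒n≡quotient*m p∣m)) (∑μ-prime (quotient p∣m) p {{quotient≢0 p∣m}} pp)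

-- weight k q m counts the coloured involutions of q points with m pairs,
-- each pair in one of k colours and the fixed points uncoloured.
weight : (k q m : ℕ) → ℕ
weight k q             zero    = 1
weight k 0             (suc m) = 0
weight k 1             (suc m) = 0
weight k (suc (suc q)) (suc m) = weight k (suc q) (suc m) + suc q * (k * weight k q m)

<-halve : ∀ {q m} → suc (suc q) < suc m + suc m → q < m + m
<-halve {q} {m} (s≤s h) = s≤s⁻¹ (subst (suc (suc q) ≤_) (+-suc m m) h)

weight-vanish : ∀ k q m → q < m + m → weight k q m ≡ 0
weight-vanish k 0             (suc m) _ = refl
weight-vanish k 1             (suc m) _ = refl
weight-vanish k (suc (suc q)) (suc m) h = begin
  weight k (suc q) (suc m) + suc q * (k * weight k q m)   ≡⟨ cong₂ (λ x y → x + suc q * (k * y))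
                                                               (weight-vanish k (suc q) (suc m) (<-trans (n<1+n _) h))
                                                               (weight-vanish k q m (<-halve h)) ⟩
  suc q * (k * 0)                                         ≡⟨ cong (suc q *_) (*-zeroʳ k) ⟩
  suc q * 0                                               ≡⟨ *-zeroʳ (suc q) ⟩
  0                                                       ∎
  where open ≡-Reasoning

-- This is k^m q! / (2^m m! r!) with denominators cleared, r being the number of fixed points. In
-- the induction the first point accounts for a share r if it is fixed and for twice the number of
-- pairs if it is paired; these shares add up to the number of points.
weight-formula : ∀ k q m r → q ≡ m + m + r → weight k q m * (2 ^ m * (r ! * m !)) ≡ k ^ m * q !
weight-formula k q zero r refl = trivial (r !)
  where
  trivial : ∀ x → 1 * (1 * (x * 1)) ≡ 1 * x
  trivial = solve-∀
weight-formula k (suc zero) (suc m) r e = contradiction (trans (suc-injective e) (cong (_+ r) (+-suc m m))) λ ()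
weight-formula k (suc (suc q)) (suc m) r e = begin
  (weight k (suc q) (suc m) + suc q * (k * weight k q m)) * (2 * 2 ^ m * (r ! * (suc m * m !)))
    ≡⟨ expand (weight k (suc q) (suc m)) (suc q) k (weight k q m) (2 ^ m) (r !) (suc m) (m !) ⟩
  weight k (suc q) (suc m) * (2 * 2 ^ m * (r ! * (suc m * m !))) + suc q * k * 2 * suc m * (weight k q m * (2 ^ m * (r ! * m !)))
    ≡⟨ cong₂ (λ x y → x + suc q * k * 2 * suc m * y) (unpaired r q≡) (weight-formula k q m r q≡) ⟩
  r * (k * k ^ m * (suc q * q !)) + suc q * k * 2 * suc m * (k ^ m * q !)
    ≡⟨ collect r k (k ^ m) (suc q) (q !) m ⟩
  k * k ^ m * (suc (suc (m + m + r)) * (suc q * q !))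
    ≡⟨ cong (λ q′ → k * k ^ m * (suc (suc q′) * (suc q * q !))) q≡ ⟨
  k * k ^ m * (suc (suc q) * (suc q * q !)) ∎
  where
  open ≡-Reasoning
  q≡ : q ≡ m + m + r
  q≡ = suc-injective (trans (suc-injective e) (cong (_+ r) (+-suc m m)))
  expand : ∀ w s k v t r m f → (w + s * (k * v)) * (2 * t * (r * (m * f))) ≡ w * (2 * t * (r * (m * f))) + s * k * 2 * m * (v * (t * (r * f)))
  expand = solve-∀
  collect : ∀ r k p s f m → r * (k * p * (s * f)) + s * k * 2 * suc m * (p * f) ≡ k * p * (suc (suc (m + m + r)) * (s * f))
  collect = solve-∀
  regroup : ∀ w t r x f → w * (2 * t * (r * x * f)) ≡ r * (w * (2 * t * (x * f)))
  regroup = solve-∀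
  unpaired : ∀ r → q ≡ m + m + r → weight k (suc q) (suc m) * (2 * 2 ^ m * (r ! * (suc m * m !))) ≡ r * (k * k ^ m * (suc q * q !))
  -- Without fixed points the remaining points are too few for the pairs, so this summand vanishes.
  unpaired zero    q≡ = cong (_* (2 * 2 ^ m * (1 * (suc m * m !))))
    (weight-vanish k (suc q) (suc m) (s≤s (≤-reflexive (trans (cong suc (trans q≡ (+-identityʳ (m + m)))) (sym (+-suc m m))))))
  unpaired (suc r) q≡ = trans (regroup (weight k (suc q) (suc m)) (2 ^ m) (suc r) (r !) (suc m * m !))
    (cong (suc r *_) (weight-formula k (suc q) (suc m) r
      (trans (cong suc (trans q≡ (+-suc (m + m) r))) (cong (λ x → suc (x + r)) (sym (+-suc m m))))))

-- With one colour for fixed points, the involutions are sorted by their number m of transpositions.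
-- Any M beyond q/2 covers all m that occur.
number-even : ∀ k q M → q < M + M → ⟦ number 1 k q ⟧ ≡ ∑< M (λ m → ⟦ weight k q m ⟧)
number-even k 0 (suc M) _ = sym (trans (cong (1ℚ ℚ.+_) (∑<-zero M (λ _ → refl))) (ℚ.+-identityʳ 1ℚ))
number-even k 1 (suc M) _ = sym (trans (cong (1ℚ ℚ.+_) (∑<-zero M (λ _ → refl))) (ℚ.+-identityʳ 1ℚ))
number-even k (suc (suc q)) (suc M) h = begin
  ⟦ 1 * number 1 k (suc q) + suc q * (k * number 1 k q) ⟧
    ≡⟨ cong ⟦_⟧ (cong₂ _+_ (*-identityˡ (number 1 k (suc q))) (sym (*-assoc (suc q) k (number 1 k q)))) ⟩
  ⟦ number 1 k (suc q) + suc q * k * number 1 k q ⟧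
    ≡⟨ trans (⟦⟧-+ (number 1 k (suc q)) _) (cong (⟦ number 1 k (suc q) ⟧ ℚ.+_) (⟦⟧-* (suc q * k) (number 1 k q))) ⟩
  ⟦ number 1 k (suc q) ⟧ ℚ.+ ⟦ suc q * k ⟧ ℚ.* ⟦ number 1 k q ⟧
    ≡⟨ cong₂ (λ x y → x ℚ.+ ⟦ suc q * k ⟧ ℚ.* y)
         (number-even k (suc q) (suc M) (<-trans (n<1+n _) h)) (number-even k q M (<-halve h)) ⟩
  (1ℚ ℚ.+ ∑< M fixed) ℚ.+ ⟦ suc q * k ⟧ ℚ.* ∑< M (λ m → ⟦ weight k q m ⟧)
    ≡⟨ ℚ.+-assoc 1ℚ (∑< M fixed) _ ⟩
  1ℚ ℚ.+ (∑< M fixed ℚ.+ ⟦ suc q * k ⟧ ℚ.* ∑< M (λ m → ⟦ weight k q m ⟧))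
    ≡⟨ cong (λ x → 1ℚ ℚ.+ (∑< M fixed ℚ.+ x)) (∑<-*ˡ M ⟦ suc q * k ⟧ (λ m → ⟦ weight k q m ⟧)) ⟩
  1ℚ ℚ.+ (∑< M fixed ℚ.+ ∑< M paired)
    ≡⟨ cong (1ℚ ℚ.+_) (∑<-+ M fixed paired) ⟨
  1ℚ ℚ.+ ∑< M (λ m → fixed m ℚ.+ paired m)
    ≡⟨ cong (1ℚ ℚ.+_) (∑<-cong M (λ m _ → sym (step m))) ⟩
  1ℚ ℚ.+ ∑< M (λ m → ⟦ weight k (suc (suc q)) (suc m) ⟧) ∎
  where
  open ≡-Reasoning
  fixed paired : ℕ → ℚ
  fixed m = ⟦ weight k (suc q) (suc m) ⟧
  paired m = ⟦ suc q * k ⟧ ℚ.* ⟦ weight k q m ⟧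
  step : ∀ m → ⟦ weight k (suc (suc q)) (suc m) ⟧ ≡ fixed m ℚ.+ paired m
  step m = trans (⟦⟧-+ (weight k (suc q) (suc m)) _) (cong (fixed m ℚ.+_)
    (trans (cong ⟦_⟧ (sym (*-assoc (suc q) k (weight k q m)))) (⟦⟧-* (suc q * k) (weight k q m))))

-- With no colour for fixed points every point is paired, which leaves only the top value m = s.
number-odd : ∀ k s → number 0 k (s + s) ≡ weight k (s + s) s
number-odd k zero    = refl
number-odd k (suc s) = subst (λ q → number 0 k (suc q) ≡ weight k (suc q) (suc s)) (sym (+-suc s s))
  (cong₂ (λ x y → x + suc (s + s) * (k * y))
    (sym (weight-vanish k (suc (s + s)) (suc s) (s≤s (≤-reflexive (sym (+-suc s s)))))) (number-odd k s))

⟦⟧-cancel : ∀ m .{{_ : NonZero m}} {x y} → x ℚ.* ⟦ m ⟧ ≡ y ℚ.* ⟦ m ⟧ → x ≡ y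
⟦⟧-cancel m {x} {y} e = trans (sym (undo x)) (trans (cong (ℚ._* inv m) e) (undo y))
  where
  undo : ∀ x → x ℚ.* ⟦ m ⟧ ℚ.* inv m ≡ x
  undo x = trans (ℚ.*-assoc x ⟦ m ⟧ (inv m)) (trans (cong (x ℚ.*_) (trans (ℚ.*-comm ⟦ m ⟧ (inv m)) (inv-⟦⟧ m))) (ℚ.*-identityʳ x))

inv-* : ∀ m k .{{_ : NonZero m}} .{{_ : NonZero k}} → inv (m * k) ≡ inv m ℚ.* inv k
inv-* m k = ⟦⟧-cancel (m * k) {{m*n≢0 m k}} (begin
  inv (m * k) ℚ.* ⟦ m * k ⟧                         ≡⟨ inv-⟦⟧ (m * k) {{m*n≢0 m k}} ⟩
  1ℚ ℚ.* 1ℚ                                         ≡⟨ cong₂ ℚ._*_ (inv-⟦⟧ m) (inv-⟦⟧ k) ⟨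
  inv m ℚ.* ⟦ m ⟧ ℚ.* (inv k ℚ.* ⟦ k ⟧)             ≡⟨ interchange (inv m) ⟦ m ⟧ (inv k) ⟦ k ⟧ ⟩
  inv m ℚ.* inv k ℚ.* (⟦ m ⟧ ℚ.* ⟦ k ⟧)             ≡⟨ cong (inv m ℚ.* inv k ℚ.*_) (⟦⟧-* m k) ⟨
  inv m ℚ.* inv k ℚ.* ⟦ m * k ⟧                     ∎)
  where
  open ≡-Reasoning
  interchange : ∀ w x y z → w ℚ.* x ℚ.* (y ℚ.* z) ≡ w ℚ.* y ℚ.* (x ℚ.* z)
  interchange = solve 4 (λ w x y z → w :* x :* (y :* z) := w :* y :* (x :* z)) refl
    where open +-*-Solver

-- The power of k/2 in the formula need not be an integer; the factor 2^m turns it into the k^m of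
-- `weight-formula`.
half-^ : ∀ k m → ⟦ 2 ^ m ⟧ ℚ.* ((ℤ.+ k ℚ./ 2) ^ℚ m) ≡ ⟦ k ^ m ⟧
half-^ k zero    = ℚ.*-identityˡ 1ℚ
half-^ k (suc m) = begin
  ⟦ 2 * 2 ^ m ⟧ ℚ.* (h ℚ.* h ^ℚ m)              ≡⟨ cong (ℚ._* (h ℚ.* h ^ℚ m)) (⟦⟧-* 2 (2 ^ m)) ⟩
  ⟦ 2 ⟧ ℚ.* ⟦ 2 ^ m ⟧ ℚ.* (h ℚ.* h ^ℚ m)        ≡⟨ interchange ⟦ 2 ⟧ ⟦ 2 ^ m ⟧ h (h ^ℚ m) ⟩
  ⟦ 2 ⟧ ℚ.* h ℚ.* (⟦ 2 ^ m ⟧ ℚ.* h ^ℚ m)        ≡⟨ cong₂ ℚ._*_ double (half-^ k m) ⟩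
  ⟦ k ⟧ ℚ.* ⟦ k ^ m ⟧                           ≡⟨ ⟦⟧-* k (k ^ m) ⟨
  ⟦ k * k ^ m ⟧                                 ∎
  where
  open ≡-Reasoning
  h = ℤ.+ k ℚ./ 2
  interchange : ∀ w x y z → w ℚ.* x ℚ.* (y ℚ.* z) ≡ w ℚ.* y ℚ.* (x ℚ.* z)
  interchange = solve 4 (λ w x y z → w :* x :* (y :* z) := w :* y :* (x :* z)) refl
    where open +-*-Solver
  shape : ∀ z → ℤ.+ 2 ℤ.* z ℤ.* ℤ.+ 1 ≡ z ℤ.* ℤ.+ 2
  shape z = trans (ℤ.*-identityʳ (ℤ.+ 2 ℤ.* z)) (ℤ.*-comm (ℤ.+ 2) z)
  double : ⟦ 2 ⟧ ℚ.* h ≡ ⟦ k ⟧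
  double = trans (sym (fromℚᵘ-* (ℚᵘ.mkℚᵘ (ℤ.+ 2) 0) (ℚᵘ.mkℚᵘ (ℤ.+ k) 1)))
    (ℚ.fromℚᵘ-cong {ℚᵘ.mkℚᵘ (ℤ.+ 2) 0 ℚᵘ.* ℚᵘ.mkℚᵘ (ℤ.+ k) 1} {ℚᵘ.mkℚᵘ (ℤ.+ k) 0} (ℚᵘ.*≡* (shape (ℤ.+ k))))

-- The summand of `B`; for 2m = q it is also `A` without its factor 1/(2n).
term : (k q m : ℕ) → ℚ
term k q m = ⟦ q ! ⟧ ℚ.* ((ℤ.+ k ℚ./ 2) ^ℚ m) ℚ.* inv ((q ∸ 2 * m) ! * m !)

⟦weight⟧ : ∀ k q m → m + m ≤ q → ⟦ weight k q m ⟧ ≡ term k q m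
⟦weight⟧ k q m h = ⟦⟧-cancel (2 ^ m * Y) {{m*n≢0 (2 ^ m) Y {{m^n≢0 2 m}} {{Y≢0}}}} (begin
  ⟦ weight k q m ⟧ ℚ.* ⟦ 2 ^ m * Y ⟧                        ≡⟨ ⟦⟧-* (weight k q m) (2 ^ m * Y) ⟨
  ⟦ weight k q m * (2 ^ m * Y) ⟧                            ≡⟨ cong ⟦_⟧ (weight-formula k q m (q ∸ 2 * m) q≡) ⟩
  ⟦ k ^ m * q ! ⟧                                           ≡⟨ ⟦⟧-* (k ^ m) (q !) ⟩
  ⟦ k ^ m ⟧ ℚ.* ⟦ q ! ⟧                                     ≡⟨ cong (ℚ._* ⟦ q ! ⟧) (half-^ k m) ⟨
  ⟦ 2 ^ m ⟧ ℚ.* x ℚ.* ⟦ q ! ⟧                               ≡⟨ ℚ.*-identityʳ _ ⟨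
  ⟦ 2 ^ m ⟧ ℚ.* x ℚ.* ⟦ q ! ⟧ ℚ.* 1ℚ                        ≡⟨ cong (⟦ 2 ^ m ⟧ ℚ.* x ℚ.* ⟦ q ! ⟧ ℚ.*_) (inv-⟦⟧ Y {{Y≢0}}) ⟨
  ⟦ 2 ^ m ⟧ ℚ.* x ℚ.* ⟦ q ! ⟧ ℚ.* (inv Y ℚ.* ⟦ Y ⟧)         ≡⟨ regroup ⟦ 2 ^ m ⟧ x ⟦ q ! ⟧ (inv Y) ⟦ Y ⟧ ⟩
  ⟦ q ! ⟧ ℚ.* x ℚ.* inv Y ℚ.* (⟦ 2 ^ m ⟧ ℚ.* ⟦ Y ⟧)         ≡⟨ cong (term k q m ℚ.*_) (⟦⟧-* (2 ^ m) Y) ⟨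
  term k q m ℚ.* ⟦ 2 ^ m * Y ⟧                              ∎)
  where
  open ≡-Reasoning
  Y = (q ∸ 2 * m) ! * m !
  x = (ℤ.+ k ℚ./ 2) ^ℚ m
  Y≢0 : NonZero Y
  Y≢0 = m*n≢0 ((q ∸ 2 * m) !) (m !) {{(q ∸ 2 * m) !≢0}} {{m !≢0}}
  m+m : 2 * m ≡ m + m
  m+m = cong (m +_) (+-identityʳ m)
  q≡ : q ≡ m + m + (q ∸ 2 * m)
  q≡ = sym (trans (cong (λ z → m + m + (q ∸ z)) m+m) (m+[n∸m]≡n h))
  regroup : ∀ t x f i y → t ℚ.* x ℚ.* f ℚ.* (i ℚ.* y) ≡ f ℚ.* x ℚ.* i ℚ.* (t ℚ.* y)
  regroup = solve 5 (λ t x f i y → t :* x :* f :* (i :* y) := f :* x :* i :* (t :* y)) refl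
    where open +-*-Solver

-- The number of invariant matchings equals 2n f(n,k)

sumTo-∑< : ∀ M g → sumTo M g ≡ ∑< (suc M) g
sumTo-∑< M g = front (suc M) id
  where
  front : ∀ n h → sumℚ (map g (applyUpTo h n)) ≡ ∑< n (g ∘ h)
  front zero    h = refl
  front (suc n) h = cong (g (h 0) ℚ.+_) (front n (h ∘ suc))

div-unique : ∀ {r k} s → r < k → (r + s * k) div k ≡ s
div-unique {r} {suc k} s r<k = trans (+-distrib-/-∣ʳ r {s * suc k} {suc k} (n∣m*n s))
  (cong₂ _+_ (m<n⇒m/n≡0 r<k) (m*n/n≡m s (suc k)))

div-exact : ∀ k s .{{_ : NonZero k}} → (s * k) div k ≡ s
div-exact k s = div-unique {0} s (>-nonZero⁻¹ k)

A-divides : ∀ n k → k ∣ n → A n k ≡ ⟦ ((2 * n) div k) ! ⟧ ℚ.* ((ℤ.+ k ℚ./ 2) ^ℚ (n div k)) ℚ.* inv (2 * n * ((n div k) !))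
A-divides n k k∣n with k ∣? n
... | yes _  = refl
... | no k∤n = contradiction k∣n k∤n

A-∤ : ∀ n k → ¬ k ∣ n → A n k ≡ 0ℚ
A-∤ n k k∤n with k ∣? n
... | yes k∣n = contradiction k∣n k∤n
... | no _    = refl

B-even : ∀ n k → 2 ∣ k → B n k ≡ inv (2 * n) ℚ.* sumTo ((n ∸ 1) div k) (term k ((2 * n) div k))
B-even n k 2∣k with 2 ∣? k
... | yes _  = refl
... | no 2∤k = contradiction 2∣k 2∤k

B-odd : ∀ n k → ¬ 2 ∣ k → B n k ≡ 0ℚ
B-odd n k 2∤k with 2 ∣? k
... | yes 2∣k = contradiction 2∣k 2∤k
... | no _    = refl

module _ {n k q : ℕ} .{{_ : NonZero n}} .{{_ : NonZero k}} (kq≡2n : k * q ≡ 2 * n) where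

  private instance
    2n≢0 : NonZero (2 * n)
    2n≢0 = m*n≢0 2 n

  2n-inv : ∀ x → ⟦ 2 * n ⟧ ℚ.* (inv (2 * n) ℚ.* x) ≡ x
  2n-inv x = trans (sym (ℚ.*-assoc ⟦ 2 * n ⟧ (inv (2 * n)) x))
    (trans (cong (ℚ._* x) (trans (ℚ.*-comm ⟦ 2 * n ⟧ (inv (2 * n))) (inv-⟦⟧ (2 * n)))) (ℚ.*-identityˡ x))

  2n-div : (2 * n) div k ≡ q
  2n-div = trans (cong (_div k) (trans (sym kq≡2n) (*-comm k q))) (div-exact k q)

  n≡ : ∀ s → q ≡ s + s → n ≡ s * k
  n≡ s e = *-cancelˡ-≡ n (s * k) 2 (trans (sym kq≡2n) (trans (cong (k *_) e) (double k s)))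
    where
    double : ∀ k s → k * (s + s) ≡ 2 * (s * k)
    double = solve-∀

  2n·A : ∀ s → q ≡ s + s → ⟦ 2 * n ⟧ ℚ.* A n k ≡ ⟦ weight k q s ⟧
  2n·A s e = begin
    ⟦ 2 * n ⟧ ℚ.* A n k
      ≡⟨ cong (⟦ 2 * n ⟧ ℚ.*_) (A-divides n k (divides s (n≡ s e))) ⟩
    ⟦ 2 * n ⟧ ℚ.* (⟦ ((2 * n) div k) ! ⟧ ℚ.* ((ℤ.+ k ℚ./ 2) ^ℚ (n div k)) ℚ.* inv (2 * n * (n div k) !))
      ≡⟨ cong₂ (λ u v → ⟦ 2 * n ⟧ ℚ.* (⟦ u ! ⟧ ℚ.* ((ℤ.+ k ℚ./ 2) ^ℚ v) ℚ.* inv (2 * n * v !)))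
           2n-div (trans (cong (_div k) (n≡ s e)) (div-exact k s)) ⟩
    ⟦ 2 * n ⟧ ℚ.* (⟦ q ! ⟧ ℚ.* x ℚ.* inv (2 * n * s !))
      ≡⟨ cong (λ y → ⟦ 2 * n ⟧ ℚ.* (⟦ q ! ⟧ ℚ.* x ℚ.* y)) (inv-* (2 * n) (s !) {{2n≢0}} {{s !≢0}}) ⟩
    ⟦ 2 * n ⟧ ℚ.* (⟦ q ! ⟧ ℚ.* x ℚ.* (inv (2 * n) ℚ.* inv (s !)))
      ≡⟨ cong (⟦ 2 * n ⟧ ℚ.*_) (pull (⟦ q ! ⟧ ℚ.* x) (inv (2 * n)) (inv (s !))) ⟩
    ⟦ 2 * n ⟧ ℚ.* (inv (2 * n) ℚ.* (⟦ q ! ⟧ ℚ.* x ℚ.* inv (s !)))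
      ≡⟨ 2n-inv _ ⟩
    ⟦ q ! ⟧ ℚ.* x ℚ.* inv (s !)
      ≡⟨ cong (λ y → ⟦ q ! ⟧ ℚ.* x ℚ.* inv y) (trans (sym (*-identityˡ (s !))) (cong (λ r → r ! * s !) (sym q∸2s))) ⟩
    term k q s
      ≡⟨ ⟦weight⟧ k q s (≤-reflexive (sym e)) ⟨
    ⟦ weight k q s ⟧ ∎
    where
    open ≡-Reasoning
    x = (ℤ.+ k ℚ./ 2) ^ℚ s
    q∸2s : q ∸ 2 * s ≡ 0
    q∸2s = trans (cong₂ _∸_ e (cong (s +_) (+-identityʳ s))) (n∸n≡0 (s + s))
    pull : ∀ x y z → x ℚ.* (y ℚ.* z) ≡ y ℚ.* (x ℚ.* z)
    pull = solve 3 (λ x y z → x :* (y :* z) := y :* (x :* z)) refl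
      where open +-*-Solver

  -- The bound on M gives 2m ≤ q for every m < M, so the truncated subtraction inside `term` is
  -- exact.
  2n·B : ∀ M → 2 ∣ k → M + M ≤ suc q → suc ((n ∸ 1) div k) ≡ M →
         ⟦ 2 * n ⟧ ℚ.* B n k ≡ ∑< M (λ m → ⟦ weight k q m ⟧)
  2n·B M 2∣k M+M≤ e = begin
    ⟦ 2 * n ⟧ ℚ.* B n k
      ≡⟨ cong (⟦ 2 * n ⟧ ℚ.*_) (B-even n k 2∣k) ⟩
    ⟦ 2 * n ⟧ ℚ.* (inv (2 * n) ℚ.* sumTo ((n ∸ 1) div k) (term k ((2 * n) div k)))
      ≡⟨ 2n-inv _ ⟩
    sumTo ((n ∸ 1) div k) (term k ((2 * n) div k))
      ≡⟨ sumTo-∑< ((n ∸ 1) div k) (term k ((2 * n) div k)) ⟩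
    ∑< (suc ((n ∸ 1) div k)) (term k ((2 * n) div k))
      ≡⟨ cong₂ (λ M q → ∑< M (term k q)) e 2n-div ⟩
    ∑< M (term k q)
      ≡⟨ ∑<-cong M (λ m m<M → ⟦weight⟧ k q m (bound m m<M)) ⟨
    ∑< M (λ m → ⟦ weight k q m ⟧) ∎
    where
    open ≡-Reasoning
    bound : ∀ m → m < M → m + m ≤ q
    bound m m<M = ≤-pred (≤-trans (n≤1+n _) (≤-trans (subst (_≤ M + M) (cong suc (+-suc m m)) (+-mono-≤ m<M m<M)) M+M≤))

  closed-odd : ∀ s → ¬ 2 ∣ k → q ≡ s + s → ⟦ number 0 k q ⟧ ≡ ⟦ 2 * n ⟧ ℚ.* f n k
  closed-odd s 2∤k e = begin
    ⟦ number 0 k q ⟧                              ≡⟨ cong ⟦_⟧ (subst (λ q → number 0 k q ≡ weight k q s) (sym e) (number-odd k s)) ⟩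
    ⟦ weight k q s ⟧                              ≡⟨ 2n·A s e ⟨
    ⟦ 2 * n ⟧ ℚ.* A n k                           ≡⟨ cong (⟦ 2 * n ⟧ ℚ.*_) (ℚ.+-identityʳ (A n k)) ⟨
    ⟦ 2 * n ⟧ ℚ.* (A n k ℚ.+ 0ℚ)                  ≡⟨ cong (λ x → ⟦ 2 * n ⟧ ℚ.* (A n k ℚ.+ x)) (B-odd n k 2∤k) ⟨
    ⟦ 2 * n ⟧ ℚ.* f n k                           ∎
    where open ≡-Reasoning

  -- Here n = s k with s positive, so n - 1 has quotient s - 1 by k: `B` contributes the terms m < s
  -- and `A` the last one, m = s.
  closed-even-even : ∀ s → 2 ∣ k → q ≡ s + s → ⟦ number 1 k q ⟧ ≡ ⟦ 2 * n ⟧ ℚ.* f n k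
  closed-even-even zero 2∣k e = contradiction (n≡ 0 e) (≢-nonZero⁻¹ n)
  closed-even-even (suc s) 2∣k e = begin
    ⟦ number 1 k q ⟧                                  ≡⟨ number-even k q (suc (suc s)) q< ⟩
    ∑< (suc (suc s)) w                                ≡⟨ ∑<-last (suc s) w ⟩
    ∑< (suc s) w ℚ.+ w (suc s)                        ≡⟨ cong₂ ℚ._+_ (2n·B (suc s) 2∣k (≤-trans (≤-reflexive (sym e)) (n≤1+n q)) (cong suc n-1))
                                                                      (2n·A (suc s) e) ⟨
    ⟦ 2 * n ⟧ ℚ.* B n k ℚ.+ ⟦ 2 * n ⟧ ℚ.* A n k       ≡⟨ ℚ.+-comm (⟦ 2 * n ⟧ ℚ.* B n k) (⟦ 2 * n ⟧ ℚ.* A n k) ⟩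
    ⟦ 2 * n ⟧ ℚ.* A n k ℚ.+ ⟦ 2 * n ⟧ ℚ.* B n k       ≡⟨ ℚ.*-distribˡ-+ ⟦ 2 * n ⟧ (A n k) (B n k) ⟨
    ⟦ 2 * n ⟧ ℚ.* f n k                               ∎
    where
    open ≡-Reasoning
    w : ℕ → ℚ
    w m = ⟦ weight k q m ⟧
    q< : q < suc (suc s) + suc (suc s)
    q< = subst (_< suc (suc s) + suc (suc s)) (sym e) (+-mono-< (n<1+n (suc s)) (n<1+n (suc s)))
    n-1 : (n ∸ 1) div k ≡ s
    n-1 = trans (cong (λ m → (m ∸ 1) div k) (n≡ (suc s) e))
      (trans (cong (_div k) (+-∸-comm {k} (s * k) {1} (>-nonZero⁻¹ k)))
        (div-unique {k ∸ 1} s (m∸n<m k 1)))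
      where
      m∸n<m : ∀ m n .{{_ : NonZero m}} .{{_ : NonZero n}} → m ∸ n < m
      m∸n<m (suc m) (suc n) = s≤s (m∸n≤m m n)

  -- Here n = κ + s k is an odd multiple of k/2, so `A` vanishes, while n - 1 has quotient s by k
  -- and `B` already contains all terms m ≤ s.
  closed-even-odd : ∀ κ s → k ≡ 2 * κ → q ≡ suc (s + s) → ⟦ number 1 k q ⟧ ≡ ⟦ 2 * n ⟧ ℚ.* f n k
  closed-even-odd zero    s k≡ e = contradiction k≡ (≢-nonZero⁻¹ k)
  closed-even-odd κ@(suc κ-1) s k≡ e = begin
    ⟦ number 1 k q ⟧                                  ≡⟨ number-even k q (suc s) (≤-reflexive (trans (cong suc e) (cong suc (sym (+-suc s s))))) ⟩
    ∑< (suc s) (λ m → ⟦ weight k q m ⟧)               ≡⟨ 2n·B (suc s) 2∣k (≤-reflexive (trans (cong suc (+-suc s s)) (cong suc (sym e)))) (cong suc n-1) ⟨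
    ⟦ 2 * n ⟧ ℚ.* B n k                               ≡⟨ cong (⟦ 2 * n ⟧ ℚ.*_) (ℚ.+-identityˡ (B n k)) ⟨
    ⟦ 2 * n ⟧ ℚ.* (0ℚ ℚ.+ B n k)                      ≡⟨ cong (λ x → ⟦ 2 * n ⟧ ℚ.* (x ℚ.+ B n k)) (A-∤ n k k∤n) ⟨
    ⟦ 2 * n ⟧ ℚ.* f n k                               ∎
    where
    open ≡-Reasoning
    2∣k : 2 ∣ k
    2∣k = divides κ (trans k≡ (*-comm 2 κ))
    κ<k : κ < k
    κ<k = subst (κ <_) (sym k≡) (m<m+n κ z<s)
    n≡κ+sk : n ≡ κ + s * k
    n≡κ+sk = *-cancelˡ-≡ n (κ + s * k) 2 (trans (sym kq≡2n) (trans (cong₂ _*_ k≡ e)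
      (trans (split κ s) (cong (λ k → 2 * (κ + s * k)) (sym k≡)))))
      where
      split : ∀ κ s → 2 * κ * suc (s + s) ≡ 2 * (κ + s * (2 * κ))
      split = solve-∀
    k∤n : ¬ k ∣ n
    k∤n k∣n = >⇒∤ κ<k (∣m+n∣m⇒∣n (subst (k ∣_) (trans n≡κ+sk (+-comm κ (s * k))) k∣n) (n∣m*n s))
    n-1 : (n ∸ 1) div k ≡ s
    n-1 = trans (cong (λ m → (m ∸ 1) div k) n≡κ+sk) (div-unique {κ-1} s (<-trans (n<1+n κ-1) κ<k))

parity : ∀ q → ∃ λ s → q ≡ s + s ⊎ q ≡ suc (s + s)
parity zero    = 0 , inj₁ refl
parity (suc q) with parity q
... | s , inj₁ e = s , inj₂ (cong suc e)
... | s , inj₂ e = suc s , inj₁ (trans (cong suc e) (cong suc (sym (+-suc s s))))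

2∣s+s : ∀ s → 2 ∣ s + s
2∣s+s s = divides s (double s)
  where
  double : ∀ s → s + s ≡ s * 2
  double = solve-∀

2∤odd : ∀ s → ¬ 2 ∣ suc (s + s)
2∤odd s d = >⇒∤ (s<s z<s) (∣m+n∣m⇒∣n (subst (2 ∣_) (+-comm 1 (s + s)) d) (2∣s+s s))

invariant-count : ∀ {n k q} .{{_ : NonZero n}} .{{_ : NonZero k}} → k * q ≡ 2 * n →
                  ∃ λ e → Halves k e × ⟦ number e k q ⟧ ≡ ⟦ 2 * n ⟧ ℚ.* f n k
invariant-count {n} {k} {q} kq≡2n with parity k | parity q
... | κ , inj₁ k≡ | s , inj₁ q≡ =
  1 , subst (λ k → Halves k 1) (sym k≡2κ) (even-halves κ {{κ≢0}}) , closed-even-even kq≡2n s (subst (2 ∣_) (sym k≡) (2∣s+s κ)) q≡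
  where
  k≡2κ = trans k≡ (cong (κ +_) (sym (+-identityʳ κ)))
  κ≢0 = ≢-nonZero (λ κ≡0 → ≢-nonZero⁻¹ k (trans k≡ (cong₂ _+_ κ≡0 κ≡0)))
... | κ , inj₁ k≡ | s , inj₂ q≡ =
  1 , subst (λ k → Halves k 1) (sym k≡2κ) (even-halves κ {{κ≢0}}) , closed-even-odd kq≡2n κ s k≡2κ q≡
  where
  k≡2κ = trans k≡ (cong (κ +_) (sym (+-identityʳ κ)))
  κ≢0 = ≢-nonZero (λ κ≡0 → ≢-nonZero⁻¹ k (trans k≡ (cong₂ _+_ κ≡0 κ≡0)))
... | κ , inj₂ k≡ | s , inj₁ q≡ =
  0 , subst (λ k → Halves k 0) (sym (trans k≡ (cong (λ x → suc (κ + x)) (sym (+-identityʳ κ))))) (odd-halves κ) ,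
  closed-odd kq≡2n s (λ d → 2∤odd κ (subst (2 ∣_) k≡ d)) q≡
... | κ , inj₂ k≡ | s , inj₂ q≡ = contradiction
  (subst (2 ∣_) (trans (sym kq≡2n) (trans (cong₂ _*_ k≡ q≡) (odd-product κ s))) (m∣m*n n)) (2∤odd (κ + s + (κ * s + κ * s)))
  where
  odd-product : ∀ κ s → suc (κ + κ) * suc (s + s) ≡ suc (κ + s + (κ * s + κ * s) + (κ + s + (κ * s + κ * s)))
  odd-product = solve-∀

-- Möbius inversion over the periods

𝟙-× : ∀ {P Q : Set} (d : Dec P) (e : Dec Q) x → 𝟙 (d ×-dec e) ℚ.* x ≡ 𝟙 d ℚ.* (𝟙 e ℚ.* x)
𝟙-× (yes _) (yes _) x = sym (ℚ.*-identityˡ (1ℚ ℚ.* x))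
𝟙-× (yes _) (no _)  x = sym (ℚ.*-identityˡ (0ℚ ℚ.* x))
𝟙-× (no _)  e       x = trans (ℚ.*-zeroˡ x) (sym (ℚ.*-zeroˡ (𝟙 e ℚ.* x)))

𝟙-under : ∀ {P : Set} (d : Dec P) {x y} → (P → x ≡ y) → 𝟙 d ℚ.* x ≡ 𝟙 d ℚ.* y
𝟙-under (yes p) e = cong (1ℚ ℚ.*_) (e p)
𝟙-under (no _) {x} {y} e = trans (ℚ.*-zeroˡ x) (sym (ℚ.*-zeroˡ y))

-- Writing k = j d turns the divisors of 2n that are multiples of d into the divisors j of p.
formula-∑< : ∀ n d p .{{_ : NonZero d}} → 2 * n ≡ p * d →
             formula n d ≡ ⟦ d ⟧ ℚ.* ∑< p (λ j → 𝟙 (suc j ∣? p) ℚ.* (f n (suc j * d) ℚ.* μℚ (suc j)))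
formula-∑< n d p 2n≡pd = cong (⟦ d ⟧ ℚ.*_) (begin
  sumℚ (map F (filter P? (map suc (upTo (2 * n)))))
    ≡⟨ cong (λ xs → sumℚ (map F (filter P? xs))) (map-upTo suc (2 * n)) ⟩
  sumℚ (map F (filter P? (applyUpTo suc (2 * n))))
    ≡⟨ sum-filter P? F (2 * n) suc ⟩
  ∑< (2 * n) (λ j → 𝟙 (P? (suc j)) ℚ.* F (suc j))
    ≡⟨ ∑<-cong (2 * n) (λ j _ → 𝟙-× (d ∣? suc j) (suc j ∣? 2 * n) (F (suc j))) ⟩
  ∑< (2 * n) (λ j → 𝟙 (d ∣? suc j) ℚ.* g (suc j))
    ≡⟨ cong (λ N → ∑< N (λ j → 𝟙 (d ∣? suc j) ℚ.* g (suc j))) 2n≡pd ⟩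
  ∑< (p * d) (λ j → 𝟙 (d ∣? suc j) ℚ.* g (suc j))
    ≡⟨ ∑<-multiples d p g ⟩
  ∑< p (λ j → g (suc j * d))
    ≡⟨ ∑<-cong p (λ j _ → cong₂ ℚ._*_
         (𝟙-cong (suc j * d ∣? 2 * n) (suc j ∣? p)
           (λ h → *-cancelʳ-∣ d (subst (suc j * d ∣_) 2n≡pd h)) (λ h → subst (suc j * d ∣_) (sym 2n≡pd) (*-monoˡ-∣ d h)))
         (cong (λ m → f n (suc j * d) ℚ.* μℚ m) (div-exact d (suc j)))) ⟩
  ∑< p (λ j → 𝟙 (suc j ∣? p) ℚ.* (f n (suc j * d) ℚ.* μℚ (suc j))) ∎)
  where
  open ≡-Reasoning
  P? : ∀ k → Dec (d ∣ k × k ∣ 2 * n)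
  P? k = (d ∣? k) ×-dec (k ∣? (2 * n))
  F g : ℕ → ℚ
  F k = f n k ℚ.* μℚ (k div d)
  g k = 𝟙 (k ∣? 2 * n) ℚ.* F k

-- Möbius inversion for a single matching. Let p₀ be its period: p/j is a symmetry exactly when p₀
-- divides p/j. If p = m p₀ this says that j divides m, and the sum of μ(j) over such j is 1 for m =
-- 1 and 0 otherwise. If p₀ does not divide p, all terms vanish.
period-∑< : ∀ {N} .{{_ : NonZero N}} (x : Matching N) p .{{_ : NonZero p}} →
            ∑< p (λ j → 𝟙 (suc j ∣? p) ℚ.* (μℚ (suc j) ℚ.* 𝟙 (shift? x x (p / suc j)))) ≡ 𝟙 (period? x p)
period-∑< {N} x p = by-cases (period x) (λ p₀ → p₀ ∣? p)
  where
  S = ∑< p (λ j → 𝟙 (suc j ∣? p) ℚ.* (μℚ (suc j) ℚ.* 𝟙 (shift? x x (p / suc j))))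
  coprime-period : ∀ p₀ → Period x p₀ → ¬ p₀ ∣ p → S ≡ 𝟙 (period? x p)
  coprime-period p₀ P₀ p₀∤p = trans
    (trans (∑<-cong p {h = λ _ → 0ℚ} (λ j _ → trans (𝟙-under (suc j ∣? p) (vanish j)) (ℚ.*-zeroʳ (𝟙 (suc j ∣? p))))) (∑<-zero p (λ _ → refl)))
    (sym (𝟙-no (period? x p) (λ P → p₀∤p (∣-reflexive (period-unique {x = x} P₀ P)))))
    where
    vanish : ∀ j → suc j ∣ p → μℚ (suc j) ℚ.* 𝟙 (shift? x x (p / suc j)) ≡ 0ℚ
    vanish j j∣p = trans (cong (μℚ (suc j) ℚ.*_) (𝟙-no (shift? x x (p / suc j))
      (λ e → p₀∤p (∣-trans (Equivalence.to (P₀ _) e) (m/n∣m j∣p))))) (ℚ.*-zeroʳ (μℚ (suc j)))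
  multiple : ∀ p₀ → Period x p₀ → ∀ m → p ≡ m * p₀ → S ≡ 𝟙 (period? x p)
  multiple p₀ P₀ m p≡mp₀ = begin
    S                              ≡⟨ ∑<-cong p (λ j _ → pointwise j) ⟩
    ∑< p w                         ≡⟨ cong (λ p → ∑< p w) (trans p≡mp₀ (sym (m+[n∸m]≡n (m≤m*n m p₀ {{p₀≢0}})))) ⟩
    ∑< (m + (m * p₀ ∸ m)) w        ≡⟨ ∑<-extend m _ w (λ j → 𝟙-0 (suc (m + j) ∣? m) (>⇒∤ {{m≢0}} (s≤s (m≤m+n m j))) _) ⟩
    ∑μ m                           ≡⟨ ∑μ≡𝟙 m {{m≢0}} ⟩
    𝟙 (m ≟ 1)                      ≡⟨ 𝟙-cong (m ≟ 1) (period? x p)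
                                        (λ m≡1 → subst (Period x) (sym (trans p≡mp₀ (trans (cong (_* p₀) m≡1) (*-identityˡ p₀)))) P₀)
                                        (λ P → *-cancelʳ-≡ m 1 p₀ {{p₀≢0}} (trans (sym p≡mp₀)
                                               (trans (period-unique {x = x} P P₀) (sym (*-identityˡ p₀))))) ⟩
    𝟙 (period? x p)                ∎
    where
    open ≡-Reasoning
    w : ℕ → ℚ
    w j = 𝟙 (suc j ∣? m) ℚ.* μℚ (suc j)
    m≢0 : NonZero m
    m≢0 = ≢-nonZero (λ m≡0 → ≢-nonZero⁻¹ p (trans p≡mp₀ (cong (_* p₀) m≡0)))
    p₀≢0 : NonZero p₀
    p₀≢0 = ≢-nonZero (λ p₀≡0 → ≢-nonZero⁻¹ p (trans p≡mp₀ (trans (cong (m *_) p₀≡0) (*-zeroʳ m))))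
    shift⇔ : ∀ j → suc j ∣ p → Shift x x (p / suc j) ⇔ suc j ∣ m
    shift⇔ j j∣p = mk⇔
      (λ e → *-cancelʳ-∣ p₀ {{p₀≢0}} (subst (suc j * p₀ ∣_) p≡mp₀ (m∣n/o⇒o*m∣n j∣p (Equivalence.to (P₀ _) e))))
      (λ j∣m → Equivalence.from (P₀ _) (m*n∣o⇒n∣o/m (suc j) p₀ (subst (suc j * p₀ ∣_) (sym p≡mp₀) (*-monoˡ-∣ p₀ j∣m))))
    pointwise : ∀ j → 𝟙 (suc j ∣? p) ℚ.* (μℚ (suc j) ℚ.* 𝟙 (shift? x x (p / suc j))) ≡ w j
    pointwise j = begin
      𝟙 (suc j ∣? p) ℚ.* (μℚ (suc j) ℚ.* 𝟙 (shift? x x (p / suc j)))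
        ≡⟨ 𝟙-under (suc j ∣? p) (λ j∣p → trans (cong (μℚ (suc j) ℚ.*_)
             (𝟙-cong (shift? x x (p / suc j)) (suc j ∣? m) (Equivalence.to (shift⇔ j j∣p)) (Equivalence.from (shift⇔ j j∣p))))
             (ℚ.*-comm (μℚ (suc j)) (𝟙 (suc j ∣? m)))) ⟩
      𝟙 (suc j ∣? p) ℚ.* w j
        ≡⟨ absorb (suc j ∣? m) ⟩
      w j ∎
      where
      absorb : (d : Dec (suc j ∣ m)) → 𝟙 (suc j ∣? p) ℚ.* (𝟙 d ℚ.* μℚ (suc j)) ≡ 𝟙 d ℚ.* μℚ (suc j)
      absorb (yes j∣m) = 𝟙-1 (suc j ∣? p) (subst (suc j ∣_) (sym p≡mp₀) (∣m⇒∣m*n p₀ j∣m)) _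
      absorb (no _)    = trans (cong (𝟙 (suc j ∣? p) ℚ.*_) (ℚ.*-zeroˡ (μℚ (suc j))))
        (trans (ℚ.*-zeroʳ (𝟙 (suc j ∣? p))) (sym (ℚ.*-zeroˡ (μℚ (suc j)))))
  by-cases : (∃ λ p₀ → 0 < p₀ × Period x p₀) → (∀ p₀ → Dec (p₀ ∣ p)) → S ≡ 𝟙 (period? x p)
  by-cases (p₀ , _ , P₀) dec = by-dec (dec p₀)
    where
    by-dec : Dec (p₀ ∣ p) → S ≡ 𝟙 (period? x p)
    by-dec (yes (divides m p≡)) = multiple p₀ P₀ m p≡
    by-dec (no p₀∤p)            = coprime-period p₀ P₀ p₀∤p

-- Counting the rotation classes of a given period

module Orbits {n size : ℕ} .{{_ : NonZero n}} (matchings : Enum (_≈ᵐ_ {2 * n}) (λ x → Shift x x (2 * n)) size) where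
  open Enum matchings using (at; distinct; find)

  private
    N = 2 * n
    instance
      N≢0 : NonZero N
      N≢0 = m*n≢0 2 n

  sub-enum : ∀ {Q : Matching N → Set} → (∀ {x y} → x ≈ᵐ y → Q x → Q y) → (Q? : ∀ x → Dec (Q x)) →
             Enum (_≈ᵐ_ {N}) Q (count (λ i → Q? (at i)))
  sub-enum {Q} resp Q? = enum-cong ≈ᵐ-isEquivalence proj₁ (λ {x} q → q , find x (shift-N x))
    (enum-filter ≈ᵐ-isEquivalence at distinct {Q} (λ {x} {y} → resp {x} {y}) (λ i → Q? (at i)))

  shift-resp-≈ : ∀ {q} {x y : Matching N} → x ≈ᵐ y → Shift x x q → Shift y y q
  shift-resp-≈ {q} {x} {y} e s t = mod-trans (mod-sym (e (t + q))) (mod-trans (s t) (mod-+ʳ q (e t)))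

  count-shifts : ∀ k q .{{_ : NonZero k}} → k * q ≡ N →
                 ⟦ count (λ i → shift? (at i) (at i) q) ⟧ ≡ ⟦ N ⟧ ℚ.* f n k
  count-shifts k q kq≡N = from-closed (invariant-count {n} {k} {q} kq≡N)
    where
    q≢0 : NonZero q
    q≢0 = ≢-nonZero (λ q≡0 → ≢-nonZero⁻¹ N (trans (sym kq≡N) (trans (cong (k *_) q≡0) (*-zeroʳ k))))
    count≡ : ∀ {e} → Halves k e → count (λ i → shift? (at i) (at i) q) ≡ number e k q
    count≡ H = enum-unique ≈ᵐ-isEquivalence {P = λ x → Shift x x q} {λ x → Shift x x q} id id
      (sub-enum (λ {x} {y} → shift-resp-≈ {q} {x} {y}) (λ x → shift? x x q))
      (invariant-enum {{q≢0}} (trans (*-comm q k) kq≡N) H)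
    from-closed : (∃ λ e → Halves k e × ⟦ number e k q ⟧ ≡ ⟦ N ⟧ ℚ.* f n k) →
                  ⟦ count (λ i → shift? (at i) (at i) q) ⟧ ≡ ⟦ N ⟧ ℚ.* f n k
    from-closed (e , H , closed) = trans (cong ⟦_⟧ (count≡ H)) closed

  period-enum : ∀ p → Enum (_≈ᵐ_ {N}) (λ x → Period x p) (count (λ i → period? (at i) p))
  period-enum p = sub-enum (λ {x} {y} e → period-resp {x = x} {y} (0 , shift-0 {x = x} {y} e)) (λ x → period? x p)

  orbits : ∀ p → ∃ λ r → Enum (_∼ᵐ_ {N}) (λ x → Period x p) r
  orbits p =
    let r , R = representatives ∼ᵐ-isEquivalence _∼ᵐ?_ E.at
    in r , enum-cong ∼ᵐ-isEquivalence
      (λ {x} (i , e) → period-resp {x = E.at i} {x} (∼ᵐ-sym {x = x} {E.at i} e) (E.holds i))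
      (λ {x} P → let i , e = E.find x P in i , 0 , shift-0 {x = x} {E.at i} e) R
    where module E = Enum (period-enum p)

  -- Multiplied by N = p d, the number r becomes d times the number r p of matchings of period p.
  -- Inversion expresses the latter as N times the sum in the formula, and N cancels.
  orbit-count : ∀ d p r → N ≡ p * d → Enum (_∼ᵐ_ {N}) (λ x → Period x p) r → ⟦ r ⟧ ≡ formula n d
  orbit-count d p r N≡pd R = ⟦⟧-cancel N (begin
    ⟦ r ⟧ ℚ.* ⟦ N ⟧
      ≡⟨ ⟦⟧-* r N ⟨
    ⟦ r * N ⟧
      ≡⟨ cong ⟦_⟧ (trans (cong (r *_) N≡pd) (trans (sym (*-assoc r p d)) (*-comm (r * p) d))) ⟩
    ⟦ d * (r * p) ⟧
      ≡⟨ ⟦⟧-* d (r * p) ⟩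
    ⟦ d ⟧ ℚ.* ⟦ r * p ⟧
      ≡⟨ cong (λ l → ⟦ d ⟧ ℚ.* ⟦ l ⟧) (enum-unique ≈ᵐ-isEquivalence {P = λ x → Period x p} {λ x → Period x p} id id
           (orbit-enum (>-nonZero⁻¹ p {{p≢0}}) R) (period-enum p)) ⟩
    ⟦ d ⟧ ℚ.* ⟦ count (λ i → period? (at i) p) ⟧
      ≡⟨ cong (⟦ d ⟧ ℚ.*_) inversion ⟩
    ⟦ d ⟧ ℚ.* (∑< p (λ j → 𝟙 (suc j ∣? p) ℚ.* (f n (suc j * d) ℚ.* μℚ (suc j))) ℚ.* ⟦ N ⟧)
      ≡⟨ ℚ.*-assoc ⟦ d ⟧ _ ⟦ N ⟧ ⟨
    ⟦ d ⟧ ℚ.* ∑< p (λ j → 𝟙 (suc j ∣? p) ℚ.* (f n (suc j * d) ℚ.* μℚ (suc j))) ℚ.* ⟦ N ⟧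
      ≡⟨ cong (ℚ._* ⟦ N ⟧) (formula-∑< n d p {{d≢0}} N≡pd) ⟨
    formula n d ℚ.* ⟦ N ⟧ ∎)
    where
    open ≡-Reasoning
    p≢0 : NonZero p
    p≢0 = ≢-nonZero (λ p≡0 → ≢-nonZero⁻¹ N (trans N≡pd (cong (_* d) p≡0)))
    d≢0 : NonZero d
    d≢0 = ≢-nonZero (λ d≡0 → ≢-nonZero⁻¹ N (trans N≡pd (trans (cong (p *_) d≡0) (*-zeroʳ p))))
    shifts : ℕ → ℚ
    shifts j = sum (λ i → 𝟙 (shift? (at i) (at i) (p / suc j)))
    -- The counted matchings are those invariant under translation by q = p/j, that is k = j d,
    -- since j d (p/j) = p d = 2n.
    shifts≡ : ∀ j → suc j ∣ p → shifts j ≡ ⟦ N ⟧ ℚ.* f n (suc j * d)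
    shifts≡ j j∣p = trans (sym (⟦count⟧ (λ i → shift? (at i) (at i) (p / suc j))))
      (count-shifts (suc j * d) (p / suc j) {{m*n≢0 (suc j) d {{_}} {{d≢0}}}}
        (trans (regroup (suc j) d (p / suc j)) (trans (cong (_* d) (m/n*n≡m j∣p)) (sym N≡pd))))
      where
      regroup : ∀ j d q → j * d * q ≡ q * j * d
      regroup = solve-∀
    arrange : ∀ u x y z → u ℚ.* (x ℚ.* (y ℚ.* z)) ≡ u ℚ.* (z ℚ.* x) ℚ.* y
    arrange = solve 4 (λ u x y z → u :* (x :* (y :* z)) := u :* (z :* x) :* y) refl
      where open +-*-Solver
    -- The identity for a single matching is summed over all matchings; after exchanging the sums,
    -- the inner one counts the matchings invariant under p/j.
    inversion : ⟦ count (λ i → period? (at i) p) ⟧ ≡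
                ∑< p (λ j → 𝟙 (suc j ∣? p) ℚ.* (f n (suc j * d) ℚ.* μℚ (suc j))) ℚ.* ⟦ N ⟧
    inversion = begin
      ⟦ count (λ i → period? (at i) p) ⟧
        ≡⟨ ⟦count⟧ (λ i → period? (at i) p) ⟩
      sum (λ i → 𝟙 (period? (at i) p))
        ≡⟨ sum-cong-≗ (λ i → period-∑< (at i) p {{p≢0}}) ⟨
      sum (λ i → ∑< p (λ j → 𝟙 (suc j ∣? p) ℚ.* (μℚ (suc j) ℚ.* 𝟙 (shift? (at i) (at i) (p / suc j)))))
        ≡⟨ ∑-comm (λ i (j : Fin p) → 𝟙 (suc (toℕ j) ∣? p) ℚ.* (μℚ (suc (toℕ j)) ℚ.* 𝟙 (shift? (at i) (at i) (p / suc (toℕ j))))) ⟩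
      ∑< p (λ j → sum (λ i → 𝟙 (suc j ∣? p) ℚ.* (μℚ (suc j) ℚ.* 𝟙 (shift? (at i) (at i) (p / suc j)))))
        ≡⟨ ∑<-cong p (λ j _ → factor j) ⟩
      ∑< p (λ j → 𝟙 (suc j ∣? p) ℚ.* (f n (suc j * d) ℚ.* μℚ (suc j)) ℚ.* ⟦ N ⟧)
        ≡⟨ *-distribʳ-sum ⟦ N ⟧ (λ (j : Fin p) → 𝟙 (suc (toℕ j) ∣? p) ℚ.* (f n (suc (toℕ j) * d) ℚ.* μℚ (suc (toℕ j)))) ⟨
      ∑< p (λ j → 𝟙 (suc j ∣? p) ℚ.* (f n (suc j * d) ℚ.* μℚ (suc j))) ℚ.* ⟦ N ⟧ ∎
      where
      factor : ∀ j → sum (λ i → 𝟙 (suc j ∣? p) ℚ.* (μℚ (suc j) ℚ.* 𝟙 (shift? (at i) (at i) (p / suc j)))) ≡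
                     𝟙 (suc j ∣? p) ℚ.* (f n (suc j * d) ℚ.* μℚ (suc j)) ℚ.* ⟦ N ⟧
      factor j = begin
        sum (λ i → 𝟙 (suc j ∣? p) ℚ.* (μℚ (suc j) ℚ.* s i))
          ≡⟨ *-distribˡ-sum (𝟙 (suc j ∣? p)) (λ i → μℚ (suc j) ℚ.* s i) ⟨
        𝟙 (suc j ∣? p) ℚ.* sum (λ i → μℚ (suc j) ℚ.* s i)
          ≡⟨ cong (𝟙 (suc j ∣? p) ℚ.*_) (*-distribˡ-sum (μℚ (suc j)) s) ⟨
        𝟙 (suc j ∣? p) ℚ.* (μℚ (suc j) ℚ.* shifts j)
          ≡⟨ 𝟙-under (suc j ∣? p) (λ j∣p → cong (μℚ (suc j) ℚ.*_) (shifts≡ j j∣p)) ⟩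
        𝟙 (suc j ∣? p) ℚ.* (μℚ (suc j) ℚ.* (⟦ N ⟧ ℚ.* f n (suc j * d)))
          ≡⟨ arrange (𝟙 (suc j ∣? p)) (μℚ (suc j)) ⟦ N ⟧ (f n (suc j * d)) ⟩
        𝟙 (suc j ∣? p) ℚ.* (f n (suc j * d) ℚ.* μℚ (suc j)) ℚ.* ⟦ N ⟧ ∎
        where
        s : Fin size → ℚ
        s i = 𝟙 (shift? (at i) (at i) (p / suc j))

-- Each rotation class is realised by a map whose matching agrees with the representative only up to
-- rotation, so periods and orbits are all transferred along `∼ᵐ`.
representative-maps : ∀ {n} .{{_ : NonZero n}} (x₀ : Nc n) d p r → d * p ≡ 2 * n →
                      Enum (_∼ᵐ_ {2 * n}) (λ x → Period x p) r → NumSymmetricImbeddings n d r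
representative-maps {n} x₀ d p r dp≡2n R =
  tabulate M , length-tabulate M ,
  All.tabulate⁺ (λ i → period⇒stab x₀ {M i} dp≡2n
    (period-resp {x = R.at i} {h (M i)} (∼ᵐ-sym {x = h (M i)} {R.at i} (h-M i)) (R.holds i))) ,
  AllPairs.tabulate⁺ (λ {i} {j} i≢j o → i≢j (R.distinct {i} {j}
    (∼-trans {R.at i} {h (M i)} {R.at j} (∼ᵐ-sym {x = h (M i)} {R.at i} (h-M i))
      (∼-trans {h (M i)} {h (M j)} {R.at j} (sameOrbit⇒∼ x₀ {M i} {M j} o) (h-M j))))) ,
  λ M′ stab →
    let i , e = R.find (h M′) (stab⇒period x₀ {M′} dp≡2n stab)
    in Any.tabulate⁺ i (∼⇒sameOrbit x₀ {M′} {M i}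
         (∼-trans {h M′} {R.at i} {h (M i)} e (∼ᵐ-sym {x = h (M i)} {R.at i} (h-M i))))
  where
  instance
    2n≢0 : NonZero (2 * n)
    2n≢0 = m*n≢0 2 n
  module R = Enum R
  open IsEquivalence (∼ᵐ-isEquivalence {2 * n}) using () renaming (trans to ∼-trans)
  h = Position.matching x₀
  M : Fin r → Map n
  M i = proj₁ (realise x₀ (R.at i))
  h-M : ∀ i → h (M i) ∼ᵐ R.at i
  h-M i = proj₂ (realise x₀ (R.at i))

-- Translation by N acts trivially, so the invariant matchings for q = N and k = 1 are all
-- matchings; `odd-halves 0` applies because ℤ/1 has no element of order two.
all-matchings : ∀ N .{{_ : NonZero N}} → Enum (_≈ᵐ_ {N}) (λ x → Shift x x N) (number 0 1 N)
all-matchings N = invariant-enum {N} {N} {1} (*-identityʳ N) (odd-halves 0)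

theorem13 : (n d : ℕ) → 1 ≤ n → d ∣ 2 * n →
    ∃ λ (i : ℕ) → NumSymmetricImbeddings n d i × ⟦ i ⟧ ≡ formula n d
theorem13 n d 1≤n (divides p 2n≡pd) =
  let r , R = orbits p
  -- The base point is the vertex a with index 0, which exists because n ≥ 1.
  in r , representative-maps (fromℕ< 1≤n , false) d p r (trans (*-comm d p) (sym 2n≡pd)) R ,
     orbit-count d p r 2n≡pd R
  where
  instance
    n≢0 : NonZero n
    n≢0 = >-nonZero 1≤n
    2n≢0 : NonZero (2 * n)
    2n≢0 = m*n≢0 2 n
  open Orbits {n} (all-matchings (2 * n)) using (orbits; orbit-count)
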